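{- Let $k\ge 5$ be an odd integer and let $\Gamma$ be a connected amply regular graph with diameter $d=4$ and parameters $(v,k,0,\mu)$, where $\mu=\frac{k-1}{2}$. Then the following are equivalent: (1) $\Gamma$ is a bipartite $Q$-regular graph with distribution diagram $\mathcal Q_k$ (defined in the context). (2) $\Gamma$ is the point--block incidence graph of a $GDDDP\left(2,k+1;\,k;\,0,\frac{k-1}{2}\right)$. (3) $\Gamma$ is a relation graph with respect to a relation $R$ of a symmetric association scheme $(X,\mathcal R)$ with $5$ classes such that the distribution diagram of $(X,\mathcal R)$ with respect to $R$ is $\mathcal Q_k$. In particular, $\Gamma$ is a bipartite $2$-walk-regular graph of order $4k+4$, diameter $4$, with exactly $6$ distinct eigenvalues.
   Context: All graphs are finite, simple and undirected. An amply regular graph with parameters $(v,k,\lambda,\mu)$ is a $k$-regular graph on $v$ vertices such that every pair of adjacent vertices has exactly $\lambda$ common neighbors and every pair of vertices at distance two has exactly $\mu$ common neighbors. A partition $\{B_1,\dots,B_n\}$ of $V(\Gamma)$ is equitable with quotient matrix $Q=(q_{ij})$ if every vertex of $B_i$ has exactly $q_{ij}$ neighbors in $B_j$, for all $i,j$. The distribution diagram of the partition records the sizes $|B_i|$ and the numbers $q_{ij}$ (it is used interchangeably with the quotient matrix). $\Gamma$ is $Q$-regular if for each vertex $x$ there is an equitable partition of $V(\Gamma)$ with quotient matrix $Q$ such that $\{x\}$ is a part. The distribution diagram $\mathcal Q_k$ has six cells $P_0,P_1,P_2,P_3,P_4,P_5$ of sizes $1,\ k,\ 2k,\ k,\ 1,\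 2$ respectively, with $P_0=\{x\}$, and with the following quotient numbers (all unlisted ones are $0$): $q_{01}=k$; $q_{10}=1$, $q_{12}=k-1$; $q_{21}=\frac{k-1}{2}$, $q_{23}=\frac{k-1}{2}$, $q_{25}=1$; $q_{32}=k-1$, $q_{34}=1$; $q_{43}=k$; $q_{52}=k$. A symmetric association scheme with $n$ classes is a pair $(X,\mathcal R)$, with $X$ a finite set and $\mathcal R=\{R_0,\dots,R_n\}$ a collection of non-empty subsets of $X\times X$ whose adjacency matrices $F_0,\dots,F_n$ are symmetric, with $F_0=I$, $\sum_i F_i=J$ (all-ones matrix), and each $F_iF_j$ a linear combination of $F_0,\dots,F_n$. The relation graph of $R_i$ ($i\ge1$) is the graph $(X,R_i)$. The distribution diagram of $(X,\mathcal R)$ with respect to $R_i$ is the distribution diagram of the graph $(X,R_i)$ with respect to the equitable partition $\{B_0,\dots,B_n\}$, $B_j=\{y\in X:(x,y)\in R_j\}$, for a vertex $x$ (it does not depend on $x$); cells are matched with $\mathcal Q_k$ up to ordering of the relations, with $B_0=\{x\}$ corresponding to $P_0$. A connected graph is $2$-walk-regular if for every $\ell\ge0$ and every pair of vertices $x,y$ at distance $i\le 2$, the number of walks of length $\ell$ from $x$ to $y$ depends only on $\ell$ and $i$. Eigenvalues of a graph are those of its adjacency matrix. A group divisible design $GDD(n,m;k;\lambda_1,\lambda_2)$ is a triple $(\mathcal P,\mathcal G,\mathcal B)$ consisting of a set $\mathcal P$ of points, a partition $\mathcal G$ of $\mathcal P$ into $m$ subsets of size $n$ (groups), and a collection $\mathcal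 B$ of $k$-subsets of $\mathcal P$ (blocks), such that each pair of distinct points from the same group appears in exactly $\lambda_1$ blocks and each pair of points from different groups appears in exactly $\lambda_2$ blocks. Its dual incidence structure has point set $\mathcal B$ and block set $\mathcal P$, where $p\in\mathcal P$ is identified with the set of blocks containing $p$. If there is a partition $\mathcal G'$ of $\mathcal B$ such that $(\mathcal B,\mathcal G',\mathcal P)$ is a $GDD(n,m;k;\lambda_1,\lambda_2)$ (same parameters), the design is called a group divisible design with the dual property, denoted $GDDDP(n,m;k;\lambda_1,\lambda_2)$. The point--block incidence graph has vertex set $\mathcal P\cup\mathcal B$ (disjoint union), with a point and a block adjacent iff they are incident, and no other adjacencies. -}

module Defs where

open import Algebra.Bundles using (CommutativeRing)
open import Algebra.Structures using (IsCommutativeRing)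
import Algebra.Definitions.RawMonoid as RawMonoidDefs
open import Data.Bool.Base using (Bool; true; false; if_then_else_; T)
open import Data.Empty using (⊥-elim)
open import Data.Fin.Base using (Fin; zero; suc)
open import Data.Fin.Patterns using (0F; 1F; 2F; 3F; 4F; 5F)
import Data.Fin.Properties as Fin
open import Data.Fin.Permutation using (Permutation′; _⟨$⟩ʳ_)
open import Data.Fin.Subset using (Subset; _∈_; _∩_; ∣_∣; ⁅_⁆; Nonempty)
open import Data.Nat.Base as ℕ using (ℕ; zero; suc; _∸_; _/_; _⊔_)
import Data.Nat.Properties as ℕ
open import Data.Product.Base using (Σ-syntax; ∃-syntax; _×_; _,_; proj₁; proj₂)
open import Data.Rational.Base as ℚ using (ℚ; 0ℚ; 1ℚ; ½)
import Data.Rational.Properties as ℚ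
open import Data.Rational.Solver using (module +-*-Solver)
open +-*-Solver using (solve; _:=_; _:+_; _:*_; _:-_; :-_)
open import Data.Sum.Base using (_⊎_; inj₁; inj₂)
open import Data.Vec.Base using (tabulate; lookup)
open import Function.Base using (_∘_)
open import Function.Bundles using (_↔_; Inverse)
open import Level using (0ℓ)
open import Relation.Binary.PropositionalEquality
open import Relation.Nullary.Decidable using (does; yes; no; dec-true)
open import Relation.Nullary.Negation using (¬_)

split : ∀ a b → a ≡ b ℚ.+ (a ℚ.- b)
split = solve 2 (λ a b → a := b :+ (a :- b)) refl

telescope : ∀ a b c → (a ℚ.- b) ℚ.+ (b ℚ.- c) ≡ a ℚ.- c
telescope = solve 3 (λ a b c → (a :- b) :+ (b :- c) := a :- c) refl

neg-sub : ∀ a b → ℚ.- (a ℚ.- b) ≡ b ℚ.- a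
neg-sub = solve 2 (λ a b → :- (a :- b) := b :- a) refl

neg-sub′ : ∀ a b → ℚ.- (a ℚ.- b) ≡ (ℚ.- a) ℚ.- (ℚ.- b)
neg-sub′ = solve 2 (λ a b → :- (a :- b) := (:- a) :- (:- b)) refl

add-sub : ∀ a b c d → (a ℚ.- b) ℚ.+ (c ℚ.- d) ≡ (a ℚ.+ c) ℚ.- (b ℚ.+ d)
add-sub = solve 4 (λ a b c d → (a :- b) :+ (c :- d) := (a :+ c) :- (b :+ d)) refl

mul-sub : ∀ a b c d →
  a ℚ.* (c ℚ.- d) ℚ.+ d ℚ.* (a ℚ.- b) ≡ a ℚ.* c ℚ.- b ℚ.* d
mul-sub = solve 4 (λ a b c d →
  a :* (c :- d) :+ d :* (a :- b) := a :* c :- b :* d) refl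

module Null {I : Set} (Tail : ℕ → I → Set)
            (mono : ∀ {M N i} → M ℕ.≤ N → Tail N i → Tail M i) where

  IsNull : (I → ℚ) → Set
  IsNull z = ∀ ε → 0ℚ ℚ.< ε → ∃[ N ] (∀ i → Tail N i → ℚ.∣ z i ∣ ℚ.< ε)

  IsBounded : (I → ℚ) → Set
  IsBounded z = ∃[ B ] (0ℚ ℚ.< B × ∃[ N ] (∀ i → Tail N i → ℚ.∣ z i ∣ ℚ.≤ B))

  null-cong : ∀ {y z} → (∀ i → y i ≡ z i) → IsNull y → IsNull z
  null-cong eq ny ε 0<ε with ny ε 0<ε
  ... | N , h = N , λ i t → subst (λ q → ℚ.∣ q ∣ ℚ.< ε) (eq i) (h i t)

  null-0 : ∀ {z} → (∀ i → z i ≡ 0ℚ) → IsNull z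
  null-0 eq ε 0<ε = 0 , λ i _ → subst (λ q → ℚ.∣ q ∣ ℚ.< ε) (sym (eq i)) 0<ε

  null-neg : ∀ {z} → IsNull z → IsNull (λ i → ℚ.- z i)
  null-neg {z} nz ε 0<ε with nz ε 0<ε
  ... | N , h = N , λ i t → subst (ℚ._< ε) (sym (ℚ.∣-p∣≡∣p∣ (z i))) (h i t)

  null-+ : ∀ {y z} → IsNull y → IsNull z → IsNull (λ i → y i ℚ.+ z i)
  null-+ {y} {z} ny nz ε 0<ε = M ⊔ N , λ i t →
    ℚ.≤-<-trans (ℚ.∣p+q∣≤∣p∣+∣q∣ (y i) (z i))
      (subst (ℚ.∣ y i ∣ ℚ.+ ℚ.∣ z i ∣ ℚ.<_) δ+δ
        (ℚ.+-mono-< (proj₂ (ny δ 0<δ) i (mono (ℕ.m≤m⊔n M N) t))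
                    (proj₂ (nz δ 0<δ) i (mono (ℕ.m≤n⊔m M N) t))))
    where
    δ = ½ ℚ.* ε
    0<δ : 0ℚ ℚ.< δ
    0<δ = ℚ.positive⁻¹ δ {{ℚ.pos*pos⇒pos ½ ε {{ℚ.positive 0<ε}}}}
    M = proj₁ (ny δ 0<δ)
    N = proj₁ (nz δ 0<δ)
    δ+δ : δ ℚ.+ δ ≡ ε
    δ+δ = trans (sym (ℚ.*-distribʳ-+ ε ½ ½)) (ℚ.*-identityˡ ε)

  bounded*null : ∀ {y z} → IsBounded y → IsNull z → IsNull (λ i → y i ℚ.* z i)
  bounded*null {y} {z} (B , 0<B , M , yB) nz ε 0<ε = M ⊔ N , λ i t →
    let instance _ = ℚ.positive 0<B
                 _ = ℚ.∣-∣-nonNeg (z i) in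
    subst₂ ℚ._<_ (sym (ℚ.∣p*q∣≡∣p∣*∣q∣ (y i) (z i))) Bδ
      (ℚ.≤-<-trans
        (ℚ.*-monoʳ-≤-nonNeg ℚ.∣ z i ∣ (yB i (mono (ℕ.m≤m⊔n M N) t)))
        (ℚ.*-monoʳ-<-pos B (proj₂ (nz δ 0<δ) i (mono (ℕ.m≤n⊔m M N) t))))
    where
    instance
      B>0 : ℚ.Positive B
      B>0 = ℚ.positive 0<B
      B≢0 : ℚ.NonZero B
      B≢0 = ℚ.pos⇒nonZero B
      ε>0 : ℚ.Positive ε
      ε>0 = ℚ.positive 0<ε
      B⁻¹>0 : ℚ.Positive (ℚ.1/ B)
      B⁻¹>0 = ℚ.1/pos⇒pos B
    δ = ℚ.1/ B ℚ.* ε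
    0<δ : 0ℚ ℚ.< δ
    0<δ = ℚ.positive⁻¹ δ {{ℚ.pos*pos⇒pos (ℚ.1/ B) ε}}
    N = proj₁ (nz δ 0<δ)
    Bδ : B ℚ.* δ ≡ ε
    Bδ = trans (sym (ℚ.*-assoc B (ℚ.1/ B) ε))
               (trans (cong (ℚ._* ε) (ℚ.*-inverseʳ B)) (ℚ.*-identityˡ ε))

module Null₁ = Null {ℕ} (λ N n → N ℕ.≤ n) ℕ.≤-trans
module Null₂ = Null {ℕ × ℕ} (λ N (m , n) → N ℕ.≤ m × N ℕ.≤ n)
  (λ M≤N (p , q) → ℕ.≤-trans M≤N p , ℕ.≤-trans M≤N q)

IsCauchy : (ℕ → ℚ) → Set
IsCauchy x = ∀ ε → 0ℚ ℚ.< ε →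
  ∃[ N ] (∀ m n → N ℕ.≤ m → N ℕ.≤ n → ℚ.∣ x m ℚ.- x n ∣ ℚ.< ε)

-- Real numbers are Cauchy sequences of rationals, equal when their difference
-- tends to 0; a setoid, since there are no quotients.
record ℝ : Set where
  constructor mkℝ
  field
    seq    : ℕ → ℚ
    cauchy : IsCauchy seq

open ℝ public

infix 4 _≃_ _#_

record _≃_ (x y : ℝ) : Set where
  constructor mk≃
  field
    null : ∀ ε → 0ℚ ℚ.< ε →
      ∃[ N ] (∀ n → N ℕ.≤ n → ℚ.∣ seq x n ℚ.- seq y n ∣ ℚ.< ε)

open _≃_ public

-- Apartness, used for "distinct" and "nonzero": classically the negation of _≃_.
_#_ : ℝ → ℝ → Set
x # y = ∃[ ε ] (0ℚ ℚ.< ε ×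
  ∃[ N ] (∀ n → N ℕ.≤ n → ε ℚ.≤ ℚ.∣ seq x n ℚ.- seq y n ∣))

toNull₂ : ∀ x → IsCauchy x → Null₂.IsNull (λ (m , n) → x m ℚ.- x n)
toNull₂ x c ε 0<ε = proj₁ (c ε 0<ε) , λ (m , n) (p , q) → proj₂ (c ε 0<ε) m n p q

fromNull₂ : ∀ x → Null₂.IsNull (λ (m , n) → x m ℚ.- x n) → IsCauchy x
fromNull₂ x c ε 0<ε = proj₁ (c ε 0<ε) , λ m n p q → proj₂ (c ε 0<ε) (m , n) (p , q)

bounded : ∀ x → IsCauchy x → Null₁.IsBounded x
bounded x c = B , 0<B , N , bound
  where
  open ℚ.≤-Reasoning
  cN = c 1ℚ (ℚ.positive⁻¹ 1ℚ)
  N = proj₁ cN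
  B = ℚ.∣ x N ∣ ℚ.+ 1ℚ
  0<B : 0ℚ ℚ.< B
  0<B = ℚ.+-mono-≤-< (ℚ.0≤∣p∣ (x N)) (ℚ.positive⁻¹ 1ℚ)
  bound : ∀ n → N ℕ.≤ n → ℚ.∣ x n ∣ ℚ.≤ B
  bound n N≤n = begin
    ℚ.∣ x n ∣                       ≡⟨ cong ℚ.∣_∣ (split (x n) (x N)) ⟩
    ℚ.∣ x N ℚ.+ (x n ℚ.- x N) ∣     ≤⟨ ℚ.∣p+q∣≤∣p∣+∣q∣ (x N) (x n ℚ.- x N) ⟩
    ℚ.∣ x N ∣ ℚ.+ ℚ.∣ x n ℚ.- x N ∣ ≤⟨ ℚ.+-monoʳ-≤ ℚ.∣ x N ∣ (ℚ.<⇒≤ (proj₂ cN n N N≤n ℕ.≤-refl)) ⟩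
    B                               ∎

bounded-fst : ∀ x → IsCauchy x → Null₂.IsBounded (λ (m , n) → x m)
bounded-fst x c = let B , 0<B , N , h = bounded x c in
  B , 0<B , N , λ (m , n) (p , q) → h m p

bounded-snd : ∀ x → IsCauchy x → Null₂.IsBounded (λ (m , n) → x n)
bounded-snd x c = let B , 0<B , N , h = bounded x c in
  B , 0<B , N , λ (m , n) (p , q) → h n q

abstract
  const-cauchy : ∀ q → IsCauchy (λ _ → q)
  const-cauchy q =
    fromNull₂ (λ _ → q) (Null₂.null-0 {λ _ → q ℚ.- q} λ _ → ℚ.+-inverseʳ q)

  +-cauchy : ∀ x y → IsCauchy x → IsCauchy y → IsCauchy (λ n → x n ℚ.+ y n)
  +-cauchy x y cx cy = fromNull₂ s
    (Null₂.null-cong {z = λ (m , n) → s m ℚ.- s n}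
      (λ (m , n) → add-sub (x m) (x n) (y m) (y n))
      (Null₂.null-+ {λ (m , n) → x m ℚ.- x n} {λ (m , n) → y m ℚ.- y n}
        (toNull₂ x cx) (toNull₂ y cy)))
    where
    s : ℕ → ℚ
    s n = x n ℚ.+ y n

  neg-cauchy : ∀ x → IsCauchy x → IsCauchy (λ n → ℚ.- x n)
  neg-cauchy x cx = fromNull₂ s
    (Null₂.null-cong {z = λ (m , n) → s m ℚ.- s n}
      (λ (m , n) → neg-sub′ (x m) (x n))
      (Null₂.null-neg {λ (m , n) → x m ℚ.- x n} (toNull₂ x cx)))
    where
    s : ℕ → ℚ
    s n = ℚ.- x n

  *-cauchy : ∀ x y → IsCauchy x → IsCauchy y → IsCauchy (λ n → x n ℚ.* y n)
  *-cauchy x y cx cy = fromNull₂ s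
    (Null₂.null-cong {z = λ (m , n) → s m ℚ.- s n}
      (λ (m , n) → mul-sub (x m) (x n) (y m) (y n))
      (Null₂.null-+ {λ (m , n) → x m ℚ.* dy (m , n)} {λ (m , n) → y n ℚ.* dx (m , n)}
        (Null₂.bounded*null {λ (m , n) → x m} {dy} (bounded-fst x cx) (toNull₂ y cy))
        (Null₂.bounded*null {λ (m , n) → y n} {dx} (bounded-snd y cy) (toNull₂ x cx))))
    where
    s : ℕ → ℚ
    s n = x n ℚ.* y n
    dx dy : ℕ × ℕ → ℚ
    dx (m , n) = x m ℚ.- x n
    dy (m , n) = y m ℚ.- y n

infixl 6 _+ʳ_
infixl 7 _*ʳ_
infix  8 -ʳ_

fromℚ : ℚ → ℝ
fromℚ q .seq _  = q
fromℚ q .cauchy = const-cauchy q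

0ℝ 1ℝ : ℝ
0ℝ = fromℚ 0ℚ
1ℝ = fromℚ 1ℚ

_+ʳ_ : ℝ → ℝ → ℝ
(x +ʳ y) .seq n  = seq x n ℚ.+ seq y n
(x +ʳ y) .cauchy = +-cauchy (seq x) (seq y) (cauchy x) (cauchy y)

-ʳ_ : ℝ → ℝ
(-ʳ x) .seq n  = ℚ.- seq x n
(-ʳ x) .cauchy = neg-cauchy (seq x) (cauchy x)

_*ʳ_ : ℝ → ℝ → ℝ
(x *ʳ y) .seq n  = seq x n ℚ.* seq y n
(x *ʳ y) .cauchy = *-cauchy (seq x) (seq y) (cauchy x) (cauchy y)

≗⇒≃ : ∀ {x y} → (∀ n → seq x n ≡ seq y n) → x ≃ y
≗⇒≃ {x} {y} eq = mk≃ (Null₁.null-0 {λ n → seq x n ℚ.- seq y n} λ n →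
  trans (cong (ℚ._- seq y n) (eq n)) (ℚ.+-inverseʳ (seq y n)))

≃-refl : ∀ {x} → x ≃ x
≃-refl = ≗⇒≃ λ _ → refl

≃-sym : ∀ {x y} → x ≃ y → y ≃ x
≃-sym {x} {y} e = mk≃ (Null₁.null-cong {z = λ n → seq y n ℚ.- seq x n}
  (λ n → neg-sub (seq x n) (seq y n))
  (Null₁.null-neg {λ n → seq x n ℚ.- seq y n} (null e)))

≃-trans : ∀ {x y z} → x ≃ y → y ≃ z → x ≃ z
≃-trans {x} {y} {z} e f = mk≃ (Null₁.null-cong {z = λ n → seq x n ℚ.- seq z n}
  (λ n → telescope (seq x n) (seq y n) (seq z n))
  (Null₁.null-+ {λ n → seq x n ℚ.- seq y n} {λ n → seq y n ℚ.- seq z n}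
    (null e) (null f)))

+ʳ-cong : ∀ {x y u v} → x ≃ y → u ≃ v → x +ʳ u ≃ y +ʳ v
+ʳ-cong {x} {y} {u} {v} e f = mk≃ (Null₁.null-cong
  {z = λ n → (seq x n ℚ.+ seq u n) ℚ.- (seq y n ℚ.+ seq v n)}
  (λ n → add-sub (seq x n) (seq y n) (seq u n) (seq v n))
  (Null₁.null-+ {λ n → seq x n ℚ.- seq y n} {λ n → seq u n ℚ.- seq v n}
    (null e) (null f)))

-ʳ-cong : ∀ {x y} → x ≃ y → -ʳ x ≃ -ʳ y
-ʳ-cong {x} {y} e = mk≃ (Null₁.null-cong
  {z = λ n → (ℚ.- seq x n) ℚ.- (ℚ.- seq y n)}
  (λ n → neg-sub′ (seq x n) (seq y n))
  (Null₁.null-neg {λ n → seq x n ℚ.- seq y n} (null e)))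

*ʳ-cong : ∀ {x y u v} → x ≃ y → u ≃ v → x *ʳ u ≃ y *ʳ v
*ʳ-cong {x} {y} {u} {v} e f = mk≃ (Null₁.null-cong
  {z = λ n → seq x n ℚ.* seq u n ℚ.- seq y n ℚ.* seq v n}
  (λ n → mul-sub (seq x n) (seq y n) (seq u n) (seq v n))
  (Null₁.null-+ {λ n → seq x n ℚ.* du n} {λ n → seq v n ℚ.* dx n}
    (Null₁.bounded*null {seq x} {du} (bounded (seq x) (cauchy x)) (null f))
    (Null₁.bounded*null {seq v} {dx} (bounded (seq v) (cauchy v)) (null e))))
  where
  dx du : ℕ → ℚ
  dx n = seq x n ℚ.- seq y n
  du n = seq u n ℚ.- seq v n

+ʳ-*ʳ-isCommutativeRing : IsCommutativeRing _≃_ _+ʳ_ _*ʳ_ -ʳ_ 0ℝ 1ℝ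
+ʳ-*ʳ-isCommutativeRing = record
  { isRing = record
    { +-isAbelianGroup = record
      { isGroup = record
        { isMonoid = record
          { isSemigroup = record
            { isMagma = record
              { isEquivalence = record
                { refl  = ≃-refl
                ; sym   = ≃-sym
                ; trans = ≃-trans
                }
              ; ∙-cong = +ʳ-cong
              }
            ; assoc = λ x y z → ≗⇒≃
                (λ n → ℚ.+-assoc (seq x n) (seq y n) (seq z n))
            }
          ; identity = (λ x → ≗⇒≃ (λ n → ℚ.+-identityˡ (seq x n)))
                     , (λ x → ≗⇒≃ (λ n → ℚ.+-identityʳ (seq x n)))
          }
        ; inverse = (λ x → ≗⇒≃ (λ n → ℚ.+-inverseˡ (seq x n)))
                  , (λ x → ≗⇒≃ (λ n → ℚ.+-inverseʳ (seq x n)))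
        ; ⁻¹-cong = -ʳ-cong
        }
      ; comm = λ x y → ≗⇒≃ (λ n → ℚ.+-comm (seq x n) (seq y n))
      }
    ; *-cong = *ʳ-cong
    ; *-assoc = λ x y z → ≗⇒≃
        (λ n → ℚ.*-assoc (seq x n) (seq y n) (seq z n))
    ; *-identity = (λ x → ≗⇒≃ (λ n → ℚ.*-identityˡ (seq x n)))
                 , (λ x → ≗⇒≃ (λ n → ℚ.*-identityʳ (seq x n)))
    ; distrib = (λ x y z → ≗⇒≃
                   (λ n → ℚ.*-distribˡ-+ (seq x n) (seq y n) (seq z n)))
              , (λ x y z → ≗⇒≃
                   (λ n → ℚ.*-distribʳ-+ (seq x n) (seq y n) (seq z n)))
    }
  ; *-comm = λ x y → ≗⇒≃ (λ n → ℚ.*-comm (seq x n) (seq y n))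
  }

ℝ-commutativeRing : CommutativeRing 0ℓ 0ℓ
ℝ-commutativeRing = record { isCommutativeRing = +ʳ-*ʳ-isCommutativeRing }

open RawMonoidDefs (CommutativeRing.+-rawMonoid ℝ-commutativeRing) public
  using () renaming (sum to sumʳ)

Matrix : ℕ → ℕ → Set
Matrix m n = Fin m → Fin n → ℝ

infix 4 _≃ᴹ_
_≃ᴹ_ : ∀ {m n} → Matrix m n → Matrix m n → Set
M ≃ᴹ N = ∀ i j → M i j ≃ N i j

infixl 7 _*ᴹ_
_*ᴹ_ : ∀ {l m n} → Matrix l m → Matrix m n → Matrix l n
(M *ᴹ N) i j = sumʳ λ h → M i h *ʳ N h j

_ᵀ : ∀ {m n} → Matrix m n → Matrix n m
(M ᵀ) i j = M j i

linComb : ∀ {m n r} → (Fin r → ℝ) → (Fin r → Matrix m n) → Matrix m n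
linComb c M i j = sumʳ λ h → c h *ʳ M h i j

matrixSum : ∀ {m n r} → (Fin r → Matrix m n) → Matrix m n
matrixSum M i j = sumʳ λ h → M h i j

⟦_⟧ : Bool → ℝ
⟦ b ⟧ = if b then 1ℝ else 0ℝ

identityMatrix : ∀ {n} → Matrix n n
identityMatrix i j = ⟦ does (i Fin.≟ j) ⟧

allOnes : ∀ {m n} → Matrix m n
allOnes _ _ = 1ℝ

adjacencyMatrix : ∀ {n} → (Fin n → Fin n → Bool) → Matrix n n
adjacencyMatrix R x y = ⟦ R x y ⟧

IsEigenvalue : ∀ {n} → Matrix n n → ℝ → Set
IsEigenvalue {n} M θ =
  Σ[ u ∈ (Fin n → ℝ) ]
    (∃[ i ] u i # 0ℝ) × (∀ i → sumʳ (λ j → M i j *ʳ u j) ≃ θ *ʳ u i)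

HasExactlyDistinctEigenvalues : ∀ {n} → Matrix n n → ℕ → Set
HasExactlyDistinctEigenvalues M r =
  Σ[ θ ∈ (Fin r → ℝ) ]
    (∀ i j → i ≢ j → θ i # θ j)
    × (∀ i → IsEigenvalue M (θ i))
    × (∀ t → IsEigenvalue M t → ∃[ i ] t ≃ θ i)

record Graph (V : Set) : Set where
  field
    adj    : V → V → Bool
    symm   : ∀ x y → adj x y ≡ adj y x
    irrefl : ∀ x → adj x x ≡ false

open Graph public

infix 4 _≅_
_≅_ : {V W : Set} → Graph V → Graph W → Set
_≅_ {V} {W} Γ Δ =
  Σ[ f ∈ V ↔ W ] (∀ x y → adj Γ x y ≡ adj Δ (Inverse.to f x) (Inverse.to f y))

data Walk {V : Set} (Γ : Graph V) : ℕ → V → V → Set where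
  []  : ∀ {x} → Walk Γ 0 x x
  _∷_ : ∀ {ℓ x y z} → T (adj Γ x y) → Walk Γ ℓ y z → Walk Γ (suc ℓ) x z

Connected : {V : Set} → Graph V → Set
Connected Γ = ∀ x y → ∃[ ℓ ] Walk Γ ℓ x y

Distance : {V : Set} → Graph V → V → V → ℕ → Set
Distance Γ x y i = Walk Γ i x y × (∀ j → j ℕ.< i → ¬ Walk Γ j x y)

HasDiameter : {V : Set} → Graph V → ℕ → Set
HasDiameter Γ d =
  (∀ x y → ∃[ i ] (i ℕ.≤ d × Distance Γ x y i))
  × (∃[ x ] ∃[ y ] Distance Γ x y d)

Bipartite : {V : Set} → Graph V → Set
Bipartite {V} Γ = Σ[ c ∈ (V → Bool) ] (∀ x y → T (adj Γ x y) → c x ≢ c y)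

neighbours : ∀ {v} → Graph (Fin v) → Fin v → Subset v
neighbours Γ x = tabulate (adj Γ x)

record AmplyRegular (v k λ′ μ : ℕ) (Γ : Graph (Fin v)) : Set where
  field
    regular   : ∀ x → ∣ neighbours Γ x ∣ ≡ k
    adjacent  : ∀ x y → T (adj Γ x y) → ∣ neighbours Γ x ∩ neighbours Γ y ∣ ≡ λ′
    distance2 : ∀ x y → Distance Γ x y 2 → ∣ neighbours Γ x ∩ neighbours Γ y ∣ ≡ μ

-- a ℓ i is the number of walks of length ℓ between vertices at distance i.
WalkRegular : {V : Set} → ℕ → Graph V → Set
WalkRegular t Γ =
  Connected Γ ×
  Σ[ a ∈ (ℕ → ℕ → ℕ) ]
    (∀ ℓ x y i → i ℕ.≤ t → Distance Γ x y i → Walk Γ ℓ x y ↔ Fin (a ℓ i))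

record IsPartition {n v : ℕ} (B : Fin n → Subset v) : Set where
  field
    nonempty : ∀ i → Nonempty (B i)
    cover    : ∀ x → ∃[ i ] x ∈ B i
    disjoint : ∀ x i j → x ∈ B i → x ∈ B j → i ≡ j

record Diagram (n : ℕ) : Set where
  field
    size     : Fin n → ℕ
    quotient : Fin n → Fin n → ℕ

open Diagram public

record HasDiagram {n v : ℕ} (Γ : Graph (Fin v)) (B : Fin n → Subset v)
                  (D : Diagram n) : Set where
  field
    isPartition : IsPartition B
    sizes       : ∀ i → ∣ B i ∣ ≡ size D i
    equitable   : ∀ i j x → x ∈ B i → ∣ neighbours Γ x ∩ B j ∣ ≡ quotient D i j

-- Cell 0 of the diagram is the one that is the singleton of the base vertex.
QRegular : ∀ {n v} → Graph (Fin v) → Diagram (suc n) → Set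
QRegular {n} {v} Γ D =
  ∀ x → Σ[ B ∈ (Fin (suc n) → Subset v) ] B zero ≡ ⁅ x ⁆ × HasDiagram Γ B D

𝒬 : ℕ → Diagram 6
𝒬 k = record { size = sz ; quotient = q }
  where
  sz : Fin 6 → ℕ
  sz 0F = 1
  sz 1F = k
  sz 2F = 2 ℕ.* k
  sz 3F = k
  sz 4F = 1
  sz 5F = 2

  q : Fin 6 → Fin 6 → ℕ
  q 0F 1F = k
  q 1F 0F = 1
  q 1F 2F = k ∸ 1
  q 2F 1F = (k ∸ 1) / 2
  q 2F 3F = (k ∸ 1) / 2
  q 2F 5F = 1
  q 3F 2F = k ∸ 1
  q 3F 4F = 1
  q 4F 3F = k
  q 5F 2F = k
  q _  _  = 0

record SymmetricScheme (n m : ℕ) : Set where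
  field
    R : Fin (suc n) → Fin m → Fin m → Bool

  F : Fin (suc n) → Matrix m m
  F i = adjacencyMatrix (R i)

  field
    nonempty  : ∀ i → ∃[ x ] ∃[ y ] T (R i x y)
    symmetric : ∀ i → F i ≃ᴹ F i ᵀ
    F₀≃I      : F zero ≃ᴹ identityMatrix
    ΣF≃J      : matrixSum F ≃ᴹ allOnes
    product   : ∀ i j → Σ[ c ∈ (Fin (suc n) → ℝ) ] F i *ᴹ F j ≃ᴹ linComb c F

fromℚ-injective : ∀ {p q} → fromℚ p ≃ fromℚ q → p ≡ q
fromℚ-injective {p} {q} e with p ℚ.≟ q
... | yes p≡q = p≡q
... | no  p≢q = ⊥-elim (ℚ.<-irrefl refl (proj₂ (null e ε 0<ε) _ ℕ.≤-refl))
  where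
  ε = ℚ.∣ p ℚ.- q ∣
  0<ε : 0ℚ ℚ.< ε
  0<ε = ℚ.≰⇒> λ ε≤0 → p≢q
    (trans (split p q)
      (trans (cong (q ℚ.+_) (ℚ.∣p∣≡0⇒p≡0 _ (ℚ.≤-antisym ε≤0 (ℚ.0≤∣p∣ _))))
             (ℚ.+-identityʳ q)))

0<1 : 0ℚ ℚ.< 1ℚ
0<1 = ℚ.positive⁻¹ 1ℚ

⟦⟧-injective : ∀ b c → ⟦ b ⟧ ≃ ⟦ c ⟧ → b ≡ c
⟦⟧-injective true  true  e = refl
⟦⟧-injective false false e = refl
⟦⟧-injective true  false e = ⊥-elim (ℚ.<-irrefl (sym (fromℚ-injective {1ℚ} {0ℚ} e)) 0<1)
⟦⟧-injective false true  e = ⊥-elim (ℚ.<-irrefl (fromℚ-injective {0ℚ} {1ℚ} e) 0<1)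

indicatorSum : ∀ {n} → (Fin n → Bool) → ℚ
indicatorSum {zero}  b = 0ℚ
indicatorSum {suc n} b = (if b zero then 1ℚ else 0ℚ) ℚ.+ indicatorSum (b ∘ suc)

seq-⟦⟧ : ∀ b n → seq ⟦ b ⟧ n ≡ (if b then 1ℚ else 0ℚ)
seq-⟦⟧ true  n = refl
seq-⟦⟧ false n = refl

seq-sum : ∀ {r} (b : Fin r → Bool) n → seq (sumʳ (λ h → ⟦ b h ⟧)) n ≡ indicatorSum b
seq-sum {zero}  b n = refl
seq-sum {suc r} b n = cong₂ ℚ._+_ (seq-⟦⟧ (b zero) n) (seq-sum (b ∘ suc) n)

0≤indicator : ∀ b → 0ℚ ℚ.≤ (if b then 1ℚ else 0ℚ)
0≤indicator true  = ℚ.<⇒≤ 0<1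
0≤indicator false = ℚ.≤-refl

0≤indicatorSum : ∀ {r} (b : Fin r → Bool) → 0ℚ ℚ.≤ indicatorSum b
0≤indicatorSum {zero}  b = ℚ.≤-refl
0≤indicatorSum {suc r} b = ℚ.+-mono-≤ (0≤indicator (b zero)) (0≤indicatorSum (b ∘ suc))

0<indicatorSum : ∀ {r} (b : Fin r → Bool) i → b i ≡ true → 0ℚ ℚ.< indicatorSum b
0<indicatorSum b zero    eq rewrite eq = ℚ.+-mono-<-≤ 0<1 (0≤indicatorSum (b ∘ suc))
0<indicatorSum b (suc i) eq = ℚ.+-mono-≤-< (0≤indicator (b zero)) (0<indicatorSum (b ∘ suc) i eq)

relation-irrefl : ∀ {n m} (S : SymmetricScheme n m) i x →
                  SymmetricScheme.R S (suc i) x x ≡ false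
relation-irrefl S i x with SymmetricScheme.R S (suc i) x x in eq
... | false = refl
... | true  = ⊥-elim (ℚ.<-irrefl (sym total) 1<total)
  where
  open SymmetricScheme S
  b = λ h → R h x x
  b₀ : b zero ≡ true
  b₀ = trans (⟦⟧-injective _ _ (F₀≃I x x)) (dec-true (x Fin.≟ x) refl)
  total : indicatorSum b ≡ 1ℚ
  total = fromℚ-injective
    (≃-trans (≗⇒≃ {fromℚ (indicatorSum b)} (λ n → sym (seq-sum b n))) (ΣF≃J x x))
  1<total : 1ℚ ℚ.< indicatorSum b
  1<total rewrite b₀ = ℚ.+-monoʳ-< 1ℚ (0<indicatorSum (b ∘ suc) i eq)

-- The graph of R_{i+1}: only the non-identity relations have relation graphs.
relationGraph : ∀ {n m} → SymmetricScheme n m → Fin n → Graph (Fin m)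
relationGraph S i = record
  { adj    = R (suc i)
  ; symm   = λ x y → ⟦⟧-injective _ _ (symmetric (suc i) x y)
  ; irrefl = relation-irrefl S i
  }
  where open SymmetricScheme S

relationCell : ∀ {n m} → SymmetricScheme n m → Fin m → Fin (suc n) → Subset m
relationCell S x j = tabulate (SymmetricScheme.R S j x)

-- σ matches the cells of the diagram with the relations, fixing cell 0.
SchemeHasDiagram : ∀ {n m} → SymmetricScheme n m → Fin n → Diagram (suc n) → Set
SchemeHasDiagram {n} S i D =
  Σ[ σ ∈ Permutation′ (suc n) ]
    σ ⟨$⟩ʳ zero ≡ zero
    × (∀ x → HasDiagram (relationGraph S i) (λ j → relationCell S x (σ ⟨$⟩ʳ j)) D)

-- A collection of blocks is an indexed family of subsets of the point set
-- Fin p, so repeated blocks are not excluded by definition.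

dual : ∀ {p b} → (Fin b → Subset p) → (Fin p → Subset b)
dual blocks x = tabulate λ j → lookup (blocks j) x

record GDD (n m k λ₁ λ₂ : ℕ) {p b : ℕ} (blocks : Fin b → Subset p) : Set where
  field
    groups      : Fin m → Subset p
    isPartition : IsPartition groups
    groupSize   : ∀ g → ∣ groups g ∣ ≡ n
    blockSize   : ∀ j → ∣ blocks j ∣ ≡ k
    sameGroup   : ∀ x y g → x ≢ y → x ∈ groups g → y ∈ groups g →
                  ∣ dual blocks x ∩ dual blocks y ∣ ≡ λ₁
    diffGroup   : ∀ x y g h → g ≢ h → x ∈ groups g → y ∈ groups h →
                  ∣ dual blocks x ∩ dual blocks y ∣ ≡ λ₂

GDDDP : (n m k λ₁ λ₂ : ℕ) {p b : ℕ} → (Fin b → Subset p) → Set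
GDDDP n m k λ₁ λ₂ blocks = GDD n m k λ₁ λ₂ blocks × GDD n m k λ₁ λ₂ (dual blocks)

incidenceGraph : ∀ {p b} → (Fin b → Subset p) → Graph (Fin p ⊎ Fin b)
incidenceGraph {p} {b} blocks = record
  { adj    = incident
  ; symm   = incident-sym
  ; irrefl = λ where
      (inj₁ _) → refl
      (inj₂ _) → refl
  }
  where
  incident : Fin p ⊎ Fin b → Fin p ⊎ Fin b → Bool
  incident (inj₁ x) (inj₂ j) = lookup (blocks j) x
  incident (inj₂ j) (inj₁ x) = lookup (blocks j) x
  incident (inj₁ _) (inj₁ _) = false
  incident (inj₂ _) (inj₂ _) = false

  incident-sym : ∀ s t → incident s t ≡ incident t s
  incident-sym (inj₁ _) (inj₂ _) = refl
  incident-sym (inj₂ _) (inj₁ _) = refl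
  incident-sym (inj₁ _) (inj₁ _) = refl
  incident-sym (inj₂ _) (inj₂ _) = refl

BipartiteQRegular : ∀ {v} → ℕ → Graph (Fin v) → Set
BipartiteQRegular k Γ = Bipartite Γ × QRegular Γ (𝒬 k)

IsIncidenceGraphOfGDDDP : ∀ {v} → ℕ → Graph (Fin v) → Set
IsIncidenceGraphOfGDDDP k Γ =
  ∃[ p ] ∃[ b ] Σ[ blocks ∈ (Fin b → Subset p) ]
    GDDDP 2 (k ℕ.+ 1) k 0 ((k ∸ 1) / 2) blocks × Γ ≅ incidenceGraph blocks

IsRelationGraphWithDiagram : ∀ {v} → ℕ → Graph (Fin v) → Set
IsRelationGraphWithDiagram k Γ =
  ∃[ m ] Σ[ S ∈ SymmetricScheme 5 m ] ∃[ i ]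
    Γ ≅ relationGraph S i × SchemeHasDiagram S i (𝒬 k)

{-# OPTIONS --safe #-}
module Submission where

-- All three conditions amount to one structure: a proper 2-colouring with classes of size
-- 2k + 2 and a colour-preserving fixed-point-free involution τ (the antipode, or the other
-- point of the group) such that distinct vertices of one colour have 0 or μ = (k − 1)/2
-- common neighbours according as they are exchanged by τ or not.  Since k = 2μ + 1, a count
-- of the vertices adjacent to neither y nor τ y shows that τ is an automorphism, so the
-- relations x = y, x ~ y, τ x ~ y, τ x = y, "otherwise, same colour" and "otherwise,
-- different colours" are symmetric, and their intersection numbers follow from those of ~.
--
-- With T the matrix of τ and J the matrix of equality of colours, A² = kI + μ(J − I − T).
-- Hence A² is k on the (−1)-eigenspace of T; on the (+1)-eigenspace it is 1 where the sum
-- over each colour class vanishes, and k² on vectors constant on the colour classes.  So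
-- the eigenvalues are ±√k, ±1, ±k.

open import Defs
open import Algebra.Bundles using (CommutativeRing)
import Algebra.Properties.CommutativeMonoid.Sum
import Algebra.Properties.Semiring.Sum
open import Data.Bool.Base using (Bool; true; false; not; _∧_; T; if_then_else_)
open import Data.Bool.Properties using (∧-comm; ∧-idem; ∧-zeroʳ; ∧-identityʳ; not-involutive; not-injective; not-¬)
open import Data.Empty using (⊥; ⊥-elim)
open import Data.Fin.Base as Fin using (Fin; zero; suc; splitAt; _↑ˡ_; _↑ʳ_; inject₁)
open import Data.Fin.Patterns using (0F; 1F; 2F; 3F; 4F; 5F)
open import Data.Fin.Permutation using (Permutation; _⟨$⟩ʳ_; cast-id)
import Data.Fin.Properties as Fin
open import Data.Fin.Subset using (Subset; _∈_; _∩_; ∣_∣; ⁅_⁆; outside)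
import Data.Integer.Base as ℤ
import Data.Integer.Properties as ℤ
open import Data.Nat.Base as ℕ using (ℕ; zero; suc; _+_; _*_; _∸_; _/_; _%_; _≤_; _⊔_; ⌊_/2⌋; z≤n; s≤s)
import Data.Nat.Coprimality as C
open import Data.Nat.DivMod using (m≡m%n+[m/n]*n; m*n/n≡m)
import Data.Nat.Properties as ℕ
import Data.Nat.Solver as ℕ
open import Data.Product.Base using (Σ; Σ-syntax; ∃-syntax; _×_; _,_; proj₁; proj₂)
open import Data.Rational.Base as ℚ using (ℚ; 0ℚ; 1ℚ; ½; mkℚ; *<*)
import Data.Rational.Properties as ℚ
import Data.Rational.Solver as ℚ
import Data.Rational.Unnormalised.Base as ℚᵘ
import Data.Rational.Unnormalised.Properties as ℚᵘ
open import Data.Sum.Base using (_⊎_; inj₁; inj₂; map₁; map₂; swap)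
open import Data.Sum.Function.Propositional using (_⊎-↔_)
open import Data.Sum.Properties using (inj₁-injective; inj₂-injective; swap-involutive)
open import Data.Vec.Base using ([]; _∷_; tabulate; lookup)
open import Data.Vec.Properties
  using (lookup∘tabulate; tabulate∘lookup; tabulate-cong; lookup-zipWith; []=⇒lookup; lookup⇒[]=; lookup-replicate)
open import Function.Base using (_∘_; case_of_)
open import Function.Bundles using (_↔_; _⇔_; Inverse; mk↔ₛ′; mk⇔)
open import Function.Construct.Composition using (_↔-∘_)
open import Function.Construct.Identity using (↔-id)
open import Function.Construct.Symmetry using (↔-sym)
open import Level using (0ℓ)
open import Relation.Binary.Definitions using (tri<; tri≈; tri>)
open import Relation.Binary.PropositionalEquality
  using (_≡_; _≢_; _≗_; refl; sym; trans; cong; cong₂; subst; subst₂; module ≡-Reasoning)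
open import Relation.Nullary.Decidable using (does; yes; no; dec-true; dec-false)
open import Relation.Nullary.Negation using (¬_; contradiction)

-- The three conditions supply τ with different gaps. In (2) the partners of points and the partners
-- of blocks come from two unrelated partitions, so nothing makes τ compatible with incidence; this
-- has to be extracted from the counts alone. In (1) the partitions at different base vertices are
-- unrelated, so facts at `x` and at `τ x` can be compared only through data that mention no base:
-- the colouring and the numbers of common neighbours. In (3) bipartiteness has to be read off the
-- diagram.
--
-- Equality of reals is not decidable here, so the spectrum is not found by counting dimensions.
-- That there is no seventh eigenvalue follows from one polynomial identity that kills every entry
-- of an eigenvector, together with cancellation of factors that are apart from zero; that all six
-- occur follows from explicit vectors. The bound `5 ≤ k` separates the six values so widely that
-- consecutive ones differ by at least 1 already in their rational approximations.

private
  module ℕ∑ where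
    open Algebra.Properties.CommutativeMonoid.Sum ℕ.+-0-commutativeMonoid public
    open Algebra.Properties.Semiring.Sum ℕ.+-*-semiring public using (*-distribˡ-sum; *-distribʳ-sum)

-- Boolean indicators, finite sums and counting

𝟙 : Bool → ℕ
𝟙 true  = 1
𝟙 false = 0

infix 5 _==_

-- Opaque definitions are injective for the unifier.
opaque
  _==_ : ∀ {n} → Fin n → Fin n → Bool
  i == j = does (i Fin.≟ j)

  ==-does : ∀ {n} (i j : Fin n) → (i == j) ≡ does (i Fin.≟ j)
  ==-does i j = refl

  ==-≡ : ∀ {n} {i j : Fin n} → i ≡ j → (i == j) ≡ true
  ==-≡ {i = i} {j} = dec-true (i Fin.≟ j)

  ==-≢ : ∀ {n} {i j : Fin n} → i ≢ j → (i == j) ≡ false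
  ==-≢ {i = i} {j} = dec-false (i Fin.≟ j)

  ==⇒≡ : ∀ {n} {i j : Fin n} → (i == j) ≡ true → i ≡ j
  ==⇒≡ {i = i} {j} e with yes p ← i Fin.≟ j = p

==-refl : ∀ {n} (i : Fin n) → (i == i) ≡ true
==-refl i = ==-≡ refl

bool-ext : ∀ {a b} → (a ≡ true → b ≡ true) → (b ≡ true → a ≡ true) → a ≡ b
bool-ext {true}  {b}     f g = sym (f refl)
bool-ext {false} {true}  f g = g refl
bool-ext {false} {false} f g = refl

==-suc : ∀ {n} (i j : Fin n) → (suc i == suc j) ≡ (i == j)
==-suc i j = bool-ext (λ e → ==-≡ (Fin.suc-injective (==⇒≡ e))) (λ e → ==-≡ (cong suc (==⇒≡ e)))

≢true⇒≡false : ∀ {b} → b ≢ true → b ≡ false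
≢true⇒≡false {true}  ne = contradiction refl ne
≢true⇒≡false {false} ne = refl

true≢false : ∀ {b} → b ≡ true → b ≡ false → ⊥
true≢false refl ()

∧-trueˡ : ∀ {a b} → a ∧ b ≡ true → a ≡ true
∧-trueˡ {true} _ = refl

∧-trueʳ : ∀ {a b} → a ∧ b ≡ true → b ≡ true
∧-trueʳ {true} e = e

≡true⇒T : ∀ {b} → b ≡ true → T b
≡true⇒T refl = _

T⇒≡true : ∀ {b} → T b → b ≡ true
T⇒≡true {true} _ = refl

𝟙-∧ : ∀ a b → 𝟙 (a ∧ b) ≡ 𝟙 a * 𝟙 b
𝟙-∧ true  b = sym (ℕ.+-identityʳ _)
𝟙-∧ false b = refl

𝟙-∧-not : ∀ p q → 𝟙 (p ∧ q) + 𝟙 (p ∧ not q) ≡ 𝟙 p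
𝟙-∧-not true  true  = refl
𝟙-∧-not true  false = refl
𝟙-∧-not false _     = refl

𝟙-not : ∀ b → 𝟙 b + 𝟙 (not b) ≡ 1
𝟙-not true  = refl
𝟙-not false = refl

opaque
  ∑ : ∀ {n} → (Fin n → ℕ) → ℕ
  ∑ = ℕ∑.sum

  ∑-suc : ∀ {n} (f : Fin (suc n) → ℕ) → ∑ f ≡ f zero + ∑ (f ∘ suc)
  ∑-suc f = refl

  ∑-cong : ∀ {n} {f g : Fin n → ℕ} → f ≗ g → ∑ f ≡ ∑ g
  ∑-cong = ℕ∑.sum-cong-≗

  ∑-const : ∀ n c → ∑ {n} (λ _ → c) ≡ n * c
  ∑-const zero    c = refl
  ∑-const (suc n) c = cong (c +_) (∑-const n c)

  ∑-0 : ∀ {n} {f : Fin n → ℕ} → (∀ i → f i ≡ 0) → ∑ f ≡ 0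
  ∑-0 {n} h = trans (ℕ∑.sum-cong-≗ h) (ℕ∑.sum-replicate-zero n)

  ∑-+ : ∀ {n} (f g : Fin n → ℕ) → ∑ (λ i → f i + g i) ≡ ∑ f + ∑ g
  ∑-+ = ℕ∑.∑-distrib-+

  ∑-swap : ∀ {m n} (f : Fin m → Fin n → ℕ) → ∑ (λ i → ∑ (f i)) ≡ ∑ (λ j → ∑ (λ i → f i j))
  ∑-swap = ℕ∑.∑-comm

  *-distribˡ-∑ : ∀ {n} c (f : Fin n → ℕ) → c * ∑ f ≡ ∑ (λ i → c * f i)
  *-distribˡ-∑ = ℕ∑.*-distribˡ-sum

  *-distribʳ-∑ : ∀ {n} c (f : Fin n → ℕ) → ∑ f * c ≡ ∑ (λ i → f i * c)
  *-distribʳ-∑ = ℕ∑.*-distribʳ-sum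

  ∑-permute : ∀ {m n} (π : Fin m ↔ Fin n) (f : Fin n → ℕ) → ∑ (f ∘ Inverse.to π) ≡ ∑ f
  ∑-permute π f = sym (ℕ∑.sum-permute f π)

  ∑-splitAt : ∀ p {q} (f : Fin (p + q) → ℕ) → ∑ f ≡ ∑ (f ∘ (_↑ˡ q)) + ∑ (f ∘ (p ↑ʳ_))
  ∑-splitAt zero    f = refl
  ∑-splitAt (suc p) f = trans (cong (f zero +_) (∑-splitAt p (f ∘ suc))) (sym (ℕ.+-assoc (f zero) _ _))

∑-δ : ∀ {n} (f : Fin n → ℕ) x → ∑ (λ i → 𝟙 (x == i) * f i) ≡ f x
∑-δ f zero = trans (∑-suc _) (trans (cong₂ _+_
  (trans (cong (λ b → 𝟙 b * f zero) (==-refl zero)) (ℕ.+-identityʳ (f zero)))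
  (∑-0 λ i → cong (λ b → 𝟙 b * f (suc i)) (==-≢ {i = zero} {suc i} λ ()))) (ℕ.+-identityʳ _))
∑-δ f (suc x) = trans (∑-suc _) (trans (cong₂ _+_
  (cong (λ b → 𝟙 b * f zero) (==-≢ {i = suc x} {zero} λ ()))
  (∑-cong λ i → cong (λ b → 𝟙 b * f (suc i)) (==-suc x i))) (∑-δ (f ∘ suc) x))

opaque
  card : ∀ {n} → (Fin n → Bool) → ℕ
  card b = ∑ (λ i → 𝟙 (b i))

  card-∑ : ∀ {n} (b : Fin n → Bool) → card b ≡ ∑ (λ i → 𝟙 (b i))
  card-∑ b = refl

card-suc : ∀ {n} (b : Fin (suc n) → Bool) → card b ≡ 𝟙 (b zero) + card (b ∘ suc)
card-suc b = trans (card-∑ b) (trans (∑-suc _) (cong (𝟙 (b zero) +_) (sym (card-∑ (b ∘ suc)))))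

card-cong : ∀ {n} {a b : Fin n → Bool} → a ≗ b → card a ≡ card b
card-cong {a = a} {b} h = trans (card-∑ a) (trans (∑-cong (λ i → cong 𝟙 (h i))) (sym (card-∑ b)))

card-false : ∀ {n} {b : Fin n → Bool} → (∀ i → b i ≡ false) → card b ≡ 0
card-false {b = b} h = trans (card-∑ b) (∑-0 (λ i → cong 𝟙 (h i)))

card-true : ∀ {n} {b : Fin n → Bool} → (∀ i → b i ≡ true) → card b ≡ n
card-true {n} {b} h = trans (card-∑ b) (trans (∑-cong (λ i → cong 𝟙 (h i))) (trans (∑-const n 1) (ℕ.*-identityʳ n)))

card-+ : ∀ {n} {a b c : Fin n → Bool} →
      (∀ i → 𝟙 (a i) + 𝟙 (b i) ≡ 𝟙 (c i)) → card a + card b ≡ card c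
card-+ {a = a} {b} {c} h = trans (cong₂ _+_ (card-∑ a) (card-∑ b)) (trans (sym (∑-+ _ _)) (trans (∑-cong h) (sym (card-∑ c))))

card-+₃ : ∀ {n} {a b c d : Fin n → Bool} →
       (∀ i → 𝟙 (a i) + 𝟙 (b i) + 𝟙 (c i) ≡ 𝟙 (d i)) → card a + card b + card c ≡ card d
card-+₃ {a = a} {b} {c} {d} h = trans (cong₂ _+_ (trans (cong₂ _+_ (card-∑ a) (card-∑ b)) (sym (∑-+ _ _))) (card-∑ c))
  (trans (sym (∑-+ _ _)) (trans (∑-cong h) (sym (card-∑ d))))

card-pos : ∀ {n} {b : Fin n → Bool} i → b i ≡ true → 1 ≤ card b
card-pos {b = b} zero    e = subst (1 ≤_) (sym (card-suc b)) (subst (λ c → 1 ≤ 𝟙 c + card (b ∘ suc)) (sym e) (s≤s z≤n))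
card-pos {b = b} (suc i) e = subst (1 ≤_) (sym (card-suc b)) (ℕ.≤-trans (card-pos i e) (ℕ.m≤n+m _ (𝟙 (b zero))))

card≡0 : ∀ {n} {b : Fin n → Bool} → card b ≡ 0 → ∀ i → b i ≡ false
card≡0 e i = ≢true⇒≡false λ t → contradiction (subst (1 ≤_) e (card-pos i t)) λ ()

card-exists : ∀ {n} (b : Fin n → Bool) → 1 ≤ card b → ∃[ i ] b i ≡ true
card-exists {zero}  b p = contradiction (subst (1 ≤_) (card-false {b = b} λ ()) p) λ ()
card-exists {suc n} b p with b zero in eq | subst (1 ≤_) (card-suc b) p
... | true  | _ = zero , eq
... | false | q with i , e ← card-exists (b ∘ suc) q = suc i , e

card-δ : ∀ {n} (b : Fin n → Bool) x → card (λ i → b i ∧ (x == i)) ≡ 𝟙 (b x)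
card-δ b x = trans (card-∑ _) (trans (∑-cong λ i → trans (𝟙-∧ (b i) _) (ℕ.*-comm (𝟙 (b i)) _)) (∑-δ (𝟙 ∘ b) x))

card-single : ∀ {n} (x : Fin n) → card (x ==_) ≡ 1
card-single x = card-δ (λ _ → true) x

card-remove : ∀ {n} (b : Fin n → Bool) x → card b ≡ 𝟙 (b x) + card (λ i → b i ∧ not (x == i))
card-remove b x = sym (trans (cong (_+ card (λ i → b i ∧ not (x == i))) (sym (card-δ b x))) (card-+ λ i → 𝟙-∧-not (b i) (x == i)))

-- Grouping by cell. With `b` a neighbourhood and `f` a weight on the cells, the sum over neighbours
-- becomes a row of cell counts applied to `f`; this is how walk counts descend to the quotient
-- matrix.
∑-fibres : ∀ {n r} (b : Fin n → Bool) (cell : Fin n → Fin r) (f : Fin r → ℕ) →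
           ∑ (λ z → 𝟙 (b z) * f (cell z)) ≡ ∑ (λ j → card (λ z → b z ∧ (cell z == j)) * f j)
∑-fibres b cell f = begin
  ∑ (λ z → 𝟙 (b z) * f (cell z))
    ≡⟨ ∑-cong (λ z → cong (𝟙 (b z) *_) (sym (∑-δ f (cell z)))) ⟩
  ∑ (λ z → 𝟙 (b z) * ∑ (λ j → 𝟙 (cell z == j) * f j))
    ≡⟨ ∑-cong (λ z → *-distribˡ-∑ (𝟙 (b z)) _) ⟩
  ∑ (λ z → ∑ (λ j → 𝟙 (b z) * (𝟙 (cell z == j) * f j)))
    ≡⟨ ∑-swap _ ⟩
  ∑ (λ j → ∑ (λ z → 𝟙 (b z) * (𝟙 (cell z == j) * f j)))
    ≡⟨ ∑-cong (λ j → ∑-cong (λ z → trans (sym (ℕ.*-assoc (𝟙 (b z)) _ _)) (cong (_* f j) (sym (𝟙-∧ (b z) _))))) ⟩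
  ∑ (λ j → ∑ (λ z → 𝟙 (b z ∧ (cell z == j)) * f j))
    ≡⟨ ∑-cong (λ j → trans (sym (*-distribʳ-∑ (f j) _)) (cong (_* f j) (sym (card-∑ _)))) ⟩
  ∑ (λ j → card (λ z → b z ∧ (cell z == j)) * f j) ∎
  where open ≡-Reasoning

card-fibres : ∀ {n r} (b : Fin n → Bool) (cell : Fin n → Fin r) →
           card b ≡ ∑ (λ j → card (λ z → b z ∧ (cell z == j)))
card-fibres b cell = trans (card-∑ b) (trans (∑-cong λ z → sym (ℕ.*-identityʳ _))
  (trans (∑-fibres b cell (λ _ → 1)) (∑-cong λ j → ℕ.*-identityʳ _)))

card-permute : ∀ {m n} (π : Fin m ↔ Fin n) (b : Fin n → Bool) → card (b ∘ Inverse.to π) ≡ card b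
card-permute π b = trans (card-∑ _) (trans (∑-permute π (𝟙 ∘ b)) (sym (card-∑ b)))

card-split : ∀ {n p q} (f : Fin n ↔ (Fin p ⊎ Fin q)) (b : Fin p ⊎ Fin q → Bool) →
          card (b ∘ Inverse.to f) ≡ card (b ∘ inj₁) + card (b ∘ inj₂)
card-split {n} {p} {q} f b = begin
  card (b ∘ Inverse.to f)             ≡⟨ card-cong (λ i → cong b (sym (Fin.splitAt-join p q (Inverse.to f i)))) ⟩
  card (b ∘ splitAt p ∘ Inverse.to π) ≡⟨ card-permute π (b ∘ splitAt p) ⟩
  card (b ∘ splitAt p)                ≡⟨ trans (card-∑ _) (∑-splitAt p _) ⟩
  _                                ≡⟨ cong₂ _+_ (sym (card-∑ _)) (sym (card-∑ _)) ⟩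
  card (b ∘ splitAt p ∘ (_↑ˡ q)) + card (b ∘ splitAt p ∘ (p ↑ʳ_))
    ≡⟨ cong₂ _+_ (card-cong λ i → cong b (Fin.splitAt-↑ˡ p i q)) (card-cong λ i → cong b (Fin.splitAt-↑ʳ p q i)) ⟩
  card (b ∘ inj₁) + card (b ∘ inj₂)      ∎
  where
  open ≡-Reasoning
  π : Permutation n (p + q)
  π = ↔-sym Fin.+↔⊎ ↔-∘ f

-- Subsets, partitions and cell functions

∣∣≡card : ∀ {n} (S : Subset n) → ∣ S ∣ ≡ card (lookup S)
∣∣≡card []          = sym (card-false λ ())
∣∣≡card (true  ∷ S) = trans (cong suc (∣∣≡card S)) (sym (card-suc _))
∣∣≡card (false ∷ S) = trans (∣∣≡card S) (sym (card-suc _))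

∣∩∣≡card : ∀ {n} (S S′ : Subset n) → ∣ S ∩ S′ ∣ ≡ card (λ i → lookup S i ∧ lookup S′ i)
∣∩∣≡card S S′ = trans (∣∣≡card (S ∩ S′)) (card-cong λ i → lookup-zipWith _∧_ i S S′)

∣tabulate∣ : ∀ {n} (b : Fin n → Bool) → ∣ tabulate b ∣ ≡ card b
∣tabulate∣ b = trans (∣∣≡card (tabulate b)) (card-cong (lookup∘tabulate b))

∣tabulate∩∣ : ∀ {n} (b : Fin n → Bool) (S : Subset n) → ∣ tabulate b ∩ S ∣ ≡ card (λ i → b i ∧ lookup S i)
∣tabulate∩∣ b S = trans (∣∩∣≡card (tabulate b) S) (card-cong λ i → cong (_∧ lookup S i) (lookup∘tabulate b i))

lookup-⁅⁆ : ∀ {n} (x z : Fin n) → lookup ⁅ x ⁆ z ≡ (z == x)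
lookup-⁅⁆ zero    zero    = sym (==-refl zero)
lookup-⁅⁆ zero    (suc z) = trans (lookup-replicate z outside) (sym (==-≢ λ ()))
lookup-⁅⁆ (suc x) zero    = sym (==-≢ λ ())
lookup-⁅⁆ (suc x) (suc z) = trans (lookup-⁅⁆ x z) (sym (==-suc z x))

subset-ext : ∀ {n} {S S′ : Subset n} → (∀ i → lookup S i ≡ lookup S′ i) → S ≡ S′
subset-ext {S = S} {S′} h = trans (sym (tabulate∘lookup S)) (trans (tabulate-cong h) (tabulate∘lookup S′))

to-injective : ∀ {A B : Set} (f : A ↔ B) {x y} → Inverse.to f x ≡ Inverse.to f y → x ≡ y
to-injective f {x} {y} e = trans (sym (strictlyInverseʳ x)) (trans (cong from e) (strictlyInverseʳ y))
  where open Inverse f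

common : ∀ {V : Set} {n} → (V → Fin n → Bool) → V → V → ℕ
common a x y = card (λ z → a x z ∧ a y z)

common-sym : ∀ {V : Set} {n} (a : V → Fin n → Bool) x y → common a x y ≡ common a y x
common-sym a x y = card-cong λ z → ∧-comm (a x z) (a y z)

common-refl : ∀ {V : Set} {n} (a : V → Fin n → Bool) x → common a x x ≡ card (a x)
common-refl a x = card-cong λ z → ∧-idem (a x z)

-- A partition is traded for the function naming the cell of each vertex: covering and disjointness
-- then hold by construction, and only non-emptiness of the fibres remains to be checked.
record _IsIndexOf_ {n v : ℕ} (cell : Fin v → Fin n) (B : Fin n → Subset v) : Set where
  constructor mkIndex
  field index : ∀ j z → lookup (B j) z ≡ (cell z == j)

open _IsIndexOf_ public

indexOf : ∀ {n v} {B : Fin n → Subset v} → IsPartition B → Σ[ cell ∈ (Fin v → Fin n) ] cell IsIndexOf B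
indexOf {B = B} P = cell , mkIndex λ j z → bool-ext
    (λ e → ==-≡ (disjoint z _ _ (proj₂ (cover z)) (lookup⇒[]= z (B j) e)))
    (λ e → trans (cong (λ i → lookup (B i) z) (sym (==⇒≡ e))) ([]=⇒lookup (proj₂ (cover z))))
  where
  open IsPartition P
  cell = λ z → proj₁ (cover z)

∈⇒index : ∀ {n v} {cell : Fin v → Fin n} {B} → cell IsIndexOf B → ∀ {z j} → z ∈ B j → cell z ≡ j
∈⇒index I {z} {j} m = ==⇒≡ (trans (sym (index I j z)) ([]=⇒lookup m))

index⇒∈ : ∀ {n v} {cell : Fin v → Fin n} {B} → cell IsIndexOf B → ∀ {z j} → cell z ≡ j → z ∈ B j
index⇒∈ {B = B} I {z} {j} e = lookup⇒[]= z (B j) (trans (index I j z) (==-≡ e))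

fibre : ∀ {n v} → (Fin v → Fin n) → Fin n → ℕ
fibre cell j = card (λ z → cell z == j)

size-fibre : ∀ {n v} {cell : Fin v → Fin n} {B} → cell IsIndexOf B → ∀ j → ∣ B j ∣ ≡ fibre cell j
size-fibre {B = B} I j = trans (∣∣≡card (B j)) (card-cong (index I j))

isPartition : ∀ {n v} {cell : Fin v → Fin n} {B} → cell IsIndexOf B →
              (∀ j → 1 ≤ fibre cell j) → IsPartition B
isPartition {cell = cell} I pos = record
  { nonempty = λ j → let z , e = card-exists _ (pos j) in z , index⇒∈ I (==⇒≡ e)
  ; cover    = λ z → cell z , index⇒∈ I refl
  ; disjoint = λ z i j p q → trans (sym (∈⇒index I p)) (∈⇒index I q)
  }

card-total : ∀ {n v} (cell : Fin v → Fin n) → v ≡ ∑ (fibre cell)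
card-total {v = v} cell = trans (sym (card-true {v} λ _ → refl)) (card-fibres (λ _ → true) cell)

record Cells {n v : ℕ} (Γ : Graph (Fin v)) (D : Diagram n) (cell : Fin v → Fin n) : Set where
  field
    sizes  : ∀ j → fibre cell j ≡ size D j
    counts : ∀ z j → card (λ w → adj Γ z w ∧ (cell w == j)) ≡ quotient D (cell z) j

∣∩cell∣ : ∀ {n v} (Γ : Graph (Fin v)) {cell : Fin v → Fin n} {B} → cell IsIndexOf B → ∀ z j →
         ∣ neighbours Γ z ∩ B j ∣ ≡ card (λ w → adj Γ z w ∧ (cell w == j))
∣∩cell∣ Γ {B = B} I z j = trans (∣tabulate∩∣ (adj Γ z) (B j)) (card-cong λ w → cong (adj Γ z w ∧_) (index I j w))

toCells : ∀ {n v} {Γ : Graph (Fin v)} {B} {D : Diagram n} → HasDiagram Γ B D →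
          Σ[ cell ∈ (Fin v → Fin n) ] cell IsIndexOf B × Cells Γ D cell
toCells {Γ = Γ} {B} {D} H with cell , I ← indexOf (HasDiagram.isPartition H) = cell , I , record
  { sizes  = λ j → trans (sym (size-fibre I j)) (HasDiagram.sizes H j)
  ; counts = λ z j → trans (sym (∣∩cell∣ Γ I z j)) (HasDiagram.equitable H (cell z) j z (index⇒∈ I refl))
  }

fromCells : ∀ {n v} {Γ : Graph (Fin v)} {B} {D : Diagram n} {cell : Fin v → Fin n} → cell IsIndexOf B →
            (∀ j → 1 ≤ size D j) → Cells Γ D cell → HasDiagram Γ B D
fromCells {Γ = Γ} {D = D} {cell} I pos C = record
  { isPartition = isPartition I λ j → subst (1 ≤_) (sym (sizes j)) (pos j)
  ; sizes       = λ j → trans (size-fibre I j) (sizes j)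
  ; equitable   = λ i j z z∈ → trans (∣∩cell∣ Γ I z j)
                    (trans (counts z j) (cong (λ h → quotient D h j) (∈⇒index I z∈)))
  }
  where open Cells C

-- Colours and the antipodal structure

same : Bool → Bool → Bool
same true  b = b
same false b = not b

same-≡ : ∀ {a b} → a ≡ b → same a b ≡ true
same-≡ {true}  refl = refl
same-≡ {false} refl = refl

same⇒≡ : ∀ {a b} → same a b ≡ true → a ≡ b
same⇒≡ {true}  {true}  _ = refl
same⇒≡ {false} {false} _ = refl

same-not : ∀ {a b} → b ≡ not a → same a b ≡ false
same-not {true}  refl = refl
same-not {false} refl = refl

same-false : ∀ {a b} → same a b ≡ false → b ≡ not a
same-false {true}  {false} _ = refl
same-false {false} {true}  _ = refl

same-notʳ : ∀ a b → same a (not b) ≡ not (same a b)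
same-notʳ true  b = refl
same-notʳ false b = refl

same-notˡ : ∀ a b → same (not a) b ≡ not (same a b)
same-notˡ true  b = refl
same-notˡ false b = sym (not-involutive b)

not-flip : ∀ {a b} → b ≡ not a → a ≡ not b
not-flip {a} refl = sym (not-involutive a)

𝟙-partition : ∀ p q s → (p ≡ true → s ≡ true) → (q ≡ true → s ≡ true) → ¬ (p ∧ q ≡ true) →
              𝟙 p + 𝟙 q + 𝟙 (s ∧ not p ∧ not q) ≡ 𝟙 s
𝟙-partition true  true  s     f g h = contradiction refl h
𝟙-partition true  false s     f g h rewrite f refl = refl
𝟙-partition false true  s     f g h rewrite g refl = refl
𝟙-partition false false true  f g h = refl
𝟙-partition false false false f g h = refl

-- The parameter μ. The oddness of `k` is used only through `k ≡ suc (half k + half k)`.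
half : ℕ → ℕ
half k = (k ∸ 1) / 2

-- Compatibility of `τ` with adjacency is not a field: a design supplies `τ` on points and on blocks
-- separately. It is derived as `adj-τ`.
record Antipodal {v : ℕ} (k : ℕ) (Γ : Graph (Fin v)) : Set where
  field
    colour    : Fin v → Bool
    proper    : ∀ {x y} → adj Γ x y ≡ true → colour y ≡ not (colour x)
    τ         : Fin v → Fin v
    τ-invol   : ∀ x → τ (τ x) ≡ x
    τ-≢       : ∀ x → τ x ≢ x
    τ-colour  : ∀ x → colour (τ x) ≡ colour x
    regular   : ∀ x → card (adj Γ x) ≡ k
    common-τ  : ∀ x → common (adj Γ) x (τ x) ≡ 0
    common-μ  : ∀ {x y} → colour x ≡ colour y → x ≢ y → τ x ≢ y → common (adj Γ) x y ≡ half k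
    classSize : ∀ b → card (λ z → same b (colour z)) ≡ 2 + (k + k)

-- Reflection of the diagram: how the cell of a vertex changes when the base `x` is replaced by
-- `τ x`.
flip : Fin 6 → Fin 6
flip 0F = 4F
flip 1F = 3F
flip 2F = 2F
flip 3F = 1F
flip 4F = 0F
flip 5F = 5F

even : Fin 6 → Bool
even 0F = true
even 1F = false
even 2F = true
even 3F = false
even 4F = true
even 5F = false

𝟙-even : ∀ h b → 𝟙 (b ∧ (h == 0F)) + 𝟙 (b ∧ (h == 4F)) + 𝟙 (b ∧ (h == 2F)) ≡ 𝟙 (b ∧ even h)
𝟙-even h false = refl
𝟙-even 0F true rewrite ==-refl {6} 0F | ==-≢ {6} {0F} {4F} (λ ()) | ==-≢ {6} {0F} {2F} (λ ()) = refl
𝟙-even 1F true rewrite ==-≢ {6} {1F} {0F} (λ ()) | ==-≢ {6} {1F} {4F} (λ ()) | ==-≢ {6} {1F} {2F} (λ ()) = refl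
𝟙-even 2F true rewrite ==-refl {6} 2F | ==-≢ {6} {2F} {4F} (λ ()) | ==-≢ {6} {2F} {0F} (λ ()) = refl
𝟙-even 3F true rewrite ==-≢ {6} {3F} {0F} (λ ()) | ==-≢ {6} {3F} {4F} (λ ()) | ==-≢ {6} {3F} {2F} (λ ()) = refl
𝟙-even 4F true rewrite ==-refl {6} 4F | ==-≢ {6} {4F} {0F} (λ ()) | ==-≢ {6} {4F} {2F} (λ ()) = refl
𝟙-even 5F true rewrite ==-≢ {6} {5F} {0F} (λ ()) | ==-≢ {6} {5F} {4F} (λ ()) | ==-≢ {6} {5F} {2F} (λ ()) = refl

𝟙-odd : ∀ h b → 𝟙 (b ∧ (h == 1F)) + 𝟙 (b ∧ (h == 3F)) + 𝟙 (b ∧ (h == 5F)) ≡ 𝟙 (b ∧ not (even h))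
𝟙-odd h false = refl
𝟙-odd 0F true rewrite ==-≢ {6} {0F} {1F} (λ ()) | ==-≢ {6} {0F} {3F} (λ ()) | ==-≢ {6} {0F} {5F} (λ ()) = refl
𝟙-odd 1F true rewrite ==-refl {6} 1F | ==-≢ {6} {1F} {3F} (λ ()) | ==-≢ {6} {1F} {5F} (λ ()) = refl
𝟙-odd 2F true rewrite ==-≢ {6} {2F} {1F} (λ ()) | ==-≢ {6} {2F} {3F} (λ ()) | ==-≢ {6} {2F} {5F} (λ ()) = refl
𝟙-odd 3F true rewrite ==-refl {6} 3F | ==-≢ {6} {3F} {1F} (λ ()) | ==-≢ {6} {3F} {5F} (λ ()) = refl
𝟙-odd 4F true rewrite ==-≢ {6} {4F} {1F} (λ ()) | ==-≢ {6} {4F} {3F} (λ ()) | ==-≢ {6} {4F} {5F} (λ ()) = refl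
𝟙-odd 5F true rewrite ==-refl {6} 5F | ==-≢ {6} {5F} {1F} (λ ()) | ==-≢ {6} {5F} {3F} (λ ()) = refl

-- The order 0, 4, 2 puts last the cell defined by "otherwise"; once the other two counts and the
-- total are known, `sub₃` yields it. In `card-odd` cell 5 plays this part.
card-even : ∀ {v} (b : Fin v → Bool) (f : Fin v → Fin 6) →
         card (λ z → b z ∧ (f z == 0F)) + card (λ z → b z ∧ (f z == 4F)) + card (λ z → b z ∧ (f z == 2F))
         ≡ card (λ z → b z ∧ even (f z))
card-even b f = card-+₃ λ z → 𝟙-even (f z) (b z)

card-odd : ∀ {v} (b : Fin v → Bool) (f : Fin v → Fin 6) →
        card (λ z → b z ∧ (f z == 1F)) + card (λ z → b z ∧ (f z == 3F)) + card (λ z → b z ∧ (f z == 5F))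
        ≡ card (λ z → b z ∧ not (even (f z)))
card-odd b f = card-+₃ λ z → 𝟙-odd (f z) (b z)

-- The automorphism τ, the six relations and their diagram

module AntipodalProperties {v k : ℕ} (Γ : Graph (Fin v)) (k≡ : k ≡ suc (half k + half k)) (1≤μ : 1 ≤ half k)
                           (𝒜 : Antipodal k Γ) where
  open Antipodal 𝒜

  private
    V = Fin v
    μ = half k

  a : V → V → Bool
  a = adj Γ

  cn : V → V → ℕ
  cn = common a

  a-sym : ∀ {x y} → a x y ≡ true → a y x ≡ true
  a-sym {x} {y} e = trans (symm Γ y x) e

  a-same : ∀ {x y} → colour x ≡ colour y → a x y ≡ false
  a-same e = ≢true⇒≡false λ t → not-¬ (sym e) (proper t)

  τ-swap : ∀ {x y} → τ x ≡ y → τ y ≡ x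
  τ-swap {x} refl = τ-invol x

  no-common : ∀ {x z} → a x z ≡ true → a (τ x) z ≡ true → ⊥
  no-common {x} {z} p q = true≢false (cong₂ _∧_ p q) (card≡0 (common-τ x) z)

  proper₂ : ∀ {x y z} → a x y ≡ true → a z y ≡ true → colour x ≡ colour z
  proper₂ {x} {y} {z} p q = trans (not-flip (proper p)) (sym (not-flip (proper q)))

  -- As μ is positive, the absence of common neighbours singles out the partner, so `τ` is
  -- determined by adjacency and colour.
  common-0⇒τ : ∀ {x y} → colour x ≡ colour y → x ≢ y → cn x y ≡ 0 → τ x ≡ y
  common-0⇒τ {x} {y} e x≢y c0 with τ x Fin.≟ y
  ... | yes p = p
  ... | no ¬p = contradiction (subst (1 ≤_) (trans (sym (common-μ e x≢y ¬p)) c0) 1≤μ) λ ()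

  -- If x, τ y were not adjacent, x would be one of the two vertices outside
  -- N(y) ∪ N(τ y).  Any vertex other than y, τ y has exactly k − 2μ = 1 neighbour
  -- among these two, so the other one is τ x; but τ x is adjacent to y.
  adj-τ-true : ∀ {x y} → a (τ x) y ≡ true → a x (τ y) ≡ true
  adj-τ-true {x} {y} τx~y with a x (τ y) in x≁τy
  ... | true  = refl
  ... | false = ⊥-elim impossible
    where
    yx : colour y ≡ not (colour x)
    yx = trans (proper τx~y) (cong not (τ-colour x))
    out : V → Bool
    out z = same (colour x) (colour z) ∧ not (a y z) ∧ not (a (τ y) z)
    side : ∀ {w z} → colour w ≡ colour y → a w z ≡ true → same (colour x) (colour z) ≡ true
    side {w} e t = same-≡ (trans (not-flip yx) (sym (trans (proper t) (cong not e))))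
    disjoint : ∀ z → ¬ (a y z ∧ a (τ y) z ≡ true)
    disjoint z t = no-common (∧-trueˡ t) (∧-trueʳ {a y z} t)
    cardout : card out ≡ 2
    cardout = ℕ.+-cancelˡ-≡ (k + k) _ _ (begin
      k + k + card out                   ≡⟨ cong (_+ card out) (cong₂ _+_ (sym (regular y)) (sym (regular (τ y)))) ⟩
      card (a y) + card (a (τ y)) + card out   ≡⟨ card-+₃ (λ z → 𝟙-partition (a y z) (a (τ y) z) _ (side refl) (side (τ-colour y)) (disjoint z)) ⟩
      card (λ z → same (colour x) (colour z)) ≡⟨ classSize (colour x) ⟩
      2 + (k + k)                     ≡⟨ ℕ.+-comm 2 (k + k) ⟩
      k + k + 2                       ∎)
      where open ≡-Reasoning
    out-x : out x ≡ true
    out-x rewrite same-≡ {colour x} refl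
                | ≢true⇒≡false {a y x} (λ t → no-common (a-sym t) τx~y)
                | trans (symm Γ (τ y) x) x≁τy = refl
    out-τx : out (τ x) ≡ false
    out-τx rewrite a-sym τx~y = ∧-zeroʳ (same (colour x) (colour (τ x)))
    out-a : ∀ {z} → out z ≡ true → a y z ≡ false × a (τ y) z ≡ false
    out-a {z} t with same (colour x) (colour z) | a y z | a (τ y) z
    ... | true | false | false = refl , refl
    rest : ∃[ w ] out w ∧ not (x == w) ≡ true
    rest = card-exists _ (ℕ.≤-reflexive (ℕ.+-cancelˡ-≡ 1 _ _ (trans (sym cardout)
      (trans (card-remove out x) (cong (λ b → 𝟙 b + card (λ i → out i ∧ not (x == i))) out-x)))))
    w = proj₁ rest
    out-w : out w ≡ true
    out-w = ∧-trueˡ (proj₂ rest)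
    x≢w : x ≢ w
    x≢w e = true≢false (∧-trueʳ {out w} (proj₂ rest)) (cong not (==-≡ e))
    one : ∀ z → colour y ≡ colour z → y ≢ z → τ y ≢ z → card (λ t → out t ∧ a z t) ≡ 1
    one z yz ne ne′ = ℕ.+-cancelˡ-≡ (μ + μ) _ _ (begin
      μ + μ + O                  ≡⟨ cong (_+ O) (cong₂ _+_ (sym (common-μ yz ne ne′))
                                    (sym (common-μ (trans (τ-colour y) yz) ne′ (ne ∘ trans (sym (τ-invol y)))))) ⟩
      cn y z + cn (τ y) z + O    ≡⟨ card-+₃ (λ t → restrict (a y t) (a (τ y) t) _ (a z t)
                                      (𝟙-partition (a y t) (a (τ y) t) _ (side refl) (side (τ-colour y)) (disjoint t)) (side (sym yz))) ⟩
      card (a z)                    ≡⟨ regular z ⟩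
      k                          ≡⟨ k≡ ⟩
      suc (μ + μ)                ≡⟨ ℕ.+-comm 1 (μ + μ) ⟩
      μ + μ + 1                  ∎)
      where
      open ≡-Reasoning
      O = card (λ t → out t ∧ a z t)
      restrict : ∀ p q s r → 𝟙 p + 𝟙 q + 𝟙 (s ∧ not p ∧ not q) ≡ 𝟙 s → (r ≡ true → s ≡ true) →
                 𝟙 (p ∧ r) + 𝟙 (q ∧ r) + 𝟙 ((s ∧ not p ∧ not q) ∧ r) ≡ 𝟙 r
      restrict p q s true h f = trans (cong₂ _+_ (cong₂ _+_ (cong 𝟙 (∧-identityʳ p)) (cong 𝟙 (∧-identityʳ q))) (cong 𝟙 (∧-identityʳ _))) (trans h (cong 𝟙 (f refl)))
      restrict p q s false h f rewrite ∧-comm p false | ∧-comm q false | ∧-comm (s ∧ not p ∧ not q) false = refl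
    -- A common neighbour `z` of `x` and `w` is neither `y` nor `τ y`, because `x` lies outside both
    -- neighbourhoods. So `one` applies to `z`, yet `z` would see two members of `out`. Without
    -- common neighbours, `w` must be `τ x`.
    cn-xw : cn x w ≡ 0
    cn-xw = card-false λ z → ≢true⇒≡false λ t →
      let x~z = ∧-trueˡ t
          w~z = ∧-trueʳ {a x z} t
          y≢z = λ e → true≢false (a-sym (subst (λ u → a x u ≡ true) (sym e) x~z)) (proj₁ (out-a out-x))
          τy≢z = λ e → true≢false (a-sym (subst (λ u → a x u ≡ true) (sym e) x~z)) (proj₂ (out-a out-x))
          b = λ u → out u ∧ a z u
          none = ℕ.+-cancelˡ-≡ 1 _ _ (trans (sym (cong (λ c → 𝟙 c + card (λ i → b i ∧ not (x == i))) (cong₂ _∧_ out-x (a-sym x~z))))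
                   (trans (sym (card-remove b x)) (one z (trans yx (sym (proper x~z))) y≢z τy≢z)))
      in true≢false (cong₂ _∧_ (cong₂ _∧_ out-w (a-sym w~z)) (cong not (==-≢ x≢w))) (card≡0 none w)
    impossible : ⊥
    impossible = true≢false (subst (λ u → out u ≡ true) (sym (common-0⇒τ (same⇒≡ (∧-trueˡ out-w)) x≢w cn-xw)) out-w) out-τx

  -- Since `τ` is an involution, this says that it is an automorphism. The converse of `adj-τ-true`
  -- is the same lemma with the two vertices exchanged.
  adj-τ : ∀ x y → a (τ x) y ≡ a x (τ y)
  adj-τ x y = bool-ext adj-τ-true λ t → a-sym (adj-τ-true (a-sym t))

  -- The index is the cell of `𝒬 k` to which `y` belongs when `x` is the base. As a view of `rel` it
  -- allows case analysis by meaning instead of by nested Boolean tests.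
  data Rel (x y : V) : Fin 6 → Set where
    is0 : x ≡ y → Rel x y 0F
    is1 : a x y ≡ true → Rel x y 1F
    is2 : colour x ≡ colour y → x ≢ y → τ x ≢ y → Rel x y 2F
    is3 : a (τ x) y ≡ true → Rel x y 3F
    is4 : τ x ≡ y → Rel x y 4F
    is5 : colour y ≡ not (colour x) → a x y ≡ false → a (τ x) y ≡ false → Rel x y 5F

  opaque
    rel : V → V → Fin 6
    rel x y = if same (colour x) (colour y)
      then (if x == y then 0F else if τ x == y then 4F else 2F)
      else (if a x y then 1F else if a (τ x) y then 3F else 5F)

    rel-view : ∀ x y → Rel x y (rel x y)
    rel-view x y with same (colour x) (colour y) in s
    rel-view x y | true with x == y in e
    ... | true  = is0 (==⇒≡ e)
    ... | false with τ x == y in e′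
    ...   | true  = is4 (==⇒≡ e′)
    ...   | false = is2 (same⇒≡ s) (λ p → true≢false (==-≡ p) e) (λ p → true≢false (==-≡ p) e′)
    rel-view x y | false with a x y in e
    ... | true  = is1 e
    ... | false with a (τ x) y in e′
    ...   | true  = is3 e′
    ...   | false = is5 (same-false s) e e′

    -- The cases exclude one another: colours separate even from odd cells, `τ` has no fixed point,
    -- and `x` and `τ x` have no common neighbour.
    rel-unique : ∀ {x y h} → Rel x y h → rel x y ≡ h
    rel-unique {x} (is0 refl) rewrite same-≡ {colour x} refl | ==-refl x = refl
    rel-unique (is1 e) rewrite same-not (proper e) | e = refl
    rel-unique (is2 s e e′) rewrite same-≡ s | ==-≢ e | ==-≢ e′ = refl
    rel-unique {x} {y} (is3 e) rewrite same-not {colour x} (trans (proper e) (cong not (τ-colour x)))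
      | ≢true⇒≡false {a x y} (λ t → no-common t e) | e = refl
    rel-unique {x} (is4 refl) rewrite same-≡ (sym (τ-colour x)) | ==-≢ (τ-≢ x ∘ sym) | ==-refl (τ x) = refl
    rel-unique (is5 s e e′) rewrite same-not s | e | e′ = refl

  -- Cases 3 and 5 are where τ must be an automorphism: they compare `τ x ~ y` with `τ y ~ x`.
  rel-sym : ∀ x y → rel y x ≡ rel x y
  rel-sym x y = rel-unique (go (rel-view x y))
    where
    go : ∀ {h} → Rel x y h → Rel y x h
    go (is0 e) = is0 (sym e)
    go (is1 e) = is1 (a-sym e)
    go (is2 s e e′) = is2 (sym s) (e ∘ sym) (e′ ∘ τ-swap)
    go (is3 e) = is3 (trans (adj-τ y x) (a-sym e))
    go (is4 e) = is4 (τ-swap e)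
    go (is5 s e e′) = is5 (not-flip s) (trans (symm Γ y x) e)
      (trans (adj-τ y x) (trans (symm Γ y (τ x)) e′))

  rel-τ : ∀ x y → rel (τ x) y ≡ flip (rel x y)
  rel-τ x y = rel-unique (go (rel-view x y))
    where
    ττ : a (τ (τ x)) y ≡ a x y
    ττ = cong (λ u → a u y) (τ-invol x)
    go : ∀ {h} → Rel x y h → Rel (τ x) y (flip h)
    go (is0 e) = is4 (trans (τ-invol x) e)
    go (is1 e) = is3 (trans ττ e)
    go (is2 s e e′) = is2 (trans (τ-colour x) s) e′ (e ∘ trans (sym (τ-invol x)))
    go (is3 e) = is1 e
    go (is4 e) = is0 e
    go (is5 s e e′) = is5 (trans s (cong not (sym (τ-colour x)))) e′ (trans ττ e)

  rel-even : ∀ x y → even (rel x y) ≡ same (colour x) (colour y)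
  rel-even x y = go (rel-view x y)
    where
    go : ∀ {h} → Rel x y h → even h ≡ same (colour x) (colour y)
    go (is0 e) = sym (same-≡ (cong colour e))
    go (is1 e) = sym (same-not (proper e))
    go (is2 s _ _) = sym (same-≡ s)
    go (is3 e) = sym (same-not (trans (proper e) (cong not (τ-colour x))))
    go (is4 e) = sym (same-≡ (trans (sym (τ-colour x)) (cong colour e)))
    go (is5 s _ _) = sym (same-not s)

  private
    rel⇒ : ∀ {x y h} → (rel x y == h) ≡ true → Rel x y h
    rel⇒ {x} {y} e = subst (Rel x y) (==⇒≡ e) (rel-view x y)

  rel-0 : ∀ x y → (rel x y == 0F) ≡ (x == y)
  rel-0 x y = bool-ext (λ e → case₀ (rel⇒ e)) (λ e → ==-≡ (rel-unique (is0 (==⇒≡ e))))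
    where
    case₀ : Rel x y 0F → (x == y) ≡ true
    case₀ (is0 e) = ==-≡ e

  rel-4 : ∀ x y → (rel x y == 4F) ≡ (τ x == y)
  rel-4 x y = bool-ext (λ e → case₄ (rel⇒ e)) (λ e → ==-≡ (rel-unique (is4 (==⇒≡ e))))
    where
    case₄ : Rel x y 4F → (τ x == y) ≡ true
    case₄ (is4 e) = ==-≡ e

  rel-1 : ∀ x y → (rel x y == 1F) ≡ a x y
  rel-1 x y = bool-ext (λ e → case₁ (rel⇒ e)) (λ e → ==-≡ (rel-unique (is1 e)))
    where
    case₁ : Rel x y 1F → a x y ≡ true
    case₁ (is1 e) = e

  rel-3 : ∀ x y → (rel x y == 3F) ≡ a (τ x) y
  rel-3 x y = bool-ext (λ e → case₃ (rel⇒ e)) (λ e → ==-≡ (rel-unique (is3 e)))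
    where
    case₃ : Rel x y 3F → a (τ x) y ≡ true
    case₃ (is3 e) = e

  card-rel-0 : ∀ (b : V → Bool) y → card (λ z → b z ∧ (rel y z == 0F)) ≡ 𝟙 (b y)
  card-rel-0 b y = trans (card-cong λ z → cong (b z ∧_) (rel-0 y z)) (card-δ b y)

  card-rel-4 : ∀ (b : V → Bool) y → card (λ z → b z ∧ (rel y z == 4F)) ≡ 𝟙 (b (τ y))
  card-rel-4 b y = trans (card-cong λ z → cong (b z ∧_) (rel-4 y z)) (card-δ b (τ y))

  card-rel-1 : ∀ x y → card (λ z → a x z ∧ (rel y z == 1F)) ≡ cn x y
  card-rel-1 x y = card-cong λ z → cong (a x z ∧_) (rel-1 y z)

  card-rel-3 : ∀ x y → card (λ z → a x z ∧ (rel y z == 3F)) ≡ cn x (τ y)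
  card-rel-3 x y = card-cong λ z → cong (a x z ∧_) (rel-3 y z)

  cn-refl : ∀ x → cn x x ≡ k
  cn-refl x = trans (common-refl a x) (regular x)

  cn-opposite : ∀ {x y} → colour y ≡ not (colour x) → cn x y ≡ 0
  cn-opposite {x} {y} e = card-false λ z → ≢true⇒≡false λ t →
    not-¬ (proper₂ {x} {z} {y} (∧-trueˡ t) (∧-trueʳ {a x z} t)) (not-flip e)

  -- Columns 0, 4, 1 and 3 of the quotient matrix. For a vertex `x` seen from the base `y` they
  -- count adjacency to `y`, adjacency to `τ y`, common neighbours with `y` and common neighbours
  -- with `τ y`.
  adj₀ adj₄ cn₁ cn₃ : Fin 6 → ℕ
  adj₀ 1F = 1
  adj₀ _  = 0
  adj₄ 3F = 1
  adj₄ _  = 0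
  cn₁ 0F = k
  cn₁ 2F = μ
  cn₁ _  = 0
  cn₃ 2F = μ
  cn₃ 4F = k
  cn₃ _  = 0

  𝟙-adj : ∀ y x → 𝟙 (a x y) ≡ adj₀ (rel y x)
  𝟙-adj y x = go (rel-view y x)
    where
    go : ∀ {h} → Rel y x h → 𝟙 (a x y) ≡ adj₀ h
    go (is0 e) = cong 𝟙 (a-same (cong colour (sym e)))
    go (is1 e) = cong 𝟙 (a-sym e)
    go (is2 s _ _) = cong 𝟙 (a-same (sym s))
    go (is3 e) = cong 𝟙 (≢true⇒≡false λ t → no-common (a-sym t) e)
    go (is4 e) = cong 𝟙 (a-same (trans (cong colour (sym e)) (τ-colour y)))
    go (is5 _ e _) = cong 𝟙 (trans (symm Γ x y) e)

  cn-rel : ∀ y x → cn x y ≡ cn₁ (rel y x)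
  cn-rel y x = go (rel-view y x)
    where
    go : ∀ {h} → Rel y x h → cn x y ≡ cn₁ h
    go (is0 refl) = cn-refl x
    go (is1 e) = cn-opposite (not-flip (proper e))
    go (is2 s e e′) = trans (common-sym a x y) (common-μ s e e′)
    go (is3 e) = cn-opposite (not-flip (trans (proper e) (cong not (τ-colour y))))
    go (is4 refl) = trans (common-sym a x y) (common-τ y)
    go (is5 s _ _) = cn-opposite (not-flip s)

  adj₀-flip : ∀ h → adj₀ (flip h) ≡ adj₄ h
  adj₀-flip 0F = refl
  adj₀-flip 1F = refl
  adj₀-flip 2F = refl
  adj₀-flip 3F = refl
  adj₀-flip 4F = refl
  adj₀-flip 5F = refl

  cn₁-flip : ∀ h → cn₁ (flip h) ≡ cn₃ h
  cn₁-flip 0F = refl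
  cn₁-flip 1F = refl
  cn₁-flip 2F = refl
  cn₁-flip 3F = refl
  cn₁-flip 4F = refl
  cn₁-flip 5F = refl

  𝟙-adj-τ : ∀ y x → 𝟙 (a x (τ y)) ≡ adj₄ (rel y x)
  𝟙-adj-τ y x = trans (𝟙-adj (τ y) x) (trans (cong adj₀ (rel-τ y x)) (adj₀-flip (rel y x)))

  cn-rel-τ : ∀ y x → cn x (τ y) ≡ cn₃ (rel y x)
  cn-rel-τ y x = trans (cn-rel (τ y) x) (trans (cong cn₁ (rel-τ y x)) (cn₁-flip (rel y x)))

  count-even : ∀ y x → card (λ z → a x z ∧ even (rel y z)) ≡ (if even (rel y x) then 0 else k)
  count-even y x rewrite rel-even y x with same (colour y) (colour x) in s
  ... | true  = card-false λ z → ≢true⇒≡false λ t →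
        not-¬ (sym (trans (sym (same⇒≡ {colour y} s)) (same⇒≡ {colour y} (trans (sym (rel-even y z)) (∧-trueʳ {a x z} t))))) (proper (∧-trueˡ t))
  ... | false = trans (card-cong λ z → lem z) (regular x)
    where
    lem : ∀ z → a x z ∧ even (rel y z) ≡ a x z
    lem z with a x z in e
    ... | false = refl
    ... | true  = trans (rel-even y z) (same-≡ (trans (not-flip (same-false {colour y} s)) (sym (proper e))))

  count-odd : ∀ y x → card (λ z → a x z ∧ not (even (rel y z))) ≡ (if even (rel y x) then k else 0)
  count-odd y x = ℕ.+-cancelˡ-≡ E _ _ (trans (trans (card-+ λ z → 𝟙-∧-not (a x z) (even (rel y z))) (regular x))
      (trans (sym (if-sum (even (rel y x)))) (cong (_+ (if even (rel y x) then k else 0)) (sym (count-even y x)))))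
    where
    E = card (λ z → a x z ∧ even (rel y z))
    if-sum : ∀ b → (if b then 0 else k) + (if b then k else 0) ≡ k
    if-sum true  = refl
    if-sum false = ℕ.+-identityʳ k

  sub₃ : ∀ {p q r t p′ q′ t′} → p + q + r ≡ t → p ≡ p′ → q ≡ q′ → t ≡ t′ → r ≡ t′ ∸ (p′ + q′)
  sub₃ {p} {q} {r} refl refl refl refl = sym (ℕ.m+n∸m≡n (p + q) r)

  -- Cells 0 and 4 are the singletons of `y` and `τ y`, cells 1 and 3 their neighbourhoods, so these
  -- four columns are adjacencies and common-neighbour counts. Columns 2 and 5 are what remains of
  -- the degree on the two sides.
  cells : ∀ y → Cells Γ (𝒬 k) (rel y)
  cells y = record { sizes = szs ; counts = cts }
    where
    szs : ∀ j → fibre (rel y) j ≡ size (𝒬 k) j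
    szs 0F = trans (card-cong (rel-0 y)) (card-single y)
    szs 1F = trans (card-cong (rel-1 y)) (regular y)
    szs 2F = trans (sub₃ (card-even (λ _ → true) (rel y)) (szs 0F) (szs 4F)
               (trans (card-cong (rel-even y)) (classSize (colour y)))) (cong (k +_) (sym (ℕ.+-identityʳ k)))
    szs 3F = trans (card-cong (rel-3 y)) (regular (τ y))
    szs 4F = trans (card-cong (rel-4 y)) (card-single (τ y))
    szs 5F = trans (sub₃ (card-odd (λ _ → true) (rel y)) (szs 1F) (szs 3F)
               (trans (card-cong λ z → trans (cong not (rel-even y z)) (sym (same-notˡ (colour y) (colour z)))) (classSize (not (colour y)))))
               (ℕ.m+n∸n≡m 2 (k + k))
    cnt-0 : ∀ x → card (λ z → a x z ∧ (rel y z == 0F)) ≡ adj₀ (rel y x)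
    cnt-0 x = trans (card-rel-0 (a x) y) (𝟙-adj y x)
    cnt-4 : ∀ x → card (λ z → a x z ∧ (rel y z == 4F)) ≡ adj₄ (rel y x)
    cnt-4 x = trans (card-rel-4 (a x) y) (𝟙-adj-τ y x)
    cnt-1 : ∀ x → card (λ z → a x z ∧ (rel y z == 1F)) ≡ cn₁ (rel y x)
    cnt-1 x = trans (card-rel-1 x y) (cn-rel y x)
    cnt-3 : ∀ x → card (λ z → a x z ∧ (rel y z == 3F)) ≡ cn₃ (rel y x)
    cnt-3 x = trans (card-rel-3 x y) (cn-rel-τ y x)
    cts : ∀ x j → card (λ z → a x z ∧ (rel y z == j)) ≡ quotient (𝒬 k) (rel y x) j
    cts x 0F = trans (cnt-0 x) (q0 (rel y x))
      where
      q0 : ∀ h → adj₀ h ≡ quotient (𝒬 k) h 0F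
      q0 0F = refl
      q0 1F = refl
      q0 2F = refl
      q0 3F = refl
      q0 4F = refl
      q0 5F = refl
    cts x 1F = trans (cnt-1 x) (q1 (rel y x))
      where
      q1 : ∀ h → cn₁ h ≡ quotient (𝒬 k) h 1F
      q1 0F = refl
      q1 1F = refl
      q1 2F = refl
      q1 3F = refl
      q1 4F = refl
      q1 5F = refl
    cts x 2F = trans (sub₃ (card-even (a x) (rel y)) (cnt-0 x) (cnt-4 x) (count-even y x)) (q2 (rel y x))
      where
      q2 : ∀ h → (if even h then 0 else k) ∸ (adj₀ h + adj₄ h) ≡ quotient (𝒬 k) h 2F
      q2 0F = refl
      q2 1F = refl
      q2 2F = refl
      q2 3F = refl
      q2 4F = refl
      q2 5F = refl
    cts x 3F = trans (cnt-3 x) (q3 (rel y x))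
      where
      q3 : ∀ h → cn₃ h ≡ quotient (𝒬 k) h 3F
      q3 0F = refl
      q3 1F = refl
      q3 2F = refl
      q3 3F = refl
      q3 4F = refl
      q3 5F = refl
    cts x 4F = trans (cnt-4 x) (q4 (rel y x))
      where
      q4 : ∀ h → adj₄ h ≡ quotient (𝒬 k) h 4F
      q4 0F = refl
      q4 1F = refl
      q4 2F = refl
      q4 3F = refl
      q4 4F = refl
      q4 5F = refl
    cts x 5F = trans (sub₃ (card-odd (a x) (rel y)) (cnt-1 x) (cnt-3 x) (count-odd y x)) (q5 (rel y x))
      where
      q5 : ∀ h → (if even h then k else 0) ∸ (cn₁ h + cn₃ h) ≡ quotient (𝒬 k) h 5F
      q5 0F = trans (cong (k ∸_) (ℕ.+-identityʳ k)) (ℕ.n∸n≡0 k)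
      q5 1F = refl
      -- The entry 1 from cell 2 to cell 5 is `k − 2μ`.
      q5 2F = trans (cong (_∸ (μ + μ)) k≡) (ℕ.m+n∸n≡m 1 (μ + μ))
      q5 3F = refl
      q5 4F = ℕ.n∸n≡0 k
      q5 5F = refl

-- The diagram at a base vertex, and the antipodal structure from Q-regularity

card≡1⇒unique : ∀ {n} {b : Fin n → Bool} → card b ≡ 1 → ∀ {i j} → b i ≡ true → b j ≡ true → i ≡ j
card≡1⇒unique {b = b} e {i} {j} p q with i Fin.≟ j
... | yes r = r
... | no ¬r = ⊥-elim (true≢false (cong₂ _∧_ q (cong not (==-≢ ¬r))) (card≡0 none j))
  where
  none : card (λ t → b t ∧ not (i == t)) ≡ 0
  none = ℕ.+-cancelˡ-≡ 1 _ _ (trans (cong (λ c → 𝟙 c + card (λ t → b t ∧ not (i == t))) (sym p)) (trans (sym (card-remove b i)) e))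

q-parity : ∀ k i j → 1 ≤ quotient (𝒬 k) i j → even j ≡ not (even i)
q-parity k 0F 0F ()
q-parity k 0F 1F _ = refl
q-parity k 0F 2F ()
q-parity k 0F 3F _ = refl
q-parity k 0F 4F ()
q-parity k 0F 5F _ = refl
q-parity k 1F 0F _ = refl
q-parity k 1F 1F ()
q-parity k 1F 2F _ = refl
q-parity k 1F 3F ()
q-parity k 1F 4F _ = refl
q-parity k 1F 5F ()
q-parity k 2F 0F ()
q-parity k 2F 1F _ = refl
q-parity k 2F 2F ()
q-parity k 2F 3F _ = refl
q-parity k 2F 4F ()
q-parity k 2F 5F _ = refl
q-parity k 3F 0F _ = refl
q-parity k 3F 1F ()
q-parity k 3F 2F _ = refl
q-parity k 3F 3F ()
q-parity k 3F 4F _ = refl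
q-parity k 3F 5F ()
q-parity k 4F 0F ()
q-parity k 4F 1F _ = refl
q-parity k 4F 2F ()
q-parity k 4F 3F _ = refl
q-parity k 4F 4F ()
q-parity k 4F 5F _ = refl
q-parity k 5F 0F _ = refl
q-parity k 5F 1F ()
q-parity k 5F 2F _ = refl
q-parity k 5F 3F ()
q-parity k 5F 4F _ = refl
q-parity k 5F 5F ()

q-from-0 : ∀ k j → 1 ≤ quotient (𝒬 k) 0F j → j ≡ 1F
q-from-0 k 0F ()
q-from-0 k 1F _ = refl
q-from-0 k 2F ()
q-from-0 k 3F ()
q-from-0 k 4F ()
q-from-0 k 5F ()

size-pos : ∀ {k} → 1 ≤ k → ∀ j → 1 ≤ size (𝒬 k) j
size-pos p 0F = s≤s z≤n
size-pos p 1F = p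
size-pos p 2F = ℕ.≤-trans p (ℕ.m≤m+n _ _)
size-pos p 3F = p
size-pos p 4F = s≤s z≤n
size-pos p 5F = s≤s z≤n

-- Common ground of (1) and (3): each of them gives such a cell function at every vertex.
record Based {v : ℕ} (k : ℕ) (Γ : Graph (Fin v)) (x : Fin v) : Set where
  field
    cell  : Fin v → Fin 6
    cells : Cells Γ (𝒬 k) cell
    base  : ∀ z → (cell z == 0F) ≡ (z == x)

  open Cells cells public

  cell-x : cell x ≡ 0F
  cell-x = ==⇒≡ (trans (base x) (==-refl x))

  cell-0 : ∀ {z} → cell z ≡ 0F → z ≡ x
  cell-0 {z} e = ==⇒≡ (trans (sym (base z)) (==-≡ e))

  edge : ∀ {z w} → adj Γ z w ≡ true → 1 ≤ quotient (𝒬 k) (cell z) (cell w)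
  edge {z} {w} e = subst (1 ≤_) (counts z (cell w)) (card-pos w (cong₂ _∧_ e (==-refl (cell w))))

  edge-even : ∀ {z w} → adj Γ z w ≡ true → even (cell w) ≡ not (even (cell z))
  edge-even e = q-parity k _ _ (edge e)

  neighbour : ∀ z j → 1 ≤ quotient (𝒬 k) (cell z) j → ∃[ w ] (adj Γ z w ≡ true × cell w ≡ j)
  neighbour z j p with w , e ← card-exists _ (subst (1 ≤_) (sym (counts z j)) p) =
    w , ∧-trueˡ e , ==⇒≡ (∧-trueʳ {adj Γ z w} e)

  -- Row 0 of the matrix is non-zero only at 1, so neighbours of `x` are in cell 1. Conversely the
  -- entry 1 from cell 1 to cell 0 gives a vertex of cell 1 a neighbour in cell 0, which can only be
  -- `x`.
  adj-cell : ∀ z → adj Γ x z ≡ (cell z == 1F)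
  adj-cell z = bool-ext
    (λ e → ==-≡ (q-from-0 k _ (subst (λ h → 1 ≤ quotient (𝒬 k) h (cell z)) cell-x (edge e))))
    (λ e → let w , z~w , w0 = neighbour z 0F (subst (λ h → 1 ≤ quotient (𝒬 k) h 0F) (sym (==⇒≡ e)) (s≤s z≤n))
           in trans (symm Γ x z) (subst (λ u → adj Γ z u ≡ true) (cell-0 w0) z~w))

  -- Cell 1 is the neighbourhood of `x`, so column 1 counts common neighbours with `x`.
  common-cell : ∀ z → common (adj Γ) x z ≡ quotient (𝒬 k) (cell z) 1F
  common-cell z = trans (common-sym (adj Γ) x z)
    (trans (card-cong λ w → cong (adj Γ z w ∧_) (adj-cell w)) (counts z 1F))

  opposite : ∃[ y ] cell y ≡ 4F
  opposite with y , e ← card-exists _ (subst (1 ≤_) (sym (sizes 4F)) (s≤s z≤n)) = y , ==⇒≡ e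

  opposite-unique : ∀ {y z} → cell y ≡ 4F → cell z ≡ 4F → y ≡ z
  opposite-unique p q = card≡1⇒unique (sizes 4F) (==-≡ p) (==-≡ q)

  card-even-cell : card (even ∘ cell) ≡ 2 + (k + k)
  card-even-cell = trans (sym (card-even (λ _ → true) cell)) (trans (cong₂ _+_ (cong₂ _+_ (sizes 0F) (sizes 4F)) (sizes 2F))
    (cong (λ u → 2 + (k + u)) (ℕ.+-identityʳ k)))

  card-odd-cell : card (not ∘ even ∘ cell) ≡ 2 + (k + k)
  card-odd-cell = trans (sym (card-odd (λ _ → true) cell)) (trans (cong₂ _+_ (cong₂ _+_ (sizes 1F) (sizes 3F)) (sizes 5F))
    (ℕ.+-comm (k + k) 2))

  order : v ≡ 4 * k + 4
  order = begin
    v                                               ≡⟨ sym (card-true {v} λ _ → refl) ⟩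
    card (λ (_ : Fin v) → true)                        ≡⟨ sym (card-+ λ z → 𝟙-not (even (cell z))) ⟩
    card (even ∘ cell) + card (not ∘ even ∘ cell)         ≡⟨ cong₂ _+_ card-even-cell card-odd-cell ⟩
    2 + (k + k) + (2 + (k + k))                     ≡⟨ solve 1 (λ k → con 2 :+ (k :+ k) :+ (con 2 :+ (k :+ k)) := con 4 :* k :+ con 4) refl k ⟩
    4 * k + 4                                       ∎
    where
    open ≡-Reasoning
    open ℕ.+-*-Solver

based : ∀ {v k} {Γ : Graph (Fin v)} → QRegular Γ (𝒬 k) → ∀ x → Based k Γ x
based Q x with B , B₀ , H ← Q x with cell , I , C ← toCells H = record
  { cell = cell ; cells = C
  ; base = λ z → trans (sym (index I 0F z)) (trans (cong (λ S → lookup S z) B₀) (lookup-⁅⁆ x z)) }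

unbased : ∀ {v k} {Γ : Graph (Fin v)} → 1 ≤ k → (∀ x → Based k Γ x) → QRegular Γ (𝒬 k)
unbased {v} {k} {Γ} 1≤k P x = B , subset-ext (λ z → trans (lookup∘tabulate _ z) (trans (base z) (sym (lookup-⁅⁆ x z)))) ,
    fromCells I (size-pos 1≤k) cells
  where
  open Based (P x)
  B : Fin 6 → Subset v
  B j = tabulate λ z → cell z == j
  I : cell IsIndexOf B
  I = mkIndex λ j → lookup∘tabulate _

based-bipartite : ∀ {v k} {Γ : Graph (Fin v)} {x} → Based k Γ x → Bipartite Γ
based-bipartite P = even ∘ Based.cell P , λ y z e s → not-¬ (sym s) (Based.edge-even P (T⇒≡true e))

≢⇒not : ∀ {a b : Bool} → a ≢ b → b ≡ not a
≢⇒not {true}  {true}  ne = contradiction refl ne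
≢⇒not {true}  {false} ne = refl
≢⇒not {false} {true}  ne = refl
≢⇒not {false} {false} ne = contradiction refl ne

module _ {v k : ℕ} (Γ : Graph (Fin v)) (1≤μ : 1 ≤ half k) (x₀ : Fin v) (connected : Connected Γ)
         (regular : ∀ x → card (adj Γ x) ≡ k) where

  -- `τ x` is the single vertex of cell 4 at `x`. The partition at `τ x` is a different one; that it
  -- leads back to `x` follows because having no common neighbours is a symmetric condition.
  antipodal-of-Qregular : BipartiteQRegular k Γ → Antipodal k Γ
  antipodal-of-Qregular ((c , c-proper) , Q) = record
    { colour = c ; proper = proper ; τ = τ
    ; τ-invol = λ x → sym (common-0 (colour-τ x) (τ-≢ x ∘ sym) (trans (common-sym (adj Γ) (τ x) x) (common-τ x)))
    ; τ-≢ = τ-≢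
    ; τ-colour = colour-τ
    ; regular = regular
    ; common-τ = common-τ
    ; common-μ = λ {x} {y} → common-μ x y
    ; classSize = classSize
    }
    where
    P : ∀ x → Based k Γ x
    P = based Q
    module B x = Based (P x)
    proper : ∀ {x y} → adj Γ x y ≡ true → c y ≡ not (c x)
    proper {x} {y} e = ≢⇒not (c-proper x y (≡true⇒T e))
    -- Colour and cell parity both change along every edge. By connectedness the given colouring
    -- therefore agrees with the parity seen from any base, relative to the colour of that base.
    colour-even : ∀ {ℓ x z} → Walk Γ ℓ z x → same (c x) (c z) ≡ even (B.cell x z)
    colour-even {x = x} [] = trans (same-≡ {c x} refl) (cong even (sym (B.cell-x x)))
    colour-even {x = x} (_∷_ {y = w} e W) = trans (cong (same (c x)) (proper (trans (symm Γ w _) (T⇒≡true e))))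
      (trans (same-notʳ (c x) (c w)) (trans (cong not (colour-even W))
        (sym (B.edge-even x (trans (symm Γ w _) (T⇒≡true e))))))
    c-even : ∀ x z → same (c x) (c z) ≡ even (B.cell x z)
    c-even x z = colour-even (proj₂ (connected z x))
    τ : Fin v → Fin v
    τ x = proj₁ (B.opposite x)
    cell-τ : ∀ x → B.cell x (τ x) ≡ 4F
    cell-τ x = proj₂ (B.opposite x)
    τ-≢ : ∀ x → τ x ≢ x
    τ-≢ x e = contradiction (trans (sym (B.cell-x x)) (subst (λ u → B.cell x u ≡ 4F) e (cell-τ x))) λ ()
    colour-τ : ∀ x → c (τ x) ≡ c x
    colour-τ x = sym (same⇒≡ (trans (c-even x (τ x)) (cong even (cell-τ x))))
    common-τ : ∀ x → common (adj Γ) x (τ x) ≡ 0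
    common-τ x = trans (B.common-cell x (τ x)) (cong (λ h → quotient (𝒬 k) h 1F) (cell-τ x))
    even-cell : ∀ x y → c x ≡ c y → x ≢ y → B.cell x y ≡ 2F ⊎ B.cell x y ≡ 4F
    even-cell x y s ne with B.cell x y in e | trans (sym (c-even x y)) (same-≡ s)
    ... | 0F | _ = contradiction (sym (B.cell-0 x e)) ne
    ... | 2F | _ = inj₁ refl
    ... | 4F | _ = inj₂ refl
    ... | 5F | ()
    -- Among the distinct vertices of the same colour, those in cell 2 have μ > 0 common neighbours
    -- with `x`; only cell 4 is left.
    common-0 : ∀ {x y} → c x ≡ c y → y ≢ x → common (adj Γ) x y ≡ 0 → y ≡ τ x
    common-0 {x} {y} s ne z with even-cell x y s (ne ∘ sym)
    ... | inj₂ e = B.opposite-unique x e (cell-τ x)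
    ... | inj₁ e = contradiction (subst (1 ≤_) (trans (sym (trans (B.common-cell x y) (cong (λ h → quotient (𝒬 k) h 1F) e))) z) 1≤μ) λ ()
    common-μ : ∀ x y → c x ≡ c y → x ≢ y → τ x ≢ y → common (adj Γ) x y ≡ half k
    common-μ x y s ne ne′ with even-cell x y s ne
    ... | inj₁ e = trans (B.common-cell x y) (cong (λ h → quotient (𝒬 k) h 1F) e)
    ... | inj₂ e = contradiction (B.opposite-unique x (cell-τ x) e) ne′
    classSize : ∀ b → card (λ z → same b (c z)) ≡ 2 + (k + k)
    classSize b with same (c x₀) b in e
    ... | true  = trans (card-cong λ z → trans (cong (λ d → same d (c z)) (sym (same⇒≡ {c x₀} e))) (c-even x₀ z)) (B.card-even-cell x₀)
    ... | false = trans (card-cong λ z → trans (cong (λ d → same d (c z)) (same-false {c x₀} e)) (trans (same-notˡ (c x₀) (c z)) (cong not (c-even x₀ z)))) (B.card-odd-cell x₀)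

module _ {v k : ℕ} {Γ : Graph (Fin v)} where

  -- The diagram at `f x` is pulled back along the isomorphism `f`. Cell 0 becomes the singleton of
  -- `x` because `σ` fixes 0 and `F₀` is the identity matrix.
  based-of-scheme : IsRelationGraphWithDiagram k Γ → ∀ x → Based k Γ x
  based-of-scheme (m , S , i , (f , f-adj) , σ , σ₀ , H) x with cell , I , C ← toCells (H (Inverse.to f x)) = record
    { cell  = cell ∘ to
    ; cells = record
      { sizes  = λ j → trans (card-permute f (λ z → cell z == j)) (Cells.sizes C j)
      ; counts = λ z j → trans (card-cong λ w → cong (_∧ (cell (to w) == j)) (f-adj z w))
                   (trans (card-permute f (λ w → R (suc i) (to z) w ∧ (cell w == j))) (Cells.counts C (to z) j))
      }
    ; base = λ z → begin
        cell (to z) == 0F                          ≡⟨ sym (index I 0F (to z)) ⟩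
        lookup (relationCell S (to x) (σ ⟨$⟩ʳ zero)) (to z) ≡⟨ cong (λ j → lookup (relationCell S (to x) j) (to z)) σ₀ ⟩
        lookup (relationCell S (to x) zero) (to z) ≡⟨ lookup∘tabulate _ (to z) ⟩
        R zero (to x) (to z)                       ≡⟨ ⟦⟧-injective _ _ (F₀≃I (to x) (to z)) ⟩
        _                                          ≡⟨ sym (==-does (to x) (to z)) ⟩
        to x == to z                               ≡⟨ bool-ext (λ e → ==-≡ (sym (to-injective f (==⇒≡ e)))) (λ e → ==-≡ (cong to (sym (==⇒≡ e)))) ⟩
        z == x                                     ∎
    }
    where
    open ≡-Reasoning
    open SymmetricScheme S
    open Inverse f using (to)

-- Walk counts and 2-walk-regularity

Σ-suc : ∀ {n} {A : Fin (suc n) → Set} → Σ (Fin (suc n)) A ↔ (A zero ⊎ Σ (Fin n) (A ∘ suc))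
Σ-suc {A = A} = mk↔ₛ′
  (λ { (zero , a) → inj₁ a ; (suc i , a) → inj₂ (i , a) })
  (λ { (inj₁ a) → zero , a ; (inj₂ (i , a)) → suc i , a })
  (λ { (inj₁ a) → refl ; (inj₂ (i , a)) → refl })
  (λ { (zero , a) → refl ; (suc i , a) → refl })

Σ-card : ∀ {n} {A : Fin n → Set} (f : Fin n → ℕ) → (∀ i → A i ↔ Fin (f i)) → Σ (Fin n) A ↔ Fin (∑ f)
Σ-card {zero}  f e = cast-id (sym (∑-0 {f = f} λ ())) ↔-∘ mk↔ₛ′ (λ ()) (λ ()) (λ ()) (λ ())
Σ-card {suc n} f e = cast-id (sym (∑-suc f)) ↔-∘
  (↔-sym Fin.+↔⊎ ↔-∘ ((e zero ⊎-↔ Σ-card (f ∘ suc) (e ∘ suc)) ↔-∘ Σ-suc))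

T-card : ∀ {A : Set} {n} b → A ↔ Fin n → (T b × A) ↔ Fin (𝟙 b * n)
T-card {n = n} true e = cast-id (sym (ℕ.+-identityʳ n)) ↔-∘ (e ↔-∘ mk↔ₛ′ proj₂ (_ ,_) (λ _ → refl) (λ _ → refl))
T-card false e = mk↔ₛ′ (λ ()) (λ ()) (λ ()) (λ ())

Walk-suc : ∀ {V : Set} {Γ : Graph V} {ℓ x z} →
           Walk Γ (suc ℓ) x z ↔ (Σ[ y ∈ V ] (T (adj Γ x y) × Walk Γ ℓ y z))
Walk-suc = mk↔ₛ′ (λ { (e ∷ w) → _ , e , w }) (λ { (_ , e , w) → e ∷ w }) (λ _ → refl) (λ { (e ∷ w) → refl })

-- Entry `(j, 0)` of the `ℓ`-th power of the quotient matrix.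
walks : ∀ {n} → Diagram (suc n) → ℕ → Fin (suc n) → ℕ
walks D zero    j = 𝟙 (j == zero)
walks D (suc ℓ) j = ∑ (λ h → quotient D j h * walks D ℓ h)

module _ {v k : ℕ} {Γ : Graph (Fin v)} where

  -- The base is the end of the walk, so prepending a step leaves it unchanged and one diagram
  -- serves the whole induction. Sorting the first steps by the cell they reach gives a row of the
  -- quotient matrix.
  walk-count : ∀ {x} (P : Based k Γ x) ℓ z → Walk Γ ℓ z x ↔ Fin (walks (𝒬 k) ℓ (Based.cell P z))
  walk-count {x} P zero z with z Fin.≟ x
  ... | yes refl = cast-id (sym (cong 𝟙 (trans (Based.base P z) (==-refl z)))) ↔-∘
        mk↔ₛ′ (λ _ → zero) (λ _ → []) (λ { zero → refl }) (λ { [] → refl })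
  ... | no z≢x = cast-id (sym (cong 𝟙 (trans (Based.base P z) (==-≢ z≢x)))) ↔-∘
        mk↔ₛ′ (λ { [] → contradiction refl z≢x }) (λ ()) (λ ()) (λ { [] → contradiction refl z≢x })
  walk-count P (suc ℓ) z = cast-id count ↔-∘
      (Σ-card _ (λ y → T-card (adj Γ z y) (walk-count P ℓ y)) ↔-∘ Walk-suc)
    where
    open Based P
    count : ∑ (λ y → 𝟙 (adj Γ z y) * walks (𝒬 k) ℓ (cell y)) ≡ walks (𝒬 k) (suc ℓ) (cell z)
    count = trans (∑-fibres (adj Γ z) cell (walks (𝒬 k) ℓ))
      (∑-cong λ h → cong (_* walks (𝒬 k) ℓ h) (counts z h))

  distance-0-cell : ∀ {x y} (P : Based k Γ y) → Distance Γ x y 0 → Based.cell P x ≡ 0F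
  distance-0-cell P ([] , _) = Based.cell-x P

  distance-1-cell : ∀ {x y} (P : Based k Γ y) → Distance Γ x y 1 → Based.cell P x ≡ 1F
  distance-1-cell P (e ∷ [] , _) = ==⇒≡ (trans (sym (Based.adj-cell P _)) (trans (symm Γ _ _) (T⇒≡true e)))

  q-to-1 : ∀ i → 1 ≤ quotient (𝒬 k) i 1F → i ≡ 0F ⊎ i ≡ 2F
  q-to-1 0F _ = inj₁ refl
  q-to-1 1F ()
  q-to-1 2F _ = inj₂ refl
  q-to-1 3F ()
  q-to-1 4F ()
  q-to-1 5F ()

  -- The middle vertex is a neighbour of `y`, hence in cell 1, and only cells 0 and 2 have edges to
  -- cell 1. Cell 0 would mean `x ≡ y`, contradicting distance 2.
  distance-2-cell : ∀ {x y} (P : Based k Γ y) → Distance Γ x y 2 → Based.cell P x ≡ 2F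
  distance-2-cell {x} {y} P (_∷_ {y = u} e (e′ ∷ []) , shortest)
    with q-to-1 (Based.cell P x) (subst (λ h → 1 ≤ quotient (𝒬 k) (Based.cell P x) h)
           (==⇒≡ (trans (sym (Based.adj-cell P u)) (trans (symm Γ y u) (T⇒≡true e′)))) (Based.edge P (T⇒≡true e)))
  ... | inj₂ p = p
  ... | inj₁ p = contradiction (subst (Walk Γ 0 x) (Based.cell-0 P p) []) (shortest 0 (s≤s z≤n))

  walk-regular : Connected Γ → (∀ x → Based k Γ x) → WalkRegular 2 Γ
  walk-regular conn P = conn , a , λ where
      ℓ x y 0 _ d → counted ℓ x y (distance-0-cell (P y) d)
      ℓ x y 1 _ d → counted ℓ x y (distance-1-cell (P y) d)
      ℓ x y 2 _ d → counted ℓ x y (distance-2-cell (P y) d)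
      ℓ x y (suc (suc (suc _))) (s≤s (s≤s ())) _
    where
    a : ℕ → ℕ → ℕ
    a ℓ 0 = walks (𝒬 k) ℓ 0F
    a ℓ 1 = walks (𝒬 k) ℓ 1F
    -- This clause also fixes a value for `i > 2`, where nothing is claimed.
    a ℓ _ = walks (𝒬 k) ℓ 2F
    counted : ∀ ℓ x y {j} → Based.cell (P y) x ≡ j → Walk Γ ℓ x y ↔ Fin (walks (𝒬 k) ℓ j)
    counted ℓ x y e = cast-id (cong (walks (𝒬 k) ℓ) e) ↔-∘ walk-count (P y) ℓ x

-- Listing the colour classes and the orbits of τ

isLeft : {A B : Set} → A ⊎ B → Bool
isLeft (inj₁ _) = true
isLeft (inj₂ _) = false

left : {A B : Set} (s : A ⊎ B) → isLeft s ≡ true → Σ[ a ∈ A ] inj₁ a ≡ s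
left (inj₁ a) _ = a , refl

private
  module Enumerate {n p q : ℕ} (f : Fin n ↔ (Fin p ⊎ Fin q)) where
    open Inverse f

    cons₁ : Fin (suc n) ↔ (Fin (suc p) ⊎ Fin q)
    cons₁ = mk↔ₛ′ t g
        (λ { (inj₁ zero) → refl ; (inj₁ (suc i)) → cong (map₁ suc) (strictlyInverseˡ (inj₁ i))
           ; (inj₂ j) → cong (map₁ suc) (strictlyInverseˡ (inj₂ j)) })
        (λ { zero → refl ; (suc i) → trans (lem (to i)) (cong suc (strictlyInverseʳ i)) })
      where
      t : Fin (suc n) → Fin (suc p) ⊎ Fin q
      t zero    = inj₁ zero
      t (suc i) = map₁ suc (to i)
      g : Fin (suc p) ⊎ Fin q → Fin (suc n)
      g (inj₁ zero)    = zero
      g (inj₁ (suc i)) = suc (from (inj₁ i))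
      g (inj₂ j)       = suc (from (inj₂ j))
      lem : ∀ s → g (map₁ suc s) ≡ suc (from s)
      lem (inj₁ _) = refl
      lem (inj₂ _) = refl

    cons₂ : Fin (suc n) ↔ (Fin p ⊎ Fin (suc q))
    cons₂ = mk↔ₛ′ t g
        (λ { (inj₂ zero) → refl ; (inj₂ (suc i)) → cong (map₂ suc) (strictlyInverseˡ (inj₂ i))
           ; (inj₁ j) → cong (map₂ suc) (strictlyInverseˡ (inj₁ j)) })
        (λ { zero → refl ; (suc i) → trans (lem (to i)) (cong suc (strictlyInverseʳ i)) })
      where
      t : Fin (suc n) → Fin p ⊎ Fin (suc q)
      t zero    = inj₂ zero
      t (suc i) = map₂ suc (to i)
      g : Fin p ⊎ Fin (suc q) → Fin (suc n)
      g (inj₂ zero)    = zero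
      g (inj₂ (suc i)) = suc (from (inj₂ i))
      g (inj₁ j)       = suc (from (inj₁ j))
      lem : ∀ s → g (map₂ suc s) ≡ suc (from s)
      lem (inj₁ _) = refl
      lem (inj₂ _) = refl

isLeft-map₁ : {A B C : Set} {f : A → C} (s : A ⊎ B) → isLeft (map₁ f s) ≡ isLeft s
isLeft-map₁ (inj₁ _) = refl
isLeft-map₁ (inj₂ _) = refl

isLeft-map₂ : {A B C : Set} {f : B → C} (s : A ⊎ B) → isLeft (map₂ f s) ≡ isLeft s
isLeft-map₂ (inj₁ _) = refl
isLeft-map₂ (inj₂ _) = refl

-- A design has points `Fin p` and blocks `Fin q`, so the colour classes have to be listed; the same
-- device lists the orbit representatives. The sizes are left open here and recovered by counting,
-- through `card-isLeft`.
enumerate : ∀ {n} (b : Fin n → Bool) →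
  ∃[ p ] ∃[ q ] Σ[ f ∈ (Fin n ↔ (Fin p ⊎ Fin q)) ] (∀ x → b x ≡ isLeft (Inverse.to f x))
enumerate {zero} b = 0 , 0 , mk↔ₛ′ (λ ()) (λ { (inj₁ ()) ; (inj₂ ()) }) (λ { (inj₁ ()) ; (inj₂ ()) }) (λ ()) , λ ()
enumerate {suc n} b with enumerate (b ∘ suc) | b zero in eq
... | p , q , f , h | true  = suc p , q , Enumerate.cons₁ f ,
      λ { zero → eq ; (suc i) → trans (h i) (sym (isLeft-map₁ (Inverse.to f i))) }
... | p , q , f , h | false = p , suc q , Enumerate.cons₂ f ,
      λ { zero → eq ; (suc i) → trans (h i) (sym (isLeft-map₂ (Inverse.to f i))) }

card-isLeft : ∀ {n p q} (f : Fin n ↔ (Fin p ⊎ Fin q)) → card (isLeft ∘ Inverse.to f) ≡ p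
card-isLeft {p = p} f = trans (card-split f isLeft)
  (trans (cong₂ _+_ (card-true λ _ → refl) (card-false λ _ → refl)) (ℕ.+-identityʳ p))

double-injective : ∀ m n → m + m ≡ n + n → m ≡ n
double-injective m n e = trans (ℕ.n≡⌊n+n/2⌋ m) (trans (cong ⌊_/2⌋ e) (sym (ℕ.n≡⌊n+n/2⌋ n)))

-- The smaller element of each orbit of τ represents the orbit.
module _ {p m : ℕ} (τ : Fin p → Fin p) (τ-invol : ∀ x → τ (τ x) ≡ x) (τ-≢ : ∀ x → τ x ≢ x)
         (p≡ : p ≡ m + m) where

  orbits : Σ[ g ∈ (Fin p → Fin m) ] (∀ x y → g x ≡ g y → x ≡ y ⊎ τ x ≡ y) × (∀ x → g (τ x) ≡ g x) × (∀ i → ∃[ x ] g x ≡ i)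
  orbits with enumerate (λ x → does (x Fin.<? τ x))
  ... | m′ , q , f , h = subst (λ m → Σ[ g ∈ (Fin p → Fin m) ] (∀ x y → g x ≡ g y → x ≡ y ⊎ τ x ≡ y)
                                × (∀ x → g (τ x) ≡ g x) × (∀ i → ∃[ x ] g x ≡ i)) m′≡m
      (g , (λ x y e → rep-inj x y (to-injective f (trans (sym (inj-g x)) (trans (cong inj₁ e) (inj-g y)))))
         , (λ x → inj₁-injective (trans (inj-g (τ x)) (trans (cong to (rep-τ x)) (sym (inj-g x)))))
         , (λ i → from (inj₁ i) , inj₁-injective (trans (inj-g _) (trans (cong to (rep-fix _ (trans (h _) (cong isLeft (strictlyInverseˡ (inj₁ i))))))
              (strictlyInverseˡ (inj₁ i))))))
    where
    open Inverse f
    r : Fin p → Bool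
    r x = does (x Fin.<? τ x)
    r-τ : ∀ x → r (τ x) ≡ not (r x)
    r-τ x with x Fin.<? τ x
    ... | yes l = trans (dec-false (τ x Fin.<? τ (τ x)) λ l′ → Fin.<-asym l (subst (τ x Fin.<_) (τ-invol x) l′))
          (cong not (sym (dec-true (x Fin.<? τ x) l)))
    ... | no ¬l = trans (dec-true (τ x Fin.<? τ (τ x)) (subst (τ x Fin.<_) (sym (τ-invol x)) (Fin.≤∧≢⇒< (ℕ.≮⇒≥ ¬l) (τ-≢ x))))
          (cong not (sym (dec-false (x Fin.<? τ x) ¬l)))
    τ↔ : Fin p ↔ Fin p
    τ↔ = mk↔ₛ′ τ τ τ-invol τ-invol
    -- `τ` exchanges the representatives with the remaining elements, so twice their number is `p`.
    m′≡m : m′ ≡ m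
    m′≡m = double-injective m′ m (begin
      m′ + m′                ≡⟨ cong₂ _+_ (sym cardr) (sym cardr) ⟩
      card r + card r              ≡⟨ cong (card r +_) (trans (sym (card-permute τ↔ r)) (card-cong r-τ)) ⟩
      card r + card (not ∘ r)      ≡⟨ card-+ {c = λ _ → true} (λ x → 𝟙-not (r x)) ⟩
      card {p} (λ _ → true)     ≡⟨ card-true (λ _ → refl) ⟩
      p                      ≡⟨ p≡ ⟩
      m + m                  ∎)
      where
      open ≡-Reasoning
      cardr : card r ≡ m′
      cardr = trans (card-cong h) (card-isLeft f)
    rep : Fin p → Fin p
    rep x = if r x then x else τ x
    rep-fix : ∀ x → r x ≡ true → rep x ≡ x
    rep-fix x e rewrite e = refl
    rep-true : ∀ x → isLeft (to (rep x)) ≡ true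
    rep-true x = trans (sym (h (rep x))) lem
      where
      lem : r (rep x) ≡ true
      lem with r x in e
      ... | true  = e
      ... | false = trans (r-τ x) (cong not e)
    rep-τ : ∀ x → rep (τ x) ≡ rep x
    rep-τ x rewrite r-τ x with r x
    ... | true  = τ-invol x
    ... | false = refl
    rep-inj : ∀ x y → rep x ≡ rep y → x ≡ y ⊎ τ x ≡ y
    rep-inj x y e with r x | r y
    ... | true  | true  = inj₁ e
    ... | true  | false = inj₂ (trans (cong τ e) (τ-invol y))
    ... | false | true  = inj₂ e
    ... | false | false = inj₁ (trans (sym (τ-invol x)) (trans (cong τ e) (τ-invol y)))
    g : Fin p → Fin m′
    g x = proj₁ (left (to (rep x)) (rep-true x))
    inj-g : ∀ x → inj₁ (g x) ≡ to (rep x)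
    inj-g x = proj₂ (left (to (rep x)) (rep-true x))

-- Group divisible designs with the dual property

-- One half of a GDDDP with groups of size 2, the groups being the orbits of τ.
record Pairing (k : ℕ) {p b : ℕ} (inc : Fin p → Fin b → Bool) : Set where
  field
    τ        : Fin p → Fin p
    τ-invol  : ∀ x → τ (τ x) ≡ x
    τ-≢      : ∀ x → τ x ≢ x
    common-τ : ∀ x → common inc x (τ x) ≡ 0
    common-μ : ∀ {x y} → x ≢ y → τ x ≢ y → common inc x y ≡ half k
    order    : p ≡ 2 + (k + k)

module _ {k p b : ℕ} {blocks : Fin b → Subset p} {inc : Fin p → Fin b → Bool}
         (eq : ∀ x j → lookup (blocks j) x ≡ inc x j) where

  common-dual : ∀ x y → ∣ dual blocks x ∩ dual blocks y ∣ ≡ common inc x y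
  common-dual x y = trans (∣tabulate∩∣ (λ j → lookup (blocks j) x) (dual blocks y))
    (card-cong λ j → cong₂ _∧_ (eq x j) (trans (lookup∘tabulate _ j) (eq y j)))

  pairing-of-GDD : GDD 2 (k + 1) k 0 (half k) blocks → Pairing k inc
  pairing-of-GDD D with g , I ← indexOf (GDD.isPartition D) = record
    { τ = τ
    ; τ-invol = λ x → sym (unique (sym (g-τ x)) (τ-≢ x ∘ sym))
    ; τ-≢ = τ-≢
    ; common-τ = λ x → trans (sym (common-dual x (τ x)))
        (sameGroup x (τ x) (g x) (τ-≢ x ∘ sym) (index⇒∈ I refl) (index⇒∈ I (g-τ x)))
    ; common-μ = λ {x} {y} ne ne′ → trans (sym (common-dual x y))
        (diffGroup x y (g x) (g y) (λ e → ne′ (sym (unique (sym e) (ne ∘ sym)))) (index⇒∈ I refl) (index⇒∈ I refl))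
    ; order = begin
        p                       ≡⟨ card-total g ⟩
        ∑ (fibre g)             ≡⟨ ∑-cong size2 ⟩
        ∑ {k + 1} (λ _ → 2)     ≡⟨ ∑-const (k + 1) 2 ⟩
        (k + 1) * 2             ≡⟨ solve 1 (λ k → (k :+ con 1) :* con 2 := con 2 :+ (k :+ k)) refl k ⟩
        2 + (k + k)             ∎
    }
    where
    open GDD D
    open ≡-Reasoning
    open ℕ.+-*-Solver
    size2 : ∀ i → fibre g i ≡ 2
    size2 i = trans (sym (size-fibre I i)) (groupSize i)
    others : Fin p → Fin p → Bool
    others x z = (g z == g x) ∧ not (x == z)
    cardothers : ∀ x → card (others x) ≡ 1
    cardothers x = ℕ.+-cancelˡ-≡ 1 _ _ (trans (cong (λ c → 𝟙 c + card (others x)) (sym (==-refl (g x))))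
      (trans (sym (card-remove (λ z → g z == g x) x)) (size2 (g x))))
    other : ∀ x → ∃[ y ] others x y ≡ true
    other x = card-exists _ (ℕ.≤-reflexive (sym (cardothers x)))
    τ : Fin p → Fin p
    τ x = proj₁ (other x)
    g-τ : ∀ x → g (τ x) ≡ g x
    g-τ x = ==⇒≡ (∧-trueˡ (proj₂ (other x)))
    τ-≢ : ∀ x → τ x ≢ x
    τ-≢ x e = true≢false (∧-trueʳ {g (τ x) == g x} (proj₂ (other x))) (cong not (==-≡ (sym e)))
    unique : ∀ {x y} → g y ≡ g x → y ≢ x → y ≡ τ x
    unique {x} {y} e ne = card≡1⇒unique (cardothers x) (cong₂ _∧_ (==-≡ e) (cong not (==-≢ (ne ∘ sym)))) (proj₂ (other x))

  GDD-of-pairing : Pairing k inc → (∀ j → card (λ x → inc x j) ≡ k) → GDD 2 (k + 1) k 0 (half k) blocks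
  GDD-of-pairing P blockSize with orbits {m = k + 1} (Pairing.τ P) (Pairing.τ-invol P) (Pairing.τ-≢ P)
    (trans (Pairing.order P) (solve 1 (λ k → con 2 :+ (k :+ k) := (k :+ con 1) :+ (k :+ con 1)) refl k))
    where
    open ℕ.+-*-Solver
  ... | g , g-inj , g-τ , g-surj = record
    { groups = groups
    ; isPartition = isPartition I λ i → subst (1 ≤_) (sym (size2 i)) (s≤s z≤n)
    ; groupSize = λ i → trans (size-fibre I i) (size2 i)
    ; blockSize = λ j → trans (∣∣≡card (blocks j)) (trans (card-cong λ x → eq x j) (blockSize j))
    ; sameGroup = λ x y i ne x∈ y∈ → trans (common-dual x y)
        (same-group (g-inj x y (trans (∈⇒index I x∈) (sym (∈⇒index I y∈)))) ne)
    ; diffGroup = λ x y i j ne x∈ y∈ → trans (common-dual x y) (common-μ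
        (λ e → ne (trans (sym (∈⇒index I x∈)) (trans (cong g e) (∈⇒index I y∈))))
        (λ e → ne (trans (sym (∈⇒index I x∈)) (trans (sym (g-τ x)) (trans (cong g e) (∈⇒index I y∈))))))
    }
    where
    open Pairing P
    groups : Fin (k + 1) → Subset p
    groups i = tabulate λ z → g z == i
    I : g IsIndexOf groups
    I = mkIndex λ i → lookup∘tabulate _
    same-group : ∀ {x y} → x ≡ y ⊎ τ x ≡ y → x ≢ y → common inc x y ≡ 0
    same-group (inj₁ e) ne = contradiction e ne
    same-group {x} (inj₂ refl) ne = common-τ x
    size2 : ∀ i → fibre g i ≡ 2
    size2 i with x , refl ← g-surj i = trans (sym (card-+ pair)) (cong₂ _+_ (card-single x) (card-single (τ x)))
      where
      pair : ∀ z → 𝟙 (x == z) + 𝟙 (τ x == z) ≡ 𝟙 (g z == g x)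
      pair z with g z == g x in e
      pair z | true with g-inj x z (sym (==⇒≡ e))
      ... | inj₁ refl rewrite ==-refl x | ==-≢ (τ-≢ x) = refl
      ... | inj₂ refl rewrite ==-refl (τ x) | ==-≢ (τ-≢ x ∘ sym) = refl
      pair z | false rewrite ==-≢ {i = x} {z} (λ { refl → true≢false (==-refl (g x)) e })
                           | ==-≢ {i = τ x} {z} (λ { refl → true≢false (==-≡ (g-τ x)) e }) = refl

module _ {v k : ℕ} (Γ : Graph (Fin v)) (regular : ∀ x → card (adj Γ x) ≡ k) where

  -- The groups of points and the groups of blocks each give an involution on one half of the vertex
  -- set; `τ` is their disjoint union, transported along `f`. Two vertices on one side have all
  -- their common neighbours on the other, where the design conditions apply.
  antipodal-of-GDDDP : IsIncidenceGraphOfGDDDP k Γ → Antipodal k Γ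
  antipodal-of-GDDDP (p , q , blocks , (D₁ , D₂) , f , f-adj) = record
    { colour    = isLeft ∘ to
    ; proper    = λ {x} {y} e → properW (to x) (to y) (trans (sym (f-adj x y)) e)
    ; τ         = from ∘ τW ∘ to
    ; τ-invol   = λ x → trans (cong (from ∘ τW) (to-τ x)) (trans (cong from (τW-invol (to x))) (strictlyInverseʳ x))
    ; τ-≢       = λ x e → τW-≢ (to x) (trans (sym (to-τ x)) (cong to e))
    ; τ-colour  = λ x → trans (cong isLeft (to-τ x)) (isLeft-τW (to x))
    ; regular   = regular
    ; common-τ  = λ x → trans (common-W x _) (trans (cong (commonW (to x)) (to-τ x)) (commonW-τ (to x)))
    ; common-μ  = λ {x} {y} s ne ne′ → trans (common-W x y) (commonW-μ (to x) (to y) s (ne ∘ to-injective f)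
                    (λ e → ne′ (trans (cong from e) (strictlyInverseʳ y))))
    ; classSize = classSize
    }
    where
    open Inverse f
    W = Fin p ⊎ Fin q
    inc : Fin p → Fin q → Bool
    inc i j = lookup (blocks j) i
    P₁ : Pairing k inc
    P₁ = pairing-of-GDD (λ _ _ → refl) D₁
    P₂ : Pairing k (λ j i → inc i j)
    P₂ = pairing-of-GDD (λ j i → lookup∘tabulate _ j) D₂
    module P₁ = Pairing P₁
    module P₂ = Pairing P₂
    aW : W → W → Bool
    aW = adj (incidenceGraph blocks)
    τW : W → W
    τW (inj₁ i) = inj₁ (P₁.τ i)
    τW (inj₂ j) = inj₂ (P₂.τ j)
    τW-invol : ∀ w → τW (τW w) ≡ w
    τW-invol (inj₁ i) = cong inj₁ (P₁.τ-invol i)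
    τW-invol (inj₂ j) = cong inj₂ (P₂.τ-invol j)
    τW-≢ : ∀ w → τW w ≢ w
    τW-≢ (inj₁ i) e = P₁.τ-≢ i (inj₁-injective e)
    τW-≢ (inj₂ j) e = P₂.τ-≢ j (inj₂-injective e)
    isLeft-τW : ∀ w → isLeft (τW w) ≡ isLeft w
    isLeft-τW (inj₁ _) = refl
    isLeft-τW (inj₂ _) = refl
    to-τ : ∀ x → to (from (τW (to x))) ≡ τW (to x)
    to-τ x = strictlyInverseˡ _
    properW : ∀ w w′ → aW w w′ ≡ true → isLeft w′ ≡ not (isLeft w)
    properW (inj₁ _) (inj₂ _) _ = refl
    properW (inj₂ _) (inj₁ _) _ = refl
    commonW : W → W → ℕ
    commonW w w′ = card (λ i → aW w (inj₁ i) ∧ aW w′ (inj₁ i)) + card (λ j → aW w (inj₂ j) ∧ aW w′ (inj₂ j))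
    common-W : ∀ x y → common (adj Γ) x y ≡ commonW (to x) (to y)
    common-W x y = trans (card-cong λ z → cong₂ _∧_ (f-adj x z) (f-adj y z))
      (card-split f (λ w → aW (to x) w ∧ aW (to y) w))
    commonW-₁ : ∀ i i′ → commonW (inj₁ i) (inj₁ i′) ≡ common inc i i′
    commonW-₁ i i′ = cong (_+ common inc i i′) (card-false {p} λ _ → refl)
    commonW-₂ : ∀ j j′ → commonW (inj₂ j) (inj₂ j′) ≡ common (λ j i → inc i j) j j′
    commonW-₂ j j′ = trans (cong (common (λ j i → inc i j) j j′ +_) (card-false {q} λ _ → refl)) (ℕ.+-identityʳ _)
    commonW-τ : ∀ w → commonW w (τW w) ≡ 0
    commonW-τ (inj₁ i) = trans (commonW-₁ i _) (P₁.common-τ i)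
    commonW-τ (inj₂ j) = trans (commonW-₂ j _) (P₂.common-τ j)
    commonW-μ : ∀ w w′ → isLeft w ≡ isLeft w′ → w ≢ w′ → τW w ≢ w′ → commonW w w′ ≡ half k
    commonW-μ (inj₁ i) (inj₁ i′) _ ne ne′ = trans (commonW-₁ i i′) (P₁.common-μ (ne ∘ cong inj₁) (ne′ ∘ cong inj₁))
    commonW-μ (inj₂ j) (inj₂ j′) _ ne ne′ = trans (commonW-₂ j j′) (P₂.common-μ (ne ∘ cong inj₂) (ne′ ∘ cong inj₂))
    classSize : ∀ b → card (λ z → same b (isLeft (to z))) ≡ 2 + (k + k)
    classSize true  = trans (card-isLeft f) P₁.order
    classSize false = trans (card-split f (not ∘ isLeft)) (cong₂ _+_ (card-false {p} λ _ → refl) (trans (card-true {q} λ _ → refl) P₂.order))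

module _ {v k : ℕ} {Γ : Graph (Fin v)} where

  -- Exchanging the colours turns blocks into points, so everything shown for one class serves for
  -- the dual design as well.
  recolour : Antipodal k Γ → Antipodal k Γ
  recolour 𝒜 = record
    { colour    = not ∘ colour
    ; proper    = cong not ∘ proper
    ; τ         = τ
    ; τ-invol   = τ-invol
    ; τ-≢       = τ-≢
    ; τ-colour  = cong not ∘ τ-colour
    ; regular   = regular
    ; common-τ  = common-τ
    ; common-μ  = common-μ ∘ not-injective
    ; classSize = λ b → trans (card-cong λ z → trans (same-notʳ b (colour z)) (sym (same-notˡ b (colour z)))) (classSize (not b))
    }
    where
    open Antipodal 𝒜

  module _ (𝒜 : Antipodal k Γ) {p q : ℕ} (f : Fin v ↔ (Fin p ⊎ Fin q))
           (f-colour : ∀ x → Antipodal.colour 𝒜 x ≡ isLeft (Inverse.to f x)) where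
    open Antipodal 𝒜
    open Inverse f

    incidence : Fin p → Fin q → Bool
    incidence i j = adj Γ (from (inj₁ i)) (from (inj₂ j))

    colour-from : ∀ w → colour (from w) ≡ isLeft w
    colour-from w = trans (f-colour (from w)) (cong isLeft (strictlyInverseˡ w))

    adj-left : ∀ i i′ → adj Γ (from (inj₁ i)) (from (inj₁ i′)) ≡ false
    adj-left i i′ = ≢true⇒≡false λ t → contradiction
      (trans (sym (colour-from (inj₁ i′))) (trans (proper t) (cong not (colour-from (inj₁ i))))) λ ()

    card-incidence : ∀ i (b : Fin v → Bool) →
      card (λ z → adj Γ (from (inj₁ i)) z ∧ b z) ≡ card (λ j → incidence i j ∧ b (from (inj₂ j)))
    card-incidence i b = trans (card-cong λ z → cong (λ u → adj Γ (from (inj₁ i)) u ∧ b u) (sym (strictlyInverseʳ z)))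
      (trans (card-split f (λ w → adj Γ (from (inj₁ i)) (from w) ∧ b (from w)))
        (cong (_+ card (λ j → incidence i j ∧ b (from (inj₂ j)))) (card-false λ i′ → cong (_∧ b (from (inj₁ i′))) (adj-left i i′))))

    incidence-size : ∀ i → card (incidence i) ≡ k
    incidence-size i = trans (card-cong λ j → ∧-comm true _) (trans (sym (card-incidence i (λ _ → true)))
      (trans (card-cong λ z → ∧-comm _ true) (regular (from (inj₁ i)))))

    pairing : Pairing k incidence
    pairing = record
      { τ        = τ₁
      ; τ-invol  = λ i → inj₁-injective (trans (inj-τ₁ (τ₁ i)) (trans (cong (to ∘ τ) (from-τ₁ i))
                     (trans (cong to (τ-invol (from (inj₁ i)))) (strictlyInverseˡ (inj₁ i)))))
      ; τ-≢      = λ i e → τ-≢ (from (inj₁ i)) (trans (sym (from-τ₁ i)) (cong (from ∘ inj₁) e))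
      ; common-τ = λ i → trans (sym (card-incidence i (adj Γ (from (inj₁ (τ₁ i))))))
                     (trans (cong (common (adj Γ) (from (inj₁ i))) (from-τ₁ i)) (common-τ (from (inj₁ i))))
      ; common-μ = λ {i} {i′} ne ne′ → trans (sym (card-incidence i (adj Γ (from (inj₁ i′)))))
                     (common-μ (trans (colour-from (inj₁ i)) (sym (colour-from (inj₁ i′)))) (ne ∘ from-inj)
                       (ne′ ∘ λ e → from-inj (trans (from-τ₁ i) e)))
      ; order    = trans (sym (card-isLeft f)) (trans (card-cong λ x → sym (f-colour x)) (classSize true))
      }
      where
      lem : ∀ i → Σ[ i′ ∈ Fin p ] inj₁ i′ ≡ to (τ (from (inj₁ i)))
      lem i = left _ (trans (sym (f-colour _)) (trans (τ-colour _) (colour-from (inj₁ i))))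
      τ₁ : Fin p → Fin p
      τ₁ i = proj₁ (lem i)
      inj-τ₁ : ∀ i → inj₁ (τ₁ i) ≡ to (τ (from (inj₁ i)))
      inj-τ₁ i = proj₂ (lem i)
      from-τ₁ : ∀ i → from (inj₁ (τ₁ i)) ≡ τ (from (inj₁ i))
      from-τ₁ i = trans (cong from (inj-τ₁ i)) (strictlyInverseʳ _)
      from-inj : ∀ {i i′} → from (inj₁ i) ≡ from (inj₁ i′) → i ≡ i′
      from-inj {i} {i′} e = inj₁-injective (trans (sym (strictlyInverseˡ (inj₁ i))) (trans (cong to e) (strictlyInverseˡ (inj₁ i′))))

  GDDDP-of-antipodal : Antipodal k Γ → IsIncidenceGraphOfGDDDP k Γ
  GDDDP-of-antipodal 𝒜 with enumerate (Antipodal.colour 𝒜)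
  ... | p , q , f , h = p , q , blocks
      , ( GDD-of-pairing (λ i j → lookup∘tabulate _ i) (pairing 𝒜 f h)
            (λ j → trans (card-cong λ i → symm Γ _ _) (incidence-size (recolour 𝒜) f′ h′ j))
        , GDD-of-pairing (λ j i → trans (lookup∘tabulate _ j) (trans (lookup∘tabulate _ i) (symm Γ _ _))) (pairing (recolour 𝒜) f′ h′)
            (λ i → trans (card-cong λ j → symm Γ _ _) (incidence-size 𝒜 f h i)))
      , f , λ x y → trans (cong₂ (adj Γ) (sym (strictlyInverseʳ x)) (sym (strictlyInverseʳ y))) (adj-from (to x) (to y))
    where
    open Inverse f
    blocks : Fin q → Subset p
    blocks j = tabulate λ i → incidence 𝒜 f h i j
    f′ : Fin v ↔ (Fin q ⊎ Fin p)
    f′ = mk↔ₛ′ swap swap swap-involutive swap-involutive ↔-∘ f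
    h′ : ∀ x → not (Antipodal.colour 𝒜 x) ≡ isLeft (swap (to x))
    h′ x = trans (cong not (h x)) (lem (to x))
      where
      lem : ∀ w → not (isLeft w) ≡ isLeft (swap w)
      lem (inj₁ _) = refl
      lem (inj₂ _) = refl
    adj-from : ∀ w w′ → adj Γ (from w) (from w′) ≡ adj (incidenceGraph blocks) w w′
    adj-from (inj₁ i) (inj₂ j) = sym (lookup∘tabulate _ i)
    adj-from (inj₂ j) (inj₁ i) = trans (symm Γ _ _) (sym (lookup∘tabulate _ i))
    adj-from (inj₁ i) (inj₁ i′) = adj-left 𝒜 f h i i′
    adj-from (inj₂ j) (inj₂ j′) = adj-left (recolour 𝒜) f′ h′ j j′

-- Sums over a commutative ring and the adjacency operator

module RingSums (R : CommutativeRing 0ℓ 0ℓ) where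
  open CommutativeRing R hiding (refl; sym; trans; zero) renaming (_+_ to _⊕_; _*_ to _⊗_)
  open CommutativeRing R using () renaming (refl to ≈-refl; sym to ≈-sym; trans to ≈-trans) public
  open import Algebra.Properties.Semiring.Sum semiring public
    using (sum; sum-cong-≋; sum-replicate-zero; ∑-distrib-+; ∑-comm; *-distribˡ-sum; *-distribʳ-sum)
  open import Algebra.Properties.Semiring.Mult semiring public
    using () renaming (_×_ to _·_; ×-homo-+ to ·-homo-+; ×1-homo-* to ·1-homo-*)

  -- Over the reals this unfolds to `⟦_⟧`, so sums of matrix entries are instances of the lemmas
  -- below. The module is also used over ℚ.
  ⟪_⟫ : Bool → Carrier
  ⟪ b ⟫ = if b then 1# else 0#

  ι : ℕ → Carrier
  ι n = n · 1#

  ⟪⟫-ι : ∀ b → ⟪ b ⟫ ≈ ι (𝟙 b)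
  ⟪⟫-ι true  = ≈-sym (+-identityʳ 1#)
  ⟪⟫-ι false = ≈-refl

  ⟪⟫-∧ : ∀ a b → ⟪ a ⟫ ⊗ ⟪ b ⟫ ≈ ⟪ a ∧ b ⟫
  ⟪⟫-∧ true  b = *-identityˡ _
  ⟪⟫-∧ false b = zeroˡ _

  sum-⟪⟫ : ∀ {n} (b : Fin n → Bool) → sum (λ i → ⟪ b i ⟫) ≈ ι (card b)
  sum-⟪⟫ {zero}  b = reflexive (cong ι (sym (card-false {b = b} λ ())))
  sum-⟪⟫ {suc n} b = ≈-trans (+-cong (⟪⟫-ι (b zero)) (sum-⟪⟫ (b ∘ suc)))
    (≈-trans (≈-sym (·-homo-+ 1# (𝟙 (b zero)) (card (b ∘ suc)))) (reflexive (cong ι (sym (card-suc b)))))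

  sum-∧ : ∀ {n} (a b : Fin n → Bool) → sum (λ i → ⟪ a i ⟫ ⊗ ⟪ b i ⟫) ≈ ι (card (λ i → a i ∧ b i))
  sum-∧ a b = ≈-trans (sum-cong-≋ λ i → ⟪⟫-∧ (a i) (b i)) (sum-⟪⟫ _)

  sum-0 : ∀ {n} {f : Fin n → Carrier} → (∀ i → f i ≈ 0#) → sum f ≈ 0#
  sum-0 {n} h = ≈-trans (sum-cong-≋ h) (sum-replicate-zero n)

  sum-δ : ∀ {n} (u : Fin n → Carrier) x → sum (λ i → ⟪ x == i ⟫ ⊗ u i) ≈ u x
  sum-δ u zero = ≈-trans (+-cong
    (≈-trans (*-congʳ (reflexive (cong ⟪_⟫ (==-refl zero)))) (*-identityˡ _))
    (sum-0 {f = λ i → ⟪ zero == suc i ⟫ ⊗ u (suc i)} λ i →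
      ≈-trans (*-congʳ (reflexive (cong ⟪_⟫ (==-≢ {i = zero} {suc i} λ ())))) (zeroˡ _))) (+-identityʳ _)
  sum-δ u (suc x) = ≈-trans (+-cong
    (≈-trans (*-congʳ (reflexive (cong ⟪_⟫ (==-≢ {i = suc x} {zero} λ ())))) (zeroˡ _))
    (≈-trans (sum-cong-≋ λ i → *-congʳ (reflexive (cong ⟪_⟫ (==-suc x i)))) (sum-δ (u ∘ suc) x))) (+-identityˡ _)

module RingAdjacency (R : CommutativeRing 0ℓ 0ℓ) {v k : ℕ} (Γ : Graph (Fin v))
                     (k≡ : k ≡ suc (half k ℕ.+ half k)) (1≤μ : 1 ≤ half k) (𝒜 : Antipodal k Γ) where
  open CommutativeRing R hiding (refl; sym; trans; zero) renaming (_+_ to _⊕_; _*_ to _⊗_)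
  open RingSums R
  open Antipodal 𝒜
  open AntipodalProperties Γ k≡ 1≤μ 𝒜
  open import Relation.Binary.Reasoning.Setoid setoid

  private
    V = Fin v
    μ = half k

  -- Linear forms with natural coefficients: identities between operators can then be proved in `ℕ`,
  -- coefficient by coefficient.
  weighted : (V → ℕ) → (V → Carrier) → Carrier
  weighted w u = sum (λ z → ι (w z) ⊗ u z)

  weighted-cong : ∀ {w w′} u → (∀ z → w z ≡ w′ z) → weighted w u ≈ weighted w′ u
  weighted-cong {w} {w′} u h = sum-cong-≋ {x = λ z → ι (w z) ⊗ u z} {y = λ z → ι (w′ z) ⊗ u z}
    λ z → *-congʳ (reflexive (cong ι (h z)))

  weighted-+ : ∀ w w′ u → weighted (λ z → w z ℕ.+ w′ z) u ≈ weighted w u ⊕ weighted w′ u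
  weighted-+ w w′ u = ≈-trans
    (sum-cong-≋ {y = λ z → ι (w z) ⊗ u z ⊕ ι (w′ z) ⊗ u z} λ z → ≈-trans (*-congʳ (·-homo-+ 1# (w z) (w′ z))) (distribʳ _ _ _))
    (∑-distrib-+ (λ z → ι (w z) ⊗ u z) (λ z → ι (w′ z) ⊗ u z))

  weighted-* : ∀ n w u → weighted (λ z → n ℕ.* w z) u ≈ ι n ⊗ weighted w u
  weighted-* n w u = ≈-trans
    (sum-cong-≋ {y = λ z → ι n ⊗ (ι (w z) ⊗ u z)} λ z → ≈-trans (*-congʳ (·1-homo-* n (w z))) (*-assoc _ _ _))
    (≈-sym (*-distribˡ-sum (ι n) (λ z → ι (w z) ⊗ u z)))

  weighted-𝟙 : ∀ (b : V → Bool) u → weighted (𝟙 ∘ b) u ≈ sum (λ z → ⟪ b z ⟫ ⊗ u z)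
  weighted-𝟙 b u = sum-cong-≋ {x = λ z → ι (𝟙 (b z)) ⊗ u z} {y = λ z → ⟪ b z ⟫ ⊗ u z} λ z → *-congʳ (≈-sym (⟪⟫-ι (b z)))

  weighted-δ : ∀ x u → weighted (λ z → 𝟙 (x == z)) u ≈ u x
  weighted-δ x u = ≈-trans (weighted-𝟙 (x ==_) u) (sum-δ u x)

  apply : (V → Carrier) → V → Carrier
  apply u x = sum (λ y → ⟪ a x y ⟫ ⊗ u y)

  classSum : Bool → (V → Carrier) → Carrier
  classSum c u = sum (λ z → ⟪ same c (colour z) ⟫ ⊗ u z)

  -- After exchanging the sums, `u y` is weighted by the number of neighbours of `y` in `b`. A
  -- neighbourhood as `b` gives the entries of A², a colour class gives the class sums of `apply u`.
  sum-apply : ∀ (b : V → Bool) u →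
              sum (λ x → ⟪ b x ⟫ ⊗ apply u x) ≈ weighted (λ y → card (λ x → b x ∧ a x y)) u
  sum-apply b u = begin
    sum (λ x → ⟪ b x ⟫ ⊗ sum (λ y → ⟪ a x y ⟫ ⊗ u y))
      ≈⟨ sum-cong-≋ {x = λ x → ⟪ b x ⟫ ⊗ apply u x} (λ x → *-distribˡ-sum ⟪ b x ⟫ (λ y → ⟪ a x y ⟫ ⊗ u y)) ⟩
    sum (λ x → sum (λ y → ⟪ b x ⟫ ⊗ (⟪ a x y ⟫ ⊗ u y)))
      ≈⟨ ∑-comm (λ x y → ⟪ b x ⟫ ⊗ (⟪ a x y ⟫ ⊗ u y)) ⟩
    sum (λ y → sum (λ x → ⟪ b x ⟫ ⊗ (⟪ a x y ⟫ ⊗ u y)))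
      ≈⟨ sum-cong-≋ {x = λ y → sum (λ x → ⟪ b x ⟫ ⊗ (⟪ a x y ⟫ ⊗ u y))} (λ y → column y) ⟩
    weighted (λ y → card (λ x → b x ∧ a x y)) u ∎
    where
    column : ∀ y → sum (λ x → ⟪ b x ⟫ ⊗ (⟪ a x y ⟫ ⊗ u y)) ≈ ι (card (λ x → b x ∧ a x y)) ⊗ u y
    column y = begin
      sum (λ x → ⟪ b x ⟫ ⊗ (⟪ a x y ⟫ ⊗ u y))
        ≈⟨ sum-cong-≋ {x = λ x → ⟪ b x ⟫ ⊗ (⟪ a x y ⟫ ⊗ u y)} (λ x → ≈-sym (*-assoc ⟪ b x ⟫ ⟪ a x y ⟫ (u y))) ⟩
      sum (λ x → (⟪ b x ⟫ ⊗ ⟪ a x y ⟫) ⊗ u y)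
        ≈⟨ ≈-sym (*-distribʳ-sum (u y) (λ x → ⟪ b x ⟫ ⊗ ⟪ a x y ⟫)) ⟩
      sum (λ x → ⟪ b x ⟫ ⊗ ⟪ a x y ⟫) ⊗ u y
        ≈⟨ *-congʳ (sum-∧ b (λ x → a x y)) ⟩
      ι (card (λ x → b x ∧ a x y)) ⊗ u y ∎

  -- The coefficient of `u z` in `square`. Both sides depend only on the relation of `x` and `z`:
  -- they are `k + μ` in cell 0, `μ` in cells 2 and 4, and 0 in the odd cells.
  square-weights : ∀ x z → cn x z ℕ.+ (μ ℕ.* 𝟙 (x == z) ℕ.+ μ ℕ.* 𝟙 (τ x == z)) ≡
                   k ℕ.* 𝟙 (x == z) ℕ.+ μ ℕ.* 𝟙 (same (colour x) (colour z))
  square-weights x z rewrite common-sym a x z | cn-rel x z | sym (rel-0 x z) | sym (rel-4 x z) | sym (rel-even x z) =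
    go (rel x z)
    where
    open ℕ.+-*-Solver
    go : ∀ h → cn₁ h ℕ.+ (μ ℕ.* 𝟙 (h == 0F) ℕ.+ μ ℕ.* 𝟙 (h == 4F)) ≡ k ℕ.* 𝟙 (h == 0F) ℕ.+ μ ℕ.* 𝟙 (even h)
    go 0F rewrite ==-refl {6} 0F | ==-≢ {6} {0F} {4F} (λ ()) =
      solve 2 (λ k m → k :+ (m :* con 1 :+ m :* con 0) := k :* con 1 :+ m :* con 1) refl k μ
    go 1F rewrite ==-≢ {6} {1F} {0F} (λ ()) | ==-≢ {6} {1F} {4F} (λ ()) =
      solve 2 (λ k m → m :* con 0 :+ m :* con 0 := k :* con 0 :+ m :* con 0) refl k μ
    go 2F rewrite ==-≢ {6} {2F} {0F} (λ ()) | ==-≢ {6} {2F} {4F} (λ ()) =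
      solve 2 (λ k m → m :+ (m :* con 0 :+ m :* con 0) := k :* con 0 :+ m :* con 1) refl k μ
    go 3F rewrite ==-≢ {6} {3F} {0F} (λ ()) | ==-≢ {6} {3F} {4F} (λ ()) =
      solve 2 (λ k m → m :* con 0 :+ m :* con 0 := k :* con 0 :+ m :* con 0) refl k μ
    go 4F rewrite ==-refl {6} 4F | ==-≢ {6} {4F} {0F} (λ ()) =
      solve 2 (λ k m → m :* con 0 :+ m :* con 1 := k :* con 0 :+ m :* con 1) refl k μ
    go 5F rewrite ==-≢ {6} {5F} {0F} (λ ()) | ==-≢ {6} {5F} {4F} (λ ()) =
      solve 2 (λ k m → m :* con 0 :+ m :* con 0 := k :* con 0 :+ m :* con 0) refl k μ

  -- A² + μ(I + T) = kI + μJ, arranged so that no subtraction occurs.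
  square : ∀ u x → apply (apply u) x ⊕ (ι μ ⊗ u x ⊕ ι μ ⊗ u (τ x)) ≈ ι k ⊗ u x ⊕ ι μ ⊗ classSum (colour x) u
  square u x = begin
    apply (apply u) x ⊕ (ι μ ⊗ u x ⊕ ι μ ⊗ u (τ x))
      ≈⟨ +-cong (≈-trans (sum-apply (a x) u) (weighted-cong u λ z → card-cong λ y → cong (a x y ∧_) (symm Γ y z)))
                (+-cong (*-congˡ (≈-sym (weighted-δ x u))) (*-congˡ (≈-sym (weighted-δ (τ x) u)))) ⟩
    weighted (cn x) u ⊕ (ι μ ⊗ weighted (λ z → 𝟙 (x == z)) u ⊕ ι μ ⊗ weighted (λ z → 𝟙 (τ x == z)) u)
      ≈⟨ +-congˡ (+-cong (≈-sym (weighted-* μ _ u)) (≈-sym (weighted-* μ _ u))) ⟩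
    weighted (cn x) u ⊕ (weighted (λ z → μ ℕ.* 𝟙 (x == z)) u ⊕ weighted (λ z → μ ℕ.* 𝟙 (τ x == z)) u)
      ≈⟨ +-congˡ (≈-sym (weighted-+ (λ z → μ ℕ.* 𝟙 (x == z)) (λ z → μ ℕ.* 𝟙 (τ x == z)) u)) ⟩
    weighted (cn x) u ⊕ weighted (λ z → μ ℕ.* 𝟙 (x == z) ℕ.+ μ ℕ.* 𝟙 (τ x == z)) u
      ≈⟨ ≈-sym (weighted-+ (cn x) (λ z → μ ℕ.* 𝟙 (x == z) ℕ.+ μ ℕ.* 𝟙 (τ x == z)) u) ⟩
    weighted (λ z → cn x z ℕ.+ (μ ℕ.* 𝟙 (x == z) ℕ.+ μ ℕ.* 𝟙 (τ x == z))) u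
      ≈⟨ weighted-cong u (square-weights x) ⟩
    weighted (λ z → k ℕ.* 𝟙 (x == z) ℕ.+ μ ℕ.* 𝟙 (same (colour x) (colour z))) u
      ≈⟨ weighted-+ (λ z → k ℕ.* 𝟙 (x == z)) (λ z → μ ℕ.* 𝟙 (same (colour x) (colour z))) u ⟩
    weighted (λ z → k ℕ.* 𝟙 (x == z)) u ⊕ weighted (λ z → μ ℕ.* 𝟙 (same (colour x) (colour z))) u
      ≈⟨ +-cong (≈-trans (weighted-* k _ u) (*-congˡ (weighted-δ x u))) (≈-trans (weighted-* μ _ u) (*-congˡ (weighted-𝟙 _ u))) ⟩
    ι k ⊗ u x ⊕ ι μ ⊗ classSum (colour x) u ∎

  class-degree : ∀ c y → card (λ x → same c (colour x) ∧ a x y) ≡ k ℕ.* 𝟙 (same (not c) (colour y))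
  class-degree c y with same (not c) (colour y) in e
  ... | true  = trans (card-cong lem) (trans (regular y) (sym (ℕ.*-identityʳ k)))
    where
    lem : ∀ x → same c (colour x) ∧ a x y ≡ a y x
    lem x with a x y in e′
    ... | true  = trans (∧-comm _ true) (trans (same-≡ (trans (sym (not-involutive c)) (trans (cong not (same⇒≡ {not c} e)) (sym (not-flip (proper e′))))))
                    (sym (a-sym e′)))
    ... | false = trans (∧-comm _ false) (sym (trans (symm Γ y x) e′))
  ... | false = trans (card-false λ x → ≢true⇒≡false λ t → true≢false
          (same-≡ {not c} (trans (cong not (same⇒≡ {c} (∧-trueˡ t))) (sym (proper (∧-trueʳ {same c (colour x)} t))))) e) (sym (ℕ.*-zeroʳ k))

  -- A vertex of the other class is counted once for each of its `k` neighbours, a vertex of class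
  -- `c` never.
  classSum-apply : ∀ c u → classSum c (apply u) ≈ ι k ⊗ classSum (not c) u
  classSum-apply c u = ≈-trans (sum-apply (λ x → same c (colour x)) u)
    (≈-trans (weighted-cong u (class-degree c)) (≈-trans (weighted-* k _ u) (*-congˡ (weighted-𝟙 _ u))))

  apply-cong : ∀ {u w} → (∀ z → u z ≈ w z) → ∀ x → apply u x ≈ apply w x
  apply-cong {u} {w} h x = sum-cong-≋ {x = λ y → ⟪ a x y ⟫ ⊗ u y} {y = λ y → ⟪ a x y ⟫ ⊗ w y} λ y → *-congˡ (h y)

  sum-scale : ∀ (b : V → Bool) t (u : V → Carrier) → sum (λ y → ⟪ b y ⟫ ⊗ (t ⊗ u y)) ≈ t ⊗ sum (λ y → ⟪ b y ⟫ ⊗ u y)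
  sum-scale b t u = ≈-trans (sum-cong-≋ {x = λ y → ⟪ b y ⟫ ⊗ (t ⊗ u y)} {y = λ y → t ⊗ (⟪ b y ⟫ ⊗ u y)}
      λ y → ≈-trans (≈-sym (*-assoc _ _ _)) (≈-trans (*-congʳ (*-comm _ _)) (*-assoc _ _ _)))
    (≈-sym (*-distribˡ-sum t (λ y → ⟪ b y ⟫ ⊗ u y)))

  sum-add : ∀ (b : V → Bool) (u w : V → Carrier) → sum (λ y → ⟪ b y ⟫ ⊗ (u y ⊕ w y)) ≈ sum (λ y → ⟪ b y ⟫ ⊗ u y) ⊕ sum (λ y → ⟪ b y ⟫ ⊗ w y)
  sum-add b u w = ≈-trans (sum-cong-≋ {x = λ y → ⟪ b y ⟫ ⊗ (u y ⊕ w y)} λ y → distribˡ ⟪ b y ⟫ (u y) (w y))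
    (∑-distrib-+ (λ y → ⟪ b y ⟫ ⊗ u y) (λ y → ⟪ b y ⟫ ⊗ w y))

  classSum-cong : ∀ c {u w} → (∀ z → u z ≈ w z) → classSum c u ≈ classSum c w
  classSum-cong c {u} {w} h = sum-cong-≋ {x = λ y → ⟪ same c (colour y) ⟫ ⊗ u y} {y = λ y → ⟪ same c (colour y) ⟫ ⊗ w y} λ y → *-congˡ (h y)

  classSum-δ : ∀ c x → classSum c (λ z → ⟪ x == z ⟫) ≈ ⟪ same c (colour x) ⟫
  classSum-δ c x = ≈-trans (sum-cong-≋ {x = λ z → ⟪ same c (colour z) ⟫ ⊗ ⟪ x == z ⟫} λ z → *-comm ⟪ same c (colour z) ⟫ ⟪ x == z ⟫)
    (sum-δ (λ z → ⟪ same c (colour z) ⟫) x)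

-- The association scheme

card-∧ˡ : ∀ {n} c (b : Fin n → Bool) → card (λ i → c ∧ b i) ≡ 𝟙 c ℕ.* card b
card-∧ˡ true  b = sym (ℕ.+-identityʳ _)
card-∧ˡ false b = card-false λ _ → refl

module _ {v k : ℕ} (Γ : Graph (Fin v)) (k≡ : k ≡ suc (half k ℕ.+ half k)) (1≤μ : 1 ≤ half k)
         (x₀ : Fin v) (𝒜 : Antipodal k Γ) where
  open Antipodal 𝒜
  open AntipodalProperties Γ k≡ 1≤μ 𝒜
  open RingSums ℝ-commutativeRing using (ι; sum-∧; sum-⟪⟫; sum-δ; sum-cong-≋)
  private
    1≤k : 1 ≤ k
    1≤k = subst (1 ≤_) (sym k≡) (s≤s z≤n)

  inter : Fin 6 → Fin 6 → Fin v → Fin v → ℕ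
  inter i j x y = card (λ z → (rel y z == j) ∧ (rel x z == i))

  inter-even : ∀ x y j → card (λ z → (rel y z == j) ∧ even (rel x z)) ≡
               𝟙 (same (even (rel x y)) (even j)) ℕ.* size (𝒬 k) j
  inter-even x y j = trans (card-cong lem) (trans (card-∧ˡ (same (even (rel x y)) (even j)) (λ z → rel y z == j)) (cong (𝟙 (same (even (rel x y)) (even j)) ℕ.*_) (Cells.sizes (cells y) j)))
    where
    transitive : ∀ p q r → same p q ≡ same (same p r) (same r q)
    transitive true  true  true  = refl
    transitive true  true  false = refl
    transitive true  false true  = refl
    transitive true  false false = refl
    transitive false true  true  = refl
    transitive false true  false = refl
    transitive false false true  = refl
    transitive false false false = refl
    lem : ∀ z → (rel y z == j) ∧ even (rel x z) ≡ same (even (rel x y)) (even j) ∧ (rel y z == j)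
    lem z with rel y z == j in e
    ... | false = ∧-comm false _
    ... | true  = trans (rel-even x z) (trans (transitive (colour x) (colour z) (colour y))
          (trans (cong₂ same (sym (rel-even x y)) (trans (sym (rel-even y z)) (cong even (==⇒≡ e)))) (∧-comm true _)))

  inter-odd : ∀ x y j → card (λ z → (rel y z == j) ∧ not (even (rel x z))) ≡
              size (𝒬 k) j ∸ 𝟙 (same (even (rel x y)) (even j)) ℕ.* size (𝒬 k) j
  inter-odd x y j = sub (trans (card-+ λ z → 𝟙-∧-not (rel y z == j) (even (rel x z))) (Cells.sizes (cells y) j)) (inter-even x y j)
    where
    sub : ∀ {p q t p′} → p ℕ.+ q ≡ t → p ≡ p′ → q ≡ t ∸ p′
    sub {p} {q} refl refl = sym (ℕ.m+n∸m≡n p q)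

  -- The intersection numbers, with `h` the relation of the two end vertices. For `i` = 0, 1, 3, 4
  -- they are read from the diagram, at `τ x` by means of `flip`. For `i` = 2 and 5 they are the
  -- part of cell `j` of the right parity minus what is already counted.
  intersection : Fin 6 → Fin 6 → Fin 6 → ℕ
  intersection 0F j h = 𝟙 (h == j)
  intersection 1F j h = quotient (𝒬 k) h j
  intersection 2F j h = 𝟙 (same (even h) (even j)) ℕ.* size (𝒬 k) j ∸ (𝟙 (h == j) ℕ.+ 𝟙 (flip h == j))
  intersection 3F j h = quotient (𝒬 k) (flip h) j
  intersection 4F j h = 𝟙 (flip h == j)
  intersection 5F j h = size (𝒬 k) j ∸ 𝟙 (same (even h) (even j)) ℕ.* size (𝒬 k) j
                        ∸ (quotient (𝒬 k) h j ℕ.+ quotient (𝒬 k) (flip h) j)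

  inter-intersection : ∀ i j x y → inter i j x y ≡ intersection i j (rel x y)
  inter-intersection 0F j x y = trans (card-rel-0 (λ z → rel y z == j) x) (cong (λ h → 𝟙 (h == j)) (rel-sym x y))
  inter-intersection 1F j x y = trans (card-cong λ z → trans (∧-comm (rel y z == j) _) (cong (_∧ (rel y z == j)) (rel-1 x z)))
    (trans (Cells.counts (cells y) x j) (cong (λ h → quotient (𝒬 k) h j) (rel-sym x y)))
  inter-intersection 2F j x y = sub₃ (card-even (λ z → rel y z == j) (rel x))
    (inter-intersection 0F j x y) (inter-intersection 4F j x y) (inter-even x y j)
  inter-intersection 3F j x y = trans (card-cong λ z → trans (∧-comm (rel y z == j) _) (cong (_∧ (rel y z == j)) (rel-3 x z)))
    (trans (Cells.counts (cells y) (τ x) j) (cong (λ h → quotient (𝒬 k) h j) (trans (rel-sym (τ x) y) (rel-τ x y))))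
  inter-intersection 4F j x y = trans (card-rel-4 (λ z → rel y z == j) x)
    (cong (λ h → 𝟙 (h == j)) (trans (rel-sym (τ x) y) (rel-τ x y)))
  inter-intersection 5F j x y = sub₃ (card-odd (λ z → rel y z == j) (rel x))
    (inter-intersection 1F j x y) (inter-intersection 3F j x y) (inter-odd x y j)

  scheme : SymmetricScheme 5 v
  scheme = record
    { R         = λ i x y → rel x y == i
    ; nonempty  = λ i → let z , e = card-exists _ (subst (1 ≤_) (sym (Cells.sizes (cells x₀) i)) (size-pos 1≤k i))
                        in x₀ , z , ≡true⇒T e
    ; symmetric = λ i x y → ≡⇒≃ (cong (λ h → ⟦ h == i ⟧) (rel-sym y x))
    ; F₀≃I      = λ x y → ≡⇒≃ (cong ⟦_⟧ (trans (rel-0 x y) (==-does x y)))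
    ; ΣF≃J      = λ x y → ≃-trans (sum-⟪⟫ (λ h → rel x y == h))
                    (≃-trans (≡⇒≃ (cong ι (card-single (rel x y)))) (CommutativeRing.+-identityʳ ℝ-commutativeRing 1ℝ))
    ; product   = λ i j → ι ∘ intersection i j , λ x y →
        ≃-trans (sum-∧ (λ z → rel x z == i) (λ z → rel z y == j))
        (≃-trans (≡⇒≃ (cong ι (trans (card-cong λ z → trans (∧-comm (rel x z == i) (rel z y == j))
            (cong (λ h → (h == j) ∧ (rel x z == i)) (rel-sym y z))) (inter-intersection i j x y))))
        -- Exactly one relation holds between `x` and `y`, so the linear combination has a single
        -- surviving coefficient.
        (≃-trans (≃-sym (sum-δ (ι ∘ intersection i j) (rel x y)))
          (sum-cong-≋ λ h → CommutativeRing.*-comm ℝ-commutativeRing ⟦ rel x y == h ⟧ (ι (intersection i j h)))))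
    }
    where
    ≡⇒≃ : ∀ {x y : ℝ} → x ≡ y → x ≃ y
    ≡⇒≃ refl = ≃-refl

  relationGraph-of-antipodal : IsRelationGraphWithDiagram k Γ
  -- The index `0F` stands for relation 1, since `relationGraph` skips the identity relation.
  relationGraph-of-antipodal = v , scheme , 0F
    , (↔-id _ , λ x y → sym (rel-1 x y))
    , ↔-id _ , refl
    , λ x → fromCells (mkIndex λ j → lookup∘tabulate _) (size-pos 1≤k) (record
        { sizes  = Cells.sizes (cells x)
        ; counts = λ z j → trans (card-cong λ w → cong (_∧ (rel x w == j)) (rel-1 z w)) (Cells.counts (cells x) z j)
        })

-- Natural numbers in the rationals and the null sequence 1/(n + 1)

open ℚ.+-*-Solver using (solve; _:=_; _:+_; _:*_; _:-_; :-_; con)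

open RingSums ℝ-commutativeRing using (ι)
open RingSums ℚ.+-*-commutativeRing using (·1-homo-*) renaming (ι to ιℚ)

private
  module ℝʳ = CommutativeRing ℝ-commutativeRing

seq-ι : ∀ m n → seq (ι m) n ≡ ιℚ m
seq-ι zero    n = refl
seq-ι (suc m) n = cong (1ℚ ℚ.+_) (seq-ι m n)

0≤ιℚ : ∀ n → 0ℚ ℚ.≤ ιℚ n
0≤ιℚ zero    = ℚ.≤-refl
0≤ιℚ (suc n) = ℚ.+-mono-≤ (ℚ.<⇒≤ 0<1) (0≤ιℚ n)

ιℚ-mono-≤ : ∀ {m n} → m ℕ.≤ n → ιℚ m ℚ.≤ ιℚ n
ιℚ-mono-≤ {n = n} z≤n = 0≤ιℚ n
ιℚ-mono-≤ (s≤s p)     = ℚ.+-monoʳ-≤ 1ℚ (ιℚ-mono-≤ p)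

n<1+n : ∀ p → p ℚ.< 1ℚ ℚ.+ p
n<1+n p = subst (ℚ._< 1ℚ ℚ.+ p) (ℚ.+-identityˡ p) (ℚ.+-monoˡ-< p 0<1)

ιℚ-mono-< : ∀ {m n} → m ℕ.< n → ιℚ m ℚ.< ιℚ n
ιℚ-mono-< {m} p = ℚ.<-≤-trans (n<1+n (ιℚ m)) (ιℚ-mono-≤ p)

ιℚ-mkℚ : ∀ n → mkℚ (ℤ.+ n) 0 (C.sym (C.1-coprimeTo n)) ≡ ιℚ n
ιℚ-mkℚ zero    = refl
ιℚ-mkℚ (suc n) = trans
  (ℚ.toℚᵘ-injective (ℚᵘ.≃-trans (ℚᵘ.*≡* (cong (λ i → (ℤ.+ 1 ℤ.+ i) ℤ.* ℤ.+ 1) (sym (ℤ.*-identityʳ (ℤ.+ n)))))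
    (ℚᵘ.≃-sym (ℚ.toℚᵘ-homo-+ 1ℚ (mkℚ (ℤ.+ n) 0 (C.sym (C.1-coprimeTo n)))))))
  (cong (1ℚ ℚ.+_) (ιℚ-mkℚ n))

-- δ n = 1 / (n + 1)
δ : ℕ → ℚ
δ n = mkℚ (ℤ.+ 1) n (C.1-coprimeTo (suc n))

0<δ : ∀ n → 0ℚ ℚ.< δ n
0<δ n = ℚ.positive⁻¹ (δ n)

δ-inverse : ∀ n → ιℚ (suc n) ℚ.* δ n ≡ 1ℚ
δ-inverse n = trans (cong (ℚ._* δ n) (sym (ιℚ-mkℚ (suc n)))) (ℚ.*-inverseʳ (mkℚ (ℤ.+ suc n) 0 (C.sym (C.1-coprimeTo (suc n)))))

δ-null : Null₁.IsNull δ
δ-null ε@(mkℚ (ℤ.+ zero) d _) 0<ε = ⊥-elim (ℚ.<-irrefl (sym (ℚ.≃⇒≡ (ℚ.*≡* refl))) 0<ε)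
δ-null (mkℚ ℤ.-[1+ _ ] d _) (*<* ())
-- Here `ε` is `(e + 1) / (d + 1)`, and `δ n < 1 / (d + 1)` as soon as `n` is at least `d + 1`.
δ-null (mkℚ ℤ.+[1+ e ] d _) _ = suc d , λ n d<n → *<* (subst₂ ℤ._<_ (sym (ℤ.*-identityˡ (ℤ.+ suc d))) (ℤ.pos-* (suc e) (suc n))
  (ℤ.+<+ (ℕ.<-≤-trans (s≤s d<n) (ℕ.m≤m+n (suc n) (e ℕ.* suc n)))))

∣∣< : ∀ {p ε} → p ℚ.< ε → ℚ.- p ℚ.< ε → ℚ.∣ p ∣ ℚ.< ε
∣∣< {p} {ε} a b with ℚ.∣p∣≡p∨∣p∣≡-p p
... | inj₁ e = subst (ℚ._< ε) (sym e) a
... | inj₂ e = subst (ℚ._< ε) (sym e) b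

≤-sub : ∀ {p q r} → p ℚ.+ q ℚ.≤ r → p ℚ.≤ r ℚ.- q
≤-sub {p} {q} {r} h = subst (ℚ._≤ r ℚ.- q) (solve 2 (λ p q → p :+ q :- q := p) refl p q) (ℚ.+-monoˡ-≤ (ℚ.- q) h)

<-sub : ∀ {p q r} → p ℚ.< q ℚ.+ r → p ℚ.- q ℚ.< r
<-sub {p} {q} {r} h = subst (p ℚ.- q ℚ.<_) (solve 2 (λ q r → q :+ r :- q := r) refl q r) (ℚ.+-monoˡ-< (ℚ.- q) h)

*-mono-≤ : ∀ {p q r s} → 0ℚ ℚ.≤ p → 0ℚ ℚ.≤ r → p ℚ.≤ q → r ℚ.≤ s → p ℚ.* r ℚ.≤ q ℚ.* s
*-mono-≤ {p} {q} {r} {s} 0≤p 0≤r p≤q r≤s = ℚ.≤-trans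
  (ℚ.*-monoʳ-≤-nonNeg r {{ℚ.nonNegative 0≤r}} p≤q)
  (ℚ.*-monoˡ-≤-nonNeg q {{ℚ.nonNegative (ℚ.≤-trans 0≤p p≤q)}} r≤s)

-- Square roots

isqrt : ∀ n → ∃[ r ] (r ℕ.* r ℕ.≤ n × n ℕ.< suc r ℕ.* suc r)
isqrt zero = 0 , z≤n , s≤s z≤n
isqrt (suc n) with r , lo , hi ← isqrt n with suc r ℕ.* suc r ℕ.≤? suc n
... | yes p = suc r , p , ℕ.≤-<-trans hi (ℕ.*-mono-< (ℕ.n<1+n (suc r)) (ℕ.n<1+n (suc r)))
... | no ¬p = r , ℕ.m≤n⇒m≤1+n lo , ℕ.≰⇒> ¬p

module Sqrt (k : ℕ) where

  root : ℕ → ℕ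
  root n = proj₁ (isqrt (k ℕ.* (suc n ℕ.* suc n)))

  -- The integer part of `(n + 1) √k`, divided by `n + 1`: an approximation from below, with
  -- `approx n + δ n` above the root.
  approx : ℕ → ℚ
  approx n = ιℚ (root n) ℚ.* δ n

  private
    scale : ∀ m n → ιℚ (m ℕ.* (suc n ℕ.* suc n)) ℚ.* (δ n ℚ.* δ n) ≡ ιℚ m
    scale m n = begin
      ιℚ (m ℕ.* (suc n ℕ.* suc n)) ℚ.* (δ n ℚ.* δ n)
        ≡⟨ cong (ℚ._* (δ n ℚ.* δ n)) (trans (·1-homo-* m (suc n ℕ.* suc n)) (cong (ιℚ m ℚ.*_) (·1-homo-* (suc n) (suc n)))) ⟩
      ιℚ m ℚ.* (ιℚ (suc n) ℚ.* ιℚ (suc n)) ℚ.* (δ n ℚ.* δ n)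
        ≡⟨ solve 3 (λ m N d → m :* (N :* N) :* (d :* d) := m :* ((N :* d) :* (N :* d))) refl (ιℚ m) (ιℚ (suc n)) (δ n) ⟩
      ιℚ m ℚ.* ((ιℚ (suc n) ℚ.* δ n) ℚ.* (ιℚ (suc n) ℚ.* δ n))
        ≡⟨ cong (λ q → ιℚ m ℚ.* (q ℚ.* q)) (δ-inverse n) ⟩
      ιℚ m ℚ.* 1ℚ
        ≡⟨ ℚ.*-identityʳ (ιℚ m) ⟩
      ιℚ m ∎
      where open ≡-Reasoning

    square-δ : ∀ r n → ιℚ (r ℕ.* r) ℚ.* (δ n ℚ.* δ n) ≡ (ιℚ r ℚ.* δ n) ℚ.* (ιℚ r ℚ.* δ n)
    square-δ r n = trans (cong (ℚ._* (δ n ℚ.* δ n)) (·1-homo-* r r))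
      (solve 2 (λ r d → r :* r :* (d :* d) := (r :* d) :* (r :* d)) refl (ιℚ r) (δ n))

    δδ-pos : ∀ n → ℚ.Positive (δ n ℚ.* δ n)
    δδ-pos n = ℚ.pos*pos⇒pos (δ n) (δ n)

    next : ∀ n → ιℚ (suc (root n)) ℚ.* δ n ≡ approx n ℚ.+ δ n
    next n = solve 2 (λ r d → (con 1ℚ :+ r) :* d := r :* d :+ d) refl (ιℚ (root n)) (δ n)

  0≤approx : ∀ n → 0ℚ ℚ.≤ approx n
  0≤approx n = subst (ℚ._≤ approx n) (ℚ.*-zeroˡ (δ n)) (ℚ.*-monoʳ-≤-nonNeg (δ n) (0≤ιℚ (root n)))

  approx² : ∀ n → approx n ℚ.* approx n ℚ.≤ ιℚ k
  approx² n = subst₂ ℚ._≤_ (square-δ (root n) n) (scale k n)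
    (ℚ.*-monoʳ-≤-nonNeg (δ n ℚ.* δ n) {{ℚ.pos⇒nonNeg (δ n ℚ.* δ n) {{δδ-pos n}}}} (ιℚ-mono-≤ (proj₁ (proj₂ (isqrt (k ℕ.* (suc n ℕ.* suc n)))))))

  next² : ∀ n → ιℚ k ℚ.< (approx n ℚ.+ δ n) ℚ.* (approx n ℚ.+ δ n)
  next² n = subst₂ ℚ._<_ (scale k n) (trans (square-δ (suc (root n)) n) (cong₂ ℚ._*_ (next n) (next n)))
    (ℚ.*-monoˡ-<-pos (δ n ℚ.* δ n) {{δδ-pos n}} (ιℚ-mono-< (proj₂ (proj₂ (isqrt (k ℕ.* (suc n ℕ.* suc n)))))))

  -- Otherwise `approx m` would reach the upper bound `approx n + δ n`, whose square exceeds `k`,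
  -- while the square of `approx m` does not. Used with `m` and `n` in both orders this gives the
  -- Cauchy property.
  approx-close : ∀ m n → approx m ℚ.- approx n ℚ.< δ n
  approx-close m n = <-sub {approx m} {approx n} (ℚ.≰⇒> λ h → ℚ.<-irrefl refl
    (ℚ.<-≤-trans (next² n) (ℚ.≤-trans (*-mono-≤ 0≤next 0≤next h h) (approx² m))))
    where
    0≤next : 0ℚ ℚ.≤ approx n ℚ.+ δ n
    0≤next = ℚ.+-mono-≤ (0≤approx n) (ℚ.<⇒≤ (0<δ n))

  private
    δ<  : ∀ {ε} (p : 0ℚ ℚ.< ε) n → proj₁ (δ-null ε p) ℕ.≤ n → δ n ℚ.< ε
    δ< {ε} p n h = subst (ℚ._< ε) (ℚ.0≤p⇒∣p∣≡p (ℚ.<⇒≤ (0<δ n))) (proj₂ (δ-null ε p) n h)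

  √ : ℝ
  √ .seq = approx
  √ .cauchy ε 0<ε = proj₁ (δ-null ε 0<ε) , λ m n hm hn → ∣∣<
    (ℚ.<-trans (approx-close m n) (δ< 0<ε n hn))
    (subst (ℚ._< ε) (sym (neg-sub (approx m) (approx n))) (ℚ.<-trans (approx-close n m) (δ< 0<ε m hm)))

  -- With `q = approx n`, the defect `k − q²` is non-negative and below `(2q + δ)δ ≤ (2q + 1)δ`, a
  -- bounded sequence times a null one. The bounded factor is the sequence of `√ +ʳ √ +ʳ 1ℝ`,
  -- bounded because it is Cauchy.
  √² : √ *ʳ √ ≃ ι k
  √² = mk≃ λ ε 0<ε →
    let N , h = Null₁.bounded*null {y} {δ} (bounded y (cauchy (√ +ʳ √ +ʳ 1ℝ))) δ-null ε 0<ε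
    in N , λ n N≤n → ∣∣<
      (ℚ.≤-<-trans (subst (ℚ._≤ 0ℚ) (cong (λ q → approx n ℚ.* approx n ℚ.- q) (sym (seq-ι k n))) (≤0 (approx² n))) 0<ε)
      (subst (ℚ._< ε) (trans (sym (neg-sub (approx n ℚ.* approx n) (ιℚ k))) (cong (λ q → ℚ.- (approx n ℚ.* approx n ℚ.- q)) (sym (seq-ι k n))))
        (ℚ.<-≤-trans (gap n) (ℚ.≤-trans (p≤∣p∣ (y n ℚ.* δ n)) (ℚ.<⇒≤ (h n N≤n)))))
    where
    y : ℕ → ℚ
    y = seq (√ +ʳ √ +ʳ 1ℝ)
    p≤∣p∣ : ∀ p → p ℚ.≤ ℚ.∣ p ∣
    p≤∣p∣ p = case ℚ.≤-total 0ℚ p of λ where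
      (inj₁ 0≤p) → ℚ.≤-reflexive (sym (ℚ.0≤p⇒∣p∣≡p 0≤p))
      (inj₂ p≤0) → ℚ.≤-trans p≤0 (ℚ.0≤∣p∣ p)
    ≤0 : ∀ {p q} → p ℚ.≤ q → p ℚ.- q ℚ.≤ 0ℚ
    ≤0 {p} {q} h = subst (p ℚ.- q ℚ.≤_) (ℚ.+-inverseʳ q) (ℚ.+-monoˡ-≤ (ℚ.- q) h)
    δ≤1 : ∀ n → δ n ℚ.≤ 1ℚ
    δ≤1 n = subst₂ ℚ._≤_ (ℚ.*-identityˡ (δ n)) (δ-inverse n)
      (ℚ.*-monoʳ-≤-nonNeg (δ n) (subst (ℚ._≤ ιℚ (suc n)) (ℚ.+-identityʳ 1ℚ) (ℚ.+-monoʳ-≤ 1ℚ (0≤ιℚ n))))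
    gap : ∀ n → ιℚ k ℚ.- approx n ℚ.* approx n ℚ.< y n ℚ.* δ n
    gap n = ℚ.<-≤-trans (<-sub {ιℚ k} {approx n ℚ.* approx n} (subst (ιℚ k ℚ.<_)
        (solve 2 (λ q d → (q :+ d) :* (q :+ d) := q :* q :+ (q :+ q :+ d) :* d) refl (approx n) (δ n)) (next² n)))
      (ℚ.*-monoʳ-≤-nonNeg (δ n) (ℚ.+-monoʳ-≤ (approx n ℚ.+ approx n) (δ≤1 n)))

  -- Integer bounds hold at every index and not only in the limit: `c (n + 1)` is an integer whose
  -- square is at most `k (n + 1)²`, so rounding down does not go below it.
  approx-≥ : ∀ {c} → c ℕ.* c ℕ.≤ k → ∀ n → ιℚ c ℚ.≤ approx n
  approx-≥ {c} c²≤k n = ℚ.≮⇒≥ λ lt → ℚ.<-irrefl refl (contra lt)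
    where
    N = suc n
    c≤r : c ℕ.* N ℕ.≤ root n
    c≤r = ℕ.≮⇒≥ λ lt → ℕ.<-irrefl refl (ℕ.<-≤-trans (proj₂ (proj₂ (isqrt (k ℕ.* (N ℕ.* N)))))
      (ℕ.≤-trans (ℕ.*-mono-≤ lt lt) (ℕ.≤-trans (ℕ.≤-reflexive (ℕ.[m*n]*[o*p]≡[m*o]*[n*p] c N c N)) (ℕ.*-monoˡ-≤ (N ℕ.* N) c²≤k))))
    ιc : ιℚ (c ℕ.* N) ℚ.* δ n ≡ ιℚ c
    ιc = trans (cong (ℚ._* δ n) (·1-homo-* c N)) (trans (ℚ.*-assoc (ιℚ c) (ιℚ N) (δ n))
      (trans (cong (ιℚ c ℚ.*_) (δ-inverse n)) (ℚ.*-identityʳ (ιℚ c))))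
    contra : approx n ℚ.< ιℚ c → approx n ℚ.< approx n
    contra lt = ℚ.<-≤-trans lt (subst (ℚ._≤ approx n) ιc (ℚ.*-monoʳ-≤-nonNeg (δ n) (ιℚ-mono-≤ c≤r)))

  approx-≤ : ∀ {c} → k ℕ.≤ c ℕ.* c → ∀ n → approx n ℚ.≤ ιℚ c
  approx-≤ {c} k≤c² n = ℚ.≮⇒≥ λ lt → ℚ.<-irrefl refl (ℚ.<-≤-trans (square-< lt)
      (ℚ.≤-trans (approx² n) (subst (ιℚ k ℚ.≤_) (·1-homo-* c c) (ιℚ-mono-≤ k≤c²))))
    where
    square-< : ιℚ c ℚ.< approx n → ιℚ c ℚ.* ιℚ c ℚ.< approx n ℚ.* approx n
    square-< lt = ℚ.≤-<-trans (ℚ.*-monoˡ-≤-nonNeg (ιℚ c) {{ℚ.nonNegative (0≤ιℚ c)}} (ℚ.<⇒≤ lt))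
      (ℚ.*-monoˡ-<-pos (approx n) {{ℚ.positive (ℚ.≤-<-trans (0≤ιℚ c) lt)}} lt)

-- Apartness

private
  0<½* : ∀ {ε} → 0ℚ ℚ.< ε → 0ℚ ℚ.< ½ ℚ.* ε
  0<½* {ε} 0<ε = ℚ.positive⁻¹ (½ ℚ.* ε) {{ℚ.pos*pos⇒pos ½ ε {{ℚ.positive 0<ε}}}}

  ½+½ : ∀ ε → ½ ℚ.* ε ℚ.+ ½ ℚ.* ε ≡ ε
  ½+½ ε = trans (sym (ℚ.*-distribʳ-+ ε ½ ½)) (ℚ.*-identityˡ ε)

  abs-near : ∀ {ε p q} → ε ℚ.≤ ℚ.∣ p ∣ → ℚ.∣ p ℚ.- q ∣ ℚ.< ½ ℚ.* ε → ½ ℚ.* ε ℚ.≤ ℚ.∣ q ∣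
  abs-near {ε} {p} {q} h near = ℚ.≮⇒≥ λ lt → ℚ.<-irrefl refl (ℚ.≤-<-trans h
    (ℚ.≤-<-trans (subst (λ r → ℚ.∣ r ∣ ℚ.≤ ℚ.∣ q ∣ ℚ.+ ℚ.∣ p ℚ.- q ∣) (sym (split p q)) (ℚ.∣p+q∣≤∣p∣+∣q∣ q (p ℚ.- q)))
      (subst (ℚ.∣ q ∣ ℚ.+ ℚ.∣ p ℚ.- q ∣ ℚ.<_) (½+½ ε) (ℚ.+-mono-< lt near))))

#-respˡ : ∀ x y z → x ≃ y → x # z → y # z
#-respˡ x y z e (ε , 0<ε , N , h) = ½ ℚ.* ε , 0<½* 0<ε , M ⊔ N , λ n le →
    abs-near {p = seq x n ℚ.- seq z n} (h n (ℕ.≤-trans (ℕ.m≤n⊔m M N) le))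
      (subst (λ p → ℚ.∣ p ∣ ℚ.< ½ ℚ.* ε) (solve 3 (λ x y z → x :- y := x :- z :- (y :- z)) refl (seq x n) (seq y n) (seq z n))
        (proj₂ (null e (½ ℚ.* ε) (0<½* 0<ε)) n (ℕ.≤-trans (ℕ.m≤m⊔n M N) le)))
  where M = proj₁ (null e (½ ℚ.* ε) (0<½* 0<ε))

-- Compare |t − x| with ε/2 far enough along the sequences.
#-cotrans : ∀ x y → x # y → ∀ t → t # x ⊎ t # y
#-cotrans x y (ε , 0<ε , N , h) t = decide (½ ℚ.* ε ℚ.≤? ℚ.∣ seq t L ℚ.- seq x L ∣)
  where
  η = ½ ℚ.* (½ ℚ.* ε)
  0<η = 0<½* (0<½* 0<ε)
  dx dy : ℝ
  dx = t +ʳ -ʳ x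
  dy = t +ʳ -ʳ y
  M₁ = proj₁ (cauchy dx η 0<η)
  M₂ = proj₁ (cauchy dy η 0<η)
  L = N ⊔ (M₁ ⊔ M₂)
  M₁≤L : M₁ ℕ.≤ L
  M₁≤L = ℕ.≤-trans (ℕ.m≤m⊔n M₁ M₂) (ℕ.m≤n⊔m N (M₁ ⊔ M₂))
  M₂≤L : M₂ ℕ.≤ L
  M₂≤L = ℕ.≤-trans (ℕ.m≤n⊔m M₁ M₂) (ℕ.m≤n⊔m N (M₁ ⊔ M₂))
  decide : _ → t # x ⊎ t # y
  decide (yes p) = inj₁ (η , 0<η , L , λ n le → abs-near p (proj₂ (cauchy dx η 0<η) L n M₁≤L (ℕ.≤-trans M₁≤L le)))
  decide (no ¬p) = inj₂ (η , 0<η , L , λ n le → abs-near far (proj₂ (cauchy dy η 0<η) L n M₂≤L (ℕ.≤-trans M₂≤L le)))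
    where
    far : ½ ℚ.* ε ℚ.≤ ℚ.∣ seq t L ℚ.- seq y L ∣
    far = abs-near {p = seq x L ℚ.- seq y L} (subst (ε ℚ.≤_) (trans (sym (ℚ.∣-p∣≡∣p∣ _)) (trans (cong ℚ.∣_∣ (neg-sub (seq x L) (seq y L)))
            (trans (sym (ℚ.∣-p∣≡∣p∣ _)) (cong ℚ.∣_∣ (neg-sub (seq y L) (seq x L)))))) (h L (ℕ.m≤m⊔n N (M₁ ⊔ M₂))))
      (subst (ℚ._< ½ ℚ.* ε) (trans (sym (ℚ.∣-p∣≡∣p∣ _)) (cong ℚ.∣_∣
        (solve 3 (λ t x y → :- (t :- x) := x :- y :- (t :- y)) refl (seq t L) (seq x L) (seq y L)))) (ℚ.≰⇒> ¬p))

private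
  p-0 : ∀ p → p ℚ.- 0ℚ ≡ p
  p-0 = ℚ.+-identityʳ

#⇒-#0 : ∀ x y → x # y → (x +ʳ -ʳ y) # 0ℝ
#⇒-#0 x y (ε , 0<ε , N , h) = ε , 0<ε , N , λ n le →
  subst (λ p → ε ℚ.≤ ℚ.∣ p ∣) (sym (p-0 (seq x n ℚ.- seq y n))) (h n le)

-≃0⇒≃ : ∀ x y → x +ʳ -ʳ y ≃ 0ℝ → x ≃ y
-≃0⇒≃ x y e = mk≃ (Null₁.null-cong (λ n → p-0 (seq x n ℚ.- seq y n)) (null e))

-- Eventually `|x| ≥ ε`, so `|x y| < ε η` forces `|y| < η`. This takes the place of division.
#0-cancel : ∀ x y → x # 0ℝ → x *ʳ y ≃ 0ℝ → y ≃ 0ℝ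
#0-cancel x y (ε , 0<ε , N , h) e = mk≃ λ η 0<η →
  let 0<εη = ℚ.positive⁻¹ (ε ℚ.* η) {{ℚ.pos*pos⇒pos ε {{ℚ.positive 0<ε}} η {{ℚ.positive 0<η}}}}
      M , g = null e (ε ℚ.* η) 0<εη
  in M ⊔ N , λ n le → ℚ.≰⇒> λ η≤ → ℚ.<-irrefl refl (ℚ.<-≤-trans (g n (ℕ.≤-trans (ℕ.m≤m⊔n M N) le))
       (subst (ε ℚ.* η ℚ.≤_) (trans (sym (ℚ.∣p*q∣≡∣p∣*∣q∣ (seq x n) (seq y n))) (cong ℚ.∣_∣ (sym (p-0 (seq x n ℚ.* seq y n)))))
         (*-mono-≤ (ℚ.<⇒≤ 0<ε) (ℚ.<⇒≤ 0<η)
           (subst (λ p → ε ℚ.≤ ℚ.∣ p ∣) (p-0 (seq x n)) (h n (ℕ.≤-trans (ℕ.m≤n⊔m M N) le)))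
           (subst (λ p → η ℚ.≤ ℚ.∣ p ∣) (p-0 (seq y n)) η≤))))

-- Roots of a product of linear factors, and separated values

∏- : ∀ {r} → (Fin r → ℝ) → ℝ → ℝ
∏- {zero}  θ t = 1ℝ
∏- {suc r} θ t = (t +ʳ -ʳ θ zero) *ʳ ∏- (θ ∘ suc) t

all-or : ∀ {n} {A : Set} {B : Fin n → Set} → (∀ i → A ⊎ B i) → A ⊎ (∀ i → B i)
all-or {zero}  f = inj₂ λ ()
all-or {suc n} f with f zero | all-or (f ∘ suc)
... | inj₁ a | _      = inj₁ a
... | inj₂ _ | inj₁ a = inj₁ a
... | inj₂ b | inj₂ g = inj₂ λ { zero → b ; (suc i) → g i }

∏-cancel : ∀ {r} (θ : Fin r → ℝ) {t} x → (∀ i → t # θ i) → x *ʳ ∏- θ t ≃ 0ℝ → x ≃ 0ℝ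
∏-cancel {zero}  θ x ap e = ≃-trans (≃-sym (ℝʳ.*-identityʳ x)) e
∏-cancel {suc r} θ {t} x ap e = #0-cancel (t +ʳ -ʳ θ zero) x (#⇒-#0 t (θ zero) (ap zero)) (≃-trans (ℝʳ.*-comm (t +ʳ -ʳ θ zero) x)
  (∏-cancel (θ ∘ suc) (x *ʳ (t +ʳ -ʳ θ zero)) (ap ∘ suc) (≃-trans (ℝʳ.*-assoc x (t +ʳ -ʳ θ zero) (∏- (θ ∘ suc) t)) e)))

-- A vanishing product of reals does not by itself reveal which factor vanishes. Since the `θ i` are
-- apart, cotransitivity decides: either `t` is apart from the first root and that factor is
-- cancelled, or it is apart from all the others and their product is cancelled.
roots : ∀ {r} (θ : Fin r → ℝ) → (∀ i j → i ≢ j → θ i # θ j) → ∀ t → ∏- θ t ≃ 0ℝ → ∃[ i ] t ≃ θ i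
roots {zero}  θ ap t e = ⊥-elim (ℚ.<-irrefl (sym (fromℚ-injective {1ℚ} {0ℚ} e)) 0<1)
roots {suc r} θ ap t e with all-or (λ j → #-cotrans (θ zero) (θ (suc j)) (ap zero (suc j) λ ()) t)
... | inj₁ t#θ₀ = let i , p = roots (θ ∘ suc) (λ i j ne → ap (suc i) (suc j) (ne ∘ Fin.suc-injective)) t (#0-cancel (t +ʳ -ʳ θ zero) (∏- (θ ∘ suc) t) (#⇒-#0 t (θ zero) t#θ₀) e)
                  in suc i , p
... | inj₂ t#θ  = zero , -≃0⇒≃ t (θ zero) (∏-cancel (θ ∘ suc) (t +ʳ -ʳ θ zero) t#θ e)

-- A gap of 1 at every index, stronger than the order of the reals. It is transitive and yields
-- apartness with no search for a threshold.
_⊏_ : ℝ → ℝ → Set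
x ⊏ y = ∀ n → seq x n ℚ.+ 1ℚ ℚ.≤ seq y n

⊏-trans : ∀ x y z → x ⊏ y → y ⊏ z → x ⊏ z
⊏-trans x y z p q n = ℚ.≤-trans (p n) (ℚ.≤-trans (subst (ℚ._≤ seq y n ℚ.+ 1ℚ) (ℚ.+-identityʳ _) (ℚ.+-monoʳ-≤ (seq y n) (ℚ.<⇒≤ 0<1))) (q n))

⊏⇒#˘ : ∀ x y → x ⊏ y → y # x
⊏⇒#˘ x y p = 1ℚ , 0<1 , 0 , λ n _ →
  let h = ≤-sub {1ℚ} {seq x n} (subst (ℚ._≤ seq y n) (ℚ.+-comm (seq x n) 1ℚ) (p n))
  in subst (1ℚ ℚ.≤_) (sym (ℚ.0≤p⇒∣p∣≡p (ℚ.≤-trans (ℚ.<⇒≤ 0<1) h))) h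

#-sym : ∀ x y → x # y → y # x
#-sym x y (ε , 0<ε , N , h) = ε , 0<ε , N , λ n le →
  subst (ε ℚ.≤_) (trans (sym (ℚ.∣-p∣≡∣p∣ _)) (cong ℚ.∣_∣ (neg-sub (seq x n) (seq y n)))) (h n le)

neg-⊏ : ∀ x y → x ⊏ y → (-ʳ y) ⊏ (-ʳ x)
neg-⊏ x y p n = subst₂ ℚ._≤_ refl
  (solve 1 (λ x → :- (x :+ con 1ℚ) :+ con 1ℚ := :- x) refl (seq x n))
  (ℚ.+-monoˡ-≤ 1ℚ (ℚ.neg-antimono-≤ (p n)))

⊏-chain : ∀ {r} (θ : Fin (suc r) → ℝ) → (∀ i → θ (inject₁ i) ⊏ θ (suc i)) → ∀ i j → i Fin.< j → θ i ⊏ θ j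
⊏-chain {suc r} θ h zero    (suc zero)    _ = h zero
⊏-chain {suc r} θ h zero    (suc (suc j)) _ = ⊏-trans (θ zero) (θ (suc zero)) (θ (suc (suc j))) (h zero) (⊏-chain (θ ∘ suc) (h ∘ suc) zero (suc j) (s≤s z≤n))
⊏-chain {suc r} θ h (suc i) (suc j)       p = ⊏-chain (θ ∘ suc) (h ∘ suc) i j (ℕ.s≤s⁻¹ p)

⊏-apart : ∀ {r} (θ : Fin (suc r) → ℝ) → (∀ i → θ (inject₁ i) ⊏ θ (suc i)) → ∀ i j → i ≢ j → θ i # θ j
⊏-apart θ h i j ne with Fin.<-cmp i j
... | tri< p _ _ = #-sym (θ j) (θ i) (⊏⇒#˘ (θ i) (θ j) (⊏-chain θ h i j p))
... | tri≈ _ p _ = contradiction p ne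
... | tri> _ _ p = ⊏⇒#˘ (θ j) (θ i) (⊏-chain θ h j i p)

suc≤square : ∀ {n} → 2 ℕ.≤ n → suc n ℕ.≤ n ℕ.* n
suc≤square {n} 2≤n = ℕ.≤-trans (ℕ.+-monoˡ-≤ n (ℕ.≤-trans (s≤s z≤n) 2≤n))
  (ℕ.≤-trans (ℕ.≤-reflexive (cong (n ℕ.+_) (sym (ℕ.+-identityʳ n)))) (ℕ.*-monoˡ-≤ n 2≤n))

-- The spectrum

module Eigenvalues {v k : ℕ} (Γ : Graph (Fin v)) (k≡ : k ≡ suc (half k ℕ.+ half k)) (1≤μ : 1 ℕ.≤ half k)
                   (5≤k : 5 ℕ.≤ k) (𝒜 : Antipodal k Γ) (x₀ : Fin v) where
  open CommutativeRing ℝ-commutativeRing using (setoid; +-cong; +-congˡ; +-congʳ; *-congˡ; *-congʳ; zeroˡ; zeroʳ; reflexive)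
  open RingSums ℝ-commutativeRing using (⟪_⟫; ·-homo-+; sum-0; sum-∧)
  open Antipodal 𝒜
  open AntipodalProperties Γ k≡ 1≤μ 𝒜
  open RingAdjacency ℝ-commutativeRing Γ k≡ 1≤μ 𝒜
  open Sqrt k using (√; √²; approx-≥; approx-≤)
  open import Relation.Binary.Reasoning.Setoid setoid

  private
    V = Fin v
    A = adjacencyMatrix (adj Γ)
    K m : ℝ
    K = ι k
    m = ι (half k)

  K≃ : K ≃ 1ℝ +ʳ (m +ʳ m)
  K≃ = ≃-trans (reflexive (cong ι k≡)) (+-congˡ (·-homo-+ 1ℝ (half k) (half k)))

  -- Listed in increasing order, so that the five consecutive gaps give all apartness relations.
  θ : Fin 6 → ℝ
  θ 0F = -ʳ K
  θ 1F = -ʳ √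
  θ 2F = -ʳ 1ℝ
  θ 3F = 1ℝ
  θ 4F = √
  θ 5F = K

  1⊏√ : 1ℝ ⊏ √
  -- A gap of 1 above 1 means `2 ≤ √k`, that is `4 ≤ k`.
  1⊏√ = approx-≥ {2} (ℕ.≤-trans (ℕ.n≤1+n 4) 5≤k)

  √⊏K : √ ⊏ K
  -- The bound needed is `√k ≤ k − 1 = 2μ`, which follows from `k ≤ (k − 1)²`.
  √⊏K n = subst (seq √ n ℚ.+ 1ℚ ℚ.≤_)
      (trans (ℚ.+-comm (ιℚ (μ ℕ.+ μ)) 1ℚ) (trans (cong ιℚ (sym k≡)) (sym (seq-ι k n))))
      (ℚ.+-monoˡ-≤ 1ℚ (approx-≤ {μ ℕ.+ μ} (subst (ℕ._≤ (μ ℕ.+ μ) ℕ.* (μ ℕ.+ μ)) (sym k≡)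
        (suc≤square (ℕ.≤-trans (s≤s (s≤s z≤n)) (ℕ.s≤s⁻¹ (subst (5 ℕ.≤_) k≡ 5≤k))))) n))
    where
    μ = half k

  θ-gap : ∀ i → θ (inject₁ i) ⊏ θ (suc i)
  θ-gap 0F = neg-⊏ √ K √⊏K
  θ-gap 1F = neg-⊏ 1ℝ √ 1⊏√
  θ-gap 2F n = ℚ.<⇒≤ 0<1
  θ-gap 3F = 1⊏√
  θ-gap 4F = √⊏K

  θ-apart : ∀ i j → i ≢ j → θ i # θ j
  θ-apart = ⊏-apart θ θ-gap

  ≃⇒-≃0 : ∀ {x y} → x ≃ y → x +ʳ -ʳ y ≃ 0ℝ
  ≃⇒-≃0 {x} {y} e = ≃-trans (+-congʳ e) (≗⇒≃ λ n → ℚ.+-inverseʳ (seq y n))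

  module _ (t : ℝ) (u : V → ℝ) (eigen : ∀ x → apply u x ≃ t *ʳ u x) where

    private
      t² = t *ʳ t

    apply-twice : ∀ x → apply (apply u) x ≃ t² *ʳ u x
    apply-twice x = begin
      apply (apply u) x        ≈⟨ apply-cong eigen x ⟩
      apply (λ z → t *ʳ u z) x ≈⟨ sum-scale (a x) t u ⟩
      t *ʳ apply u x           ≈⟨ *-congˡ (eigen x) ⟩
      t *ʳ (t *ʳ u x)          ≈⟨ ≗⇒≃ (λ n → sym (ℚ.*-assoc (seq t n) (seq t n) (seq (u x) n))) ⟩
      t² *ʳ u x                 ∎

    classSum-eigen : ∀ c → t *ʳ classSum c u ≃ K *ʳ classSum (not c) u
    classSum-eigen c = begin
      t *ʳ classSum c u             ≈⟨ sum-scale (λ z → same c (colour z)) t u ⟨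
      classSum c (λ z → t *ʳ u z)   ≈⟨ classSum-cong c eigen ⟨
      classSum c (apply u)          ≈⟨ classSum-apply c u ⟩
      K *ʳ classSum (not c) u       ∎

    classSum-twice : ∀ c → t² *ʳ classSum c u ≃ (K *ʳ K) *ʳ classSum c u
    classSum-twice c = begin
      t² *ʳ classSum c u                  ≈⟨ ≗⇒≃ (λ n → ℚ.*-assoc (seq t n) (seq t n) (seq (classSum c u) n)) ⟩
      t *ʳ (t *ʳ classSum c u)           ≈⟨ *-congˡ (classSum-eigen c) ⟩
      t *ʳ (K *ʳ classSum (not c) u)     ≈⟨ ≗⇒≃ (λ n → solve 3 (λ t K S → t :* (K :* S) := K :* (t :* S)) refl (seq t n) (seq K n) (seq (classSum (not c) u) n)) ⟩
      K *ʳ (t *ʳ classSum (not c) u)     ≈⟨ *-congˡ (classSum-eigen (not c)) ⟩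
      K *ʳ (K *ʳ classSum (not (not c)) u) ≈⟨ *-congˡ (*-congˡ (reflexive (cong (λ c → classSum c u) (not-involutive c)))) ⟩
      K *ʳ (K *ʳ classSum c u)           ≈⟨ ≗⇒≃ (λ n → sym (ℚ.*-assoc (seq K n) (seq K n) (seq (classSum c u) n))) ⟩
      (K *ʳ K) *ʳ classSum c u           ∎

    2ℝ : ℝ
    2ℝ = 1ℝ +ʳ 1ℝ

    -- Put `p = u x`, `q = u (τ x)` and let `S` be the class sum. `square` at `x` and at `τ x` gives
    -- `(t² − 1)(p + q) = 2μS` by addition and `(t² − k)(p − q) = 0` by subtraction, while
    -- `(t² − k²)S = 0`. Eliminating `q` and `S` leaves a multiple of `p`; the factor 2 comes from
    -- `2p = (p + q) + (p − q)`.
    minimal : ∀ x → u x *ʳ (2ℝ *ʳ ∏- θ t) ≃ 0ℝ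
    minimal x = begin
      p *ʳ (2ℝ *ʳ ∏- θ t)                             ≈⟨ *-congˡ (*-congˡ factor) ⟩
      p *ʳ (2ℝ *ʳ ((t² - KK) *ʳ ((t² - ss) *ʳ (t² - 1ℝ)))) ≈⟨ *-congˡ (*-congˡ (*-congˡ (*-congʳ (+-congˡ (-ʳ-cong √²))))) ⟩
      p *ʳ (2ℝ *ʳ ((t² - KK) *ʳ ((t² - K) *ʳ (t² - 1ℝ))))  ≈⟨ combine ⟩
      -- Each bracket vanishes: `e₁ + e₂ + e₄(p + q)` is `(t² − 1)(p + q) − 2μS`, where `e₄` trades
      -- `k` for `1 + 2μ`; `e₁ − e₂` is `(t² − k)(p − q)`; and `e₃` is `(t² − k²)S`.
      (t² - K) *ʳ (t² - KK) *ʳ (e₁ +ʳ e₂ +ʳ e₄ *ʳ (p +ʳ q)) +ʳ (t² - 1ℝ) *ʳ (t² - KK) *ʳ (e₁ - e₂) +ʳ 2ℝ *ʳ m *ʳ (t² - K) *ʳ e₃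
        ≈⟨ +-cong (+-cong (*-congˡ (+-cong (+-cong e₁≃0 e₂≃0) (*-congʳ e₄≃0))) (*-congˡ (+-cong e₁≃0 (-ʳ-cong e₂≃0)))) (*-congˡ e₃≃0) ⟩
      (t² - K) *ʳ (t² - KK) *ʳ (0ℝ +ʳ 0ℝ +ʳ 0ℝ *ʳ (p +ʳ q)) +ʳ (t² - 1ℝ) *ʳ (t² - KK) *ʳ (0ℝ - 0ℝ) +ʳ 2ℝ *ʳ m *ʳ (t² - K) *ʳ 0ℝ
        ≈⟨ ≗⇒≃ (λ n → solve 5 (λ a b c d e → a :* (con 0ℚ :+ con 0ℚ :+ con 0ℚ :* (d :+ e)) :+ b :* (con 0ℚ :- con 0ℚ) :+ c :* con 0ℚ := con 0ℚ) refl
             (seq ((t² - K) *ʳ (t² - KK)) n) (seq ((t² - 1ℝ) *ʳ (t² - KK)) n) (seq (2ℝ *ʳ m *ʳ (t² - K)) n) (seq p n) (seq q n)) ⟩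
      0ℝ ∎
      where
      infixl 6 _-_
      _-_ : ℝ → ℝ → ℝ
      y - z = y +ʳ -ʳ z
      p = u x
      q = u (τ x)
      S = classSum (colour x) u
      KK = K *ʳ K
      ss = √ *ʳ √
      e₁ e₂ e₃ e₄ : ℝ
      e₁ = t² *ʳ p +ʳ (m *ʳ p +ʳ m *ʳ q) - (K *ʳ p +ʳ m *ʳ S)
      e₂ = t² *ʳ q +ʳ (m *ʳ q +ʳ m *ʳ p) - (K *ʳ q +ʳ m *ʳ S)
      e₃ = t² *ʳ S - KK *ʳ S
      e₄ = K - (1ℝ +ʳ (m +ʳ m))
      e₁≃0 : e₁ ≃ 0ℝ
      e₁≃0 = ≃⇒-≃0 (≃-trans (+-congʳ (≃-sym (apply-twice x))) (square u x))
      e₂≃0 : e₂ ≃ 0ℝ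
      e₂≃0 = ≃⇒-≃0 (≃-trans (+-cong (≃-sym (apply-twice (τ x))) (+-congˡ (*-congˡ (reflexive (cong u (sym (τ-invol x)))))))
        (≃-trans (square u (τ x)) (+-congˡ (*-congˡ (reflexive (cong (λ c → classSum c u) (τ-colour x)))))))
      e₃≃0 : e₃ ≃ 0ℝ
      e₃≃0 = ≃⇒-≃0 (classSum-twice (colour x))
      e₄≃0 : e₄ ≃ 0ℝ
      e₄≃0 = ≃⇒-≃0 K≃
      factor : ∏- θ t ≃ (t² - KK) *ʳ ((t² - ss) *ʳ (t² - 1ℝ))
      factor = ≗⇒≃ λ n → solve 3 (λ t K s →
        (t :- :- K) :* ((t :- :- s) :* ((t :- :- con 1ℚ) :* ((t :- con 1ℚ) :* ((t :- s) :* ((t :- K) :* con 1ℚ)))))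
        := (t :* t :- K :* K) :* ((t :* t :- s :* s) :* (t :* t :- con 1ℚ))) refl (seq t n) (seq K n) (seq √ n)
      combine : p *ʳ (2ℝ *ʳ ((t² - KK) *ʳ ((t² - K) *ʳ (t² - 1ℝ)))) ≃
        (t² - K) *ʳ (t² - KK) *ʳ (e₁ +ʳ e₂ +ʳ e₄ *ʳ (p +ʳ q)) +ʳ (t² - 1ℝ) *ʳ (t² - KK) *ʳ (e₁ - e₂) +ʳ 2ℝ *ʳ m *ʳ (t² - K) *ʳ e₃
      combine = ≗⇒≃ λ n → solve 6 (λ t² K m p q S →
        let e₁ = t² :* p :+ (m :* p :+ m :* q) :- (K :* p :+ m :* S)
            e₂ = t² :* q :+ (m :* q :+ m :* p) :- (K :* q :+ m :* S)
            e₃ = t² :* S :- K :* K :* S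
            e₄ = K :- (con 1ℚ :+ (m :+ m))
            two = con 1ℚ :+ con 1ℚ
        in p :* (two :* ((t² :- K :* K) :* ((t² :- K) :* (t² :- con 1ℚ))))
           := (t² :- K) :* (t² :- K :* K) :* (e₁ :+ e₂ :+ e₄ :* (p :+ q)) :+ (t² :- con 1ℚ) :* (t² :- K :* K) :* (e₁ :- e₂) :+ two :* m :* (t² :- K) :* e₃)
        refl (seq t² n) (seq K n) (seq m n) (seq p n) (seq q n) (seq S n)

  eigenvalue-root : ∀ t → IsEigenvalue A t → ∃[ i ] t ≃ θ i
  eigenvalue-root t (u , (x , ux#0) , eigen) = roots θ θ-apart t
    (#0-cancel (1ℝ +ʳ 1ℝ) (∏- θ t) (1ℚ , 0<1 , 0 , λ n _ → ℚ.<⇒≤ 1<2)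
      (#0-cancel (u x) ((1ℝ +ʳ 1ℝ) *ʳ ∏- θ t) ux#0 (minimal t u eigen x)))
    where
    1<2 : 1ℚ ℚ.< 1ℚ ℚ.+ 1ℚ
    1<2 = ℚ.+-monoʳ-< 1ℚ 0<1

  apply-0 : ∀ {w x} → (∀ z → colour z ≡ not (colour x) → w z ≃ 0ℝ) → apply w x ≃ 0ℝ
  apply-0 {w} {x} h = sum-0 {f = λ z → ⟪ a x z ⟫ *ʳ w z} λ z → term z
    where
    term : ∀ z → ⟪ a x z ⟫ *ʳ w z ≃ 0ℝ
    term z with a x z in e
    ... | true  = ≃-trans (*-congˡ (h z (proper e))) (zeroʳ 1ℝ)
    ... | false = zeroˡ (w z)

  -- If w lives on the colour class of x and A²w = θ²w, then Aw + θw is a θ-eigenvector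
  -- whose entry at x is θ w(x).
  eigenvector : ∀ θ (w : V → ℝ) x → (∀ z → apply (apply w) z ≃ (θ *ʳ θ) *ʳ w z) →
                (∀ z → colour z ≡ not (colour x) → w z ≃ 0ℝ) → w x ≃ 1ℝ → θ # 0ℝ → IsEigenvalue A θ
  eigenvector θ w x h support wx θ#0 = u , (x , #-respˡ θ (u x) 0ℝ (≃-sym ux) θ#0) , λ z → begin
      apply u z                                             ≈⟨ sum-add (a z) (apply w) (λ y → θ *ʳ w y) ⟩
      apply (apply w) z +ʳ apply (λ y → θ *ʳ w y) z         ≈⟨ +-cong (h z) (sum-scale (a z) θ w) ⟩
      (θ *ʳ θ) *ʳ w z +ʳ θ *ʳ apply w z
        ≈⟨ ≗⇒≃ (λ n → solve 3 (λ θ w b → (θ :* θ) :* w :+ θ :* b := θ :* (b :+ θ :* w)) refl (seq θ n) (seq (w z) n) (seq (apply w z) n)) ⟩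
      θ *ʳ u z ∎
    where
    u : V → ℝ
    u z = apply w z +ʳ θ *ʳ w z
    ux : u x ≃ θ
    ux = ≃-trans (+-cong (apply-0 support) (*-congˡ wx))
      (≗⇒≃ λ n → solve 1 (λ θ → con 0ℚ :+ θ :* con 1ℚ := θ) refl (seq θ n))

  -1ʳ : ℝ
  -1ʳ = -ʳ 1ℝ

  e : V → V → ℝ
  e x z = ⟪ x == z ⟫

  e-refl : ∀ x → e x x ≃ 1ℝ
  e-refl x = reflexive (cong ⟪_⟫ (==-refl x))

  e-≢ : ∀ {x z} → x ≢ z → e x z ≃ 0ℝ
  e-≢ ne = reflexive (cong ⟪_⟫ (==-≢ ne))

  e-colour : ∀ {x y} z → colour x ≡ colour y → colour z ≡ not (colour y) → e x z ≃ 0ℝ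
  e-colour z s ne = e-≢ λ { refl → not-¬ s ne }

  e-τ : ∀ x z → e x (τ z) ≃ e (τ x) z
  e-τ x z = reflexive (cong ⟪_⟫ (bool-ext
    (λ p → ==-≡ (trans (cong τ (==⇒≡ p)) (τ-invol z)))
    (λ p → ==-≡ (trans (sym (τ-invol x)) (cong τ (==⇒≡ p))))))

  e-τ′ : ∀ x z → e (τ x) (τ z) ≃ e x z
  e-τ′ x z = ≃-trans (e-τ (τ x) z) (reflexive (cong (λ y → e y z) (τ-invol x)))

  module _ (x : V) where

    -- Seeds for `eigenvector`: the indicator of a colour class, on which A² is `k²`, and
    -- `e x − e (τ x)`, which τ negates, so that A² is `k` on it.
    wK w√ : V → ℝ
    wK z = ⟪ same (colour x) (colour z) ⟫
    w√ z = e x z +ʳ -1ʳ *ʳ e (τ x) z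

    classSum-wK : ∀ c → classSum c wK ≃ (1ℝ +ʳ (1ℝ +ʳ (K +ʳ K))) *ʳ ⟪ same (colour x) c ⟫
    classSum-wK c = ≃-trans (sum-∧ (λ z → same c (colour z)) (λ z → same (colour x) (colour z))) (lem (same (colour x) c) refl)
      where
      N = card (λ z → same c (colour z) ∧ same (colour x) (colour z))
      lem : ∀ b → same (colour x) c ≡ b → ι N ≃ (1ℝ +ʳ (1ℝ +ʳ (K +ʳ K))) *ʳ ⟪ b ⟫
      lem true s = ≃-trans (reflexive (cong ι (trans (card-cong λ z → trans (cong (λ d → same c (colour z) ∧ same d (colour z)) (same⇒≡ {colour x} s)) (∧-idem _)) (classSize c))))
        (≃-trans (+-congˡ (+-congˡ (·-homo-+ 1ℝ k k))) (≗⇒≃ λ n → sym (ℚ.*-identityʳ _)))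
      lem false s = ≃-trans (reflexive (cong ι (card-false λ z → ≢true⇒≡false λ p →
          not-¬ (trans (same⇒≡ {c} (∧-trueˡ p)) (sym (same⇒≡ {colour x} (∧-trueʳ {same c (colour z)} p)))) (same-false {colour x} s))))
        (≃-sym (zeroʳ (1ℝ +ʳ (1ℝ +ʳ (K +ʳ K)))))

    square-wK : ∀ z → apply (apply wK) z ≃ (K *ʳ K) *ʳ wK z
    square-wK z = begin
      -- The terms `μ w + μ w` are added and taken away again to match the left side of `square`.
      B                                                   ≈⟨ ≗⇒≃ (λ n → solve 3 (λ b m w → b := b :+ (m :* w :+ m :* w) :- (m :* w :+ m :* w)) refl (seq B n) (seq m n) (seq w n)) ⟩
      B +ʳ (m *ʳ w +ʳ m *ʳ w) +ʳ -ʳ (m *ʳ w +ʳ m *ʳ w)      ≈⟨ +-congʳ (+-congˡ (+-congˡ (*-congˡ (reflexive (cong (λ c → ⟪ same (colour x) c ⟫) (sym (τ-colour z))))))) ⟩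
      B +ʳ (m *ʳ w +ʳ m *ʳ wK (τ z)) +ʳ -ʳ (m *ʳ w +ʳ m *ʳ w) ≈⟨ +-congʳ (square wK z) ⟩
      K *ʳ w +ʳ m *ʳ classSum (colour z) wK +ʳ -ʳ (m *ʳ w +ʳ m *ʳ w) ≈⟨ +-congʳ (+-congˡ (*-congˡ (classSum-wK (colour z)))) ⟩
      K *ʳ w +ʳ m *ʳ ((1ℝ +ʳ (1ℝ +ʳ (K +ʳ K))) *ʳ w) +ʳ -ʳ (m *ʳ w +ʳ m *ʳ w)
        ≈⟨ ≗⇒≃ (λ n → solve 3 (λ K m w → K :* w :+ m :* ((con 1ℚ :+ (con 1ℚ :+ (K :+ K))) :* w) :- (m :* w :+ m :* w) := (K :* (con 1ℚ :+ (m :+ m))) :* w) refl (seq K n) (seq m n) (seq w n)) ⟩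
      (K *ʳ (1ℝ +ʳ (m +ʳ m))) *ʳ w                         ≈⟨ *-congʳ (*-congˡ (≃-sym K≃)) ⟩
      (K *ʳ K) *ʳ w                                        ∎
      where
      w = wK z
      B = apply (apply wK) z

    classSum-w√ : ∀ c → classSum c w√ ≃ 0ℝ
    classSum-w√ c = begin
      classSum c w√                                               ≈⟨ sum-add (λ z → same c (colour z)) (e x) (λ z → -1ʳ *ʳ e (τ x) z) ⟩
      classSum c (e x) +ʳ classSum c (λ z → -1ʳ *ʳ e (τ x) z)      ≈⟨ +-congˡ (sum-scale (λ z → same c (colour z)) -1ʳ (e (τ x))) ⟩
      classSum c (e x) +ʳ -1ʳ *ʳ classSum c (e (τ x))              ≈⟨ +-cong (classSum-δ c x) (*-congˡ (classSum-δ c (τ x))) ⟩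
      ⟪ same c (colour x) ⟫ +ʳ -1ʳ *ʳ ⟪ same c (colour (τ x)) ⟫     ≈⟨ +-congˡ (*-congˡ (reflexive (cong (λ d → ⟪ same c d ⟫) (τ-colour x)))) ⟩
      ⟪ same c (colour x) ⟫ +ʳ -1ʳ *ʳ ⟪ same c (colour x) ⟫         ≈⟨ ≗⇒≃ (λ n → solve 1 (λ s → s :+ (:- con 1ℚ) :* s := con 0ℚ) refl (seq ⟪ same c (colour x) ⟫ n)) ⟩
      0ℝ                                                          ∎

    square-w√ : ∀ z → apply (apply w√) z ≃ K *ʳ w√ z
    square-w√ z = begin
      B                                     ≈⟨ ≗⇒≃ (λ n → solve 4 (λ b m p q → b := b :+ (m :* (p :+ (:- con 1ℚ) :* q) :+ m :* (q :+ (:- con 1ℚ) :* p))) refl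
                                                   (seq B n) (seq m n) (seq (e x z) n) (seq (e (τ x) z) n)) ⟩
      B +ʳ (m *ʳ w√ z +ʳ m *ʳ (e (τ x) z +ʳ -1ʳ *ʳ e x z)) ≈⟨ +-congˡ (+-congˡ (*-congˡ (+-cong (≃-sym (e-τ x z)) (*-congˡ (≃-sym (e-τ′ x z)))))) ⟩
      B +ʳ (m *ʳ w√ z +ʳ m *ʳ w√ (τ z))      ≈⟨ square w√ z ⟩
      K *ʳ w√ z +ʳ m *ʳ classSum (colour z) w√ ≈⟨ +-congˡ (≃-trans (*-congˡ (classSum-w√ (colour z))) (zeroʳ m)) ⟩
      K *ʳ w√ z +ʳ 0ℝ                       ≈⟨ ≗⇒≃ (λ n → ℚ.+-identityʳ (seq (K *ʳ w√ z) n)) ⟩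
      K *ʳ w√ z                             ∎
      where B = apply (apply w√) z

  module _ {x y : V} (s : colour x ≡ colour y) (x≢y : x ≢ y) (τx≢y : τ x ≢ y) where

    -- Invariant under τ with zero class sums, hence fixed by A². The second pair `y`, `τ y` in the
    -- same class is there to cancel the sum over the first.
    w₁ : V → ℝ
    w₁ z = (e x z +ʳ e (τ x) z) +ʳ -1ʳ *ʳ (e y z +ʳ e (τ y) z)

    classSum-pair : ∀ c x → classSum c (λ z → e x z +ʳ e (τ x) z) ≃ ⟪ same c (colour x) ⟫ +ʳ ⟪ same c (colour x) ⟫
    classSum-pair c x = ≃-trans (sum-add (λ z → same c (colour z)) (e x) (e (τ x)))
      (+-cong (classSum-δ c x) (≃-trans (classSum-δ c (τ x)) (reflexive (cong (λ d → ⟪ same c d ⟫) (τ-colour x)))))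

    classSum-w₁ : ∀ c → classSum c w₁ ≃ 0ℝ
    classSum-w₁ c = begin
      classSum c w₁ ≈⟨ sum-add (λ z → same c (colour z)) (λ z → e x z +ʳ e (τ x) z) (λ z → -1ʳ *ʳ (e y z +ʳ e (τ y) z)) ⟩
      classSum c (λ z → e x z +ʳ e (τ x) z) +ʳ classSum c (λ z → -1ʳ *ʳ (e y z +ʳ e (τ y) z))
        ≈⟨ +-cong (classSum-pair c x) (≃-trans (sum-scale (λ z → same c (colour z)) -1ʳ (λ z → e y z +ʳ e (τ y) z)) (*-congˡ (classSum-pair c y))) ⟩
      (σ +ʳ σ) +ʳ -1ʳ *ʳ (⟪ same c (colour y) ⟫ +ʳ ⟪ same c (colour y) ⟫)
        ≈⟨ +-congˡ (*-congˡ (reflexive (cong (λ d → ⟪ same c d ⟫ +ʳ ⟪ same c d ⟫) (sym s)))) ⟩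
      (σ +ʳ σ) +ʳ -1ʳ *ʳ (σ +ʳ σ) ≈⟨ ≗⇒≃ (λ n → solve 1 (λ s → (s :+ s) :+ (:- con 1ℚ) :* (s :+ s) := con 0ℚ) refl (seq σ n)) ⟩
      0ℝ ∎
      where σ = ⟪ same c (colour x) ⟫

    w₁-τ : ∀ z → w₁ (τ z) ≃ w₁ z
    w₁-τ z = +-cong (pair x) (*-congˡ (pair y))
      where
      pair : ∀ x → e x (τ z) +ʳ e (τ x) (τ z) ≃ e x z +ʳ e (τ x) z
      pair x = ≃-trans (+-cong (e-τ x z) (e-τ′ x z)) (≗⇒≃ λ n → ℚ.+-comm (seq (e (τ x) z) n) (seq (e x z) n))

    square-w₁ : ∀ z → apply (apply w₁) z ≃ (1ℝ *ʳ 1ℝ) *ʳ w₁ z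
    square-w₁ z = begin
      B                                                   ≈⟨ ≗⇒≃ (λ n → solve 3 (λ b m w → b := b :+ (m :* w :+ m :* w) :- (m :* w :+ m :* w)) refl (seq B n) (seq m n) (seq w n)) ⟩
      B +ʳ (m *ʳ w +ʳ m *ʳ w) +ʳ -ʳ (m *ʳ w +ʳ m *ʳ w)      ≈⟨ +-congʳ (+-congˡ (+-congˡ (*-congˡ (≃-sym (w₁-τ z))))) ⟩
      B +ʳ (m *ʳ w +ʳ m *ʳ w₁ (τ z)) +ʳ -ʳ (m *ʳ w +ʳ m *ʳ w) ≈⟨ +-congʳ (square w₁ z) ⟩
      K *ʳ w +ʳ m *ʳ classSum (colour z) w₁ +ʳ -ʳ (m *ʳ w +ʳ m *ʳ w) ≈⟨ +-congʳ (+-cong (*-congʳ K≃) (*-congˡ (classSum-w₁ (colour z)))) ⟩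
      (1ℝ +ʳ (m +ʳ m)) *ʳ w +ʳ m *ʳ 0ℝ +ʳ -ʳ (m *ʳ w +ʳ m *ʳ w)
        ≈⟨ ≗⇒≃ (λ n → solve 2 (λ m w → (con 1ℚ :+ (m :+ m)) :* w :+ m :* con 0ℚ :- (m :* w :+ m :* w) := (con 1ℚ :* con 1ℚ) :* w) refl (seq m n) (seq w n)) ⟩
      (1ℝ *ʳ 1ℝ) *ʳ w ∎
      where
      w = w₁ z
      B = apply (apply w₁) z

    support-w₁ : ∀ z → colour z ≡ not (colour x) → w₁ z ≃ 0ℝ
    support-w₁ z ne = ≃-trans (+-cong (+-cong (e-colour z refl ne) (e-colour z (τ-colour x) ne))
        (*-congˡ (+-cong (e-colour z (sym s) ne) (e-colour z (trans (τ-colour y) (sym s)) ne))))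
      (≗⇒≃ λ n → refl)

    w₁-x : w₁ x ≃ 1ℝ
    w₁-x = ≃-trans (+-cong (+-cong (e-refl x) (e-≢ (τ-≢ x))) (*-congˡ (+-cong (e-≢ (x≢y ∘ sym)) (e-≢ (λ p → τx≢y (τ-swap p))))))
      (≗⇒≃ λ n → refl)

  support-wK : ∀ x z → colour z ≡ not (colour x) → wK x z ≃ 0ℝ
  support-wK x z ne = reflexive (cong ⟪_⟫ (same-not ne))

  wK-x : ∀ x → wK x x ≃ 1ℝ
  wK-x x = reflexive (cong ⟪_⟫ (same-≡ {colour x} refl))

  support-w√ : ∀ x z → colour z ≡ not (colour x) → w√ x z ≃ 0ℝ
  support-w√ x z ne = ≃-trans (+-cong (e-colour z refl ne) (*-congˡ (e-colour z (τ-colour x) ne))) (≗⇒≃ λ n → refl)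

  w√-x : ∀ x → w√ x x ≃ 1ℝ
  w√-x x = ≃-trans (+-cong (e-refl x) (*-congˡ (e-≢ (τ-≢ x)))) (≗⇒≃ λ n → refl)

  second : ∃[ y ] (colour x₀ ≡ colour y × x₀ ≢ y × τ x₀ ≢ y)
  second with card-exists (λ z → rel x₀ z == 2F) (subst (1 ℕ.≤_) (sym (Cells.sizes (cells x₀) 2F))
    (ℕ.≤-trans (ℕ.≤-trans (s≤s z≤n) 5≤k) (ℕ.m≤m+n k _)))
  ... | y , p with is2 s ne ne′ ← subst (Rel x₀ y) (==⇒≡ p) (rel-view x₀ y) = y , s , ne , ne′

  neg² : ∀ θ w z → apply (apply w) z ≃ (θ *ʳ θ) *ʳ w z → apply (apply w) z ≃ (-ʳ θ *ʳ -ʳ θ) *ʳ w z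
  neg² θ w z h = ≃-trans h (≗⇒≃ λ n → solve 2 (λ θ w → (θ :* θ) :* w := ((:- θ) :* (:- θ)) :* w) refl (seq θ n) (seq (w z) n))

  0⊏1 : 0ℝ ⊏ 1ℝ
  0⊏1 n = ℚ.≤-refl

  0⊏√ : 0ℝ ⊏ √
  0⊏√ = ⊏-trans 0ℝ 1ℝ √ 0⊏1 1⊏√

  0⊏K : 0ℝ ⊏ K
  0⊏K = ⊏-trans 0ℝ √ K 0⊏√ √⊏K

  neg-#0 : ∀ θ → 0ℝ ⊏ θ → (-ʳ θ) # 0ℝ
  neg-#0 θ p = #-sym 0ℝ (-ʳ θ) (⊏⇒#˘ (-ʳ θ) 0ℝ (neg-⊏ 0ℝ θ p))

  square-√ : ∀ z → apply (apply (w√ x₀)) z ≃ (√ *ʳ √) *ʳ w√ x₀ z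
  square-√ z = ≃-trans (square-w√ x₀ z) (*-congʳ (≃-sym √²))

  θ-eigenvalue : ∀ i → IsEigenvalue A (θ i)
  θ-eigenvalue i with y , s , ne , ne′ ← second = go i
    where
    go : ∀ i → IsEigenvalue A (θ i)
    -- Opposite values share a seed, since `eigenvector` asks only how A² acts on it.
    go 0F = eigenvector (-ʳ K) (wK x₀) x₀ (λ z → neg² K (wK x₀) z (square-wK x₀ z)) (support-wK x₀) (wK-x x₀) (neg-#0 K 0⊏K)
    go 1F = eigenvector (-ʳ √) (w√ x₀) x₀ (λ z → neg² √ (w√ x₀) z (square-√ z)) (support-w√ x₀) (w√-x x₀) (neg-#0 √ 0⊏√)
    go 2F = eigenvector (-ʳ 1ℝ) (w₁ s ne ne′) x₀ (λ z → neg² 1ℝ (w₁ s ne ne′) z (square-w₁ s ne ne′ z)) (support-w₁ s ne ne′) (w₁-x s ne ne′) (neg-#0 1ℝ 0⊏1)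
    go 3F = eigenvector 1ℝ (w₁ s ne ne′) x₀ (square-w₁ s ne ne′) (support-w₁ s ne ne′) (w₁-x s ne ne′) (⊏⇒#˘ 0ℝ 1ℝ 0⊏1)
    go 4F = eigenvector √ (w√ x₀) x₀ square-√ (support-w√ x₀) (w√-x x₀) (⊏⇒#˘ 0ℝ √ 0⊏√)
    go 5F = eigenvector K (wK x₀) x₀ (square-wK x₀) (support-wK x₀) (wK-x x₀) (⊏⇒#˘ 0ℝ K 0⊏K)

  six-eigenvalues : HasExactlyDistinctEigenvalues A 6
  six-eigenvalues = θ , θ-apart , θ-eigenvalue , eigenvalue-root

-- The equivalences and their consequences

module _ {k v : ℕ} (Γ : Graph (Fin v)) (5≤k : 5 ≤ k) (odd : k % 2 ≡ 1) (connected : Connected Γ)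
         (diameter : HasDiameter Γ 4) (ample : AmplyRegular v k 0 (half k) Γ) where

  private
    k≡ : k ≡ suc (half k + half k)
    k≡ = begin
      k                              ≡⟨ k-odd ⟩
      suc (k / 2 * 2)                ≡⟨ cong (λ q → suc (q * 2)) k/2 ⟩
      suc (half k * 2)               ≡⟨ cong suc (trans (ℕ.*-comm (half k) 2) (cong (half k +_) (ℕ.+-identityʳ (half k)))) ⟩
      suc (half k + half k)          ∎
      where
      open ≡-Reasoning
      k-odd : k ≡ suc (k / 2 * 2)
      k-odd = trans (m≡m%n+[m/n]*n k 2) (cong (_+ k / 2 * 2) odd)
      k/2 : k / 2 ≡ half k
      k/2 = sym (trans (cong half k-odd) (m*n/n≡m (k / 2) 2))

    1≤μ : 1 ≤ half k
    1≤μ with half k | k≡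
    ... | zero  | refl = contradiction 5≤k λ { (s≤s ()) }
    ... | suc _ | _    = s≤s z≤n

    x₀ : Fin v
    x₀ = proj₁ (proj₂ diameter)

    regular : ∀ x → card (adj Γ x) ≡ k
    regular x = trans (sym (∣tabulate∣ (adj Γ x))) (AmplyRegular.regular ample x)

    1⇒antipodal : BipartiteQRegular k Γ → Antipodal k Γ
    1⇒antipodal = antipodal-of-Qregular Γ 1≤μ x₀ connected regular

    2⇒antipodal : IsIncidenceGraphOfGDDDP k Γ → Antipodal k Γ
    2⇒antipodal = antipodal-of-GDDDP Γ regular

    antipodal⇒3 : Antipodal k Γ → IsRelationGraphWithDiagram k Γ
    antipodal⇒3 = relationGraph-of-antipodal Γ k≡ 1≤μ x₀

    3⇒based : IsRelationGraphWithDiagram k Γ → ∀ x → Based k Γ x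
    3⇒based = based-of-scheme

    -- The diagram joins only cells of opposite parity, so the parity of the cells at a single base
    -- vertex already 2-colours the graph.
    3⇒1 : IsRelationGraphWithDiagram k Γ → BipartiteQRegular k Γ
    3⇒1 S = based-bipartite (3⇒based S x₀) , unbased (ℕ.≤-trans (s≤s z≤n) 5≤k) (3⇒based S)

  equivalence₁₂ : BipartiteQRegular k Γ ⇔ IsIncidenceGraphOfGDDDP k Γ
  equivalence₁₂ = mk⇔ (GDDDP-of-antipodal ∘ 1⇒antipodal) (3⇒1 ∘ antipodal⇒3 ∘ 2⇒antipodal)

  equivalence₂₃ : IsIncidenceGraphOfGDDDP k Γ ⇔ IsRelationGraphWithDiagram k Γ
  equivalence₂₃ = mk⇔ (antipodal⇒3 ∘ 2⇒antipodal) (GDDDP-of-antipodal ∘ 1⇒antipodal ∘ 3⇒1)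

  consequences : IsRelationGraphWithDiagram k Γ →
    Bipartite Γ × WalkRegular 2 Γ × v ≡ 4 * k + 4 × HasDiameter Γ 4
    × HasExactlyDistinctEigenvalues (adjacencyMatrix (adj Γ)) 6
  consequences S = proj₁ (3⇒1 S) , walk-regular connected (3⇒based S) , Based.order (3⇒based S x₀) , diameter
    , Eigenvalues.six-eigenvalues Γ k≡ 1≤μ 5≤k (1⇒antipodal (3⇒1 S)) x₀

theorem3p3 : (k v : ℕ) (Γ : Graph (Fin v)) →
    5 ≤ k → k % 2 ≡ 1 →
    Connected Γ → HasDiameter Γ 4 → AmplyRegular v k 0 ((k ∸ 1) / 2) Γ →
    (BipartiteQRegular k Γ ⇔ IsIncidenceGraphOfGDDDP k Γ)
    × (IsIncidenceGraphOfGDDDP k Γ ⇔ IsRelationGraphWithDiagram k Γ)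
    × (IsRelationGraphWithDiagram k Γ →
    Bipartite Γ
    × WalkRegular 2 Γ
    × v ≡ 4 * k + 4
    × HasDiameter Γ 4
    × HasExactlyDistinctEigenvalues (adjacencyMatrix (adj Γ)) 6)
theorem3p3 k v Γ 5≤k odd connected diameter ample =
    equivalence₁₂ Γ 5≤k odd connected diameter ample
  , equivalence₂₃ Γ 5≤k odd connected diameter ample
  , consequences Γ 5≤k odd connected diameter ample
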